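{- Let $K,L,A$ be as in the context and suppose there is an $A$-scaffold on $L$ of tolerance $\mathfrak{T}\ge1$ with shift parameters $b_1,\dots,b_n$ (elements $\lambda_t$, $\Psi_i$). Let $h\in\mathbb{Z}$, and let $\mathfrak{A}$, $b$, $d$, $w$, $\Phi^{(s)}$ be as in the context. Under the strong assumption $\mathfrak{T}\ge p^n+b-h$: (i) $\mathfrak{A}$ has $\mathfrak{O}_K$-basis $\{\Phi^{(s)}:s\in\mathbb{S}_{p^n}\}$; (ii) $\mathfrak{P}_L^h$ is free over $\mathfrak{A}$ if and only if $w(s)=d(s)$ for all $s\in\mathbb{S}_{p^n}$; moreover, if this condition holds, then $\mathfrak{P}_L^h=\mathfrak{A}\cdot\rho$ for any $\rho\in L$ with $v_L(\rho)=b$. Under the weak assumption $\mathfrak{T}\ge\max(b-h,1)$: (iii) $\Phi^{(s)}\in\mathfrak{A}$ for all $s\in\mathbb{S}_{p^n}$; (iv) if $w(s)=d(s)$ for all $s\in\mathbb{S}_{p^n}$, then $\mathfrak{A}$ has $\mathfrak{O}_K$-basis $\{\Phi^{(s)}:s\in\mathbb{S}_{p^n}\}$ and $\mathfrak{P}_L^h$ is free over $\mathfrak{A}$ with $\mathfrak{P}_L^h=\mathfrak{A}\cdot\lambda_b$.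
   Context: Let $K$ be a field complete with respect to a discrete valuation, with residue field $\kappa$ of characteristic $p>0$ ($\kappa$ need not be perfect; $K$ may have characteristic $0$ or $p$). Let $L/K$ be a totally ramified field extension of degree $p^n$; $v_K,v_L$ normalized valuations ($v_K(K^\times)=v_L(L^\times)=\mathbb{Z}$), $\mathfrak{O}_K,\mathfrak{O}_L$ valuation rings, $\mathfrak{P}_K,\mathfrak{P}_L$ maximal ideals. Let $A$ be a $K$-algebra with $\dim_K A=p^n$ acting $K$-linearly on $L$, written $\alpha\cdot x$. Let $\mathbb{S}_{p^n}=\{0,\dots,p^n-1\}$; write $s=\sum_{i=1}^n s_{(n-i)}p^{n-i}$ with digits $s_{(n-i)}\in\{0,\dots,p-1\}$, and $s\preceq t$ means $s_{(n-i)}\le t_{(n-i)}$ for all $i$. Given integers $b_1,\dots,b_n$ prime to $p$, put $\mathfrak{b}(s)=\sum_{i=1}^n s_{(n-i)}p^{n-i}b_i$; for $t\in\mathbb{Z}$ let $\mathfrak{a}(t)\in\mathbb{S}_{p^n}$ be the unique element with $\mathfrak{b}(\mathfrak{a}(t))\equiv-t\pmod{p^n}$ (digits $\mathfrak{a}(t)_{(n-i)}$). An $A$-scaffold on $L$ of tolerance $\mathfrak{T}\ge1$ (possibly $\infty$) with shift parameters $b_1,\dots,b_n$ consists of: (i) $\lambda_t\in L$ ($t\in\mathbb{Z}$) with $v_L(\lambda_t)=t$ and $\lambda_{t_1}\lambda_{t_2}^{ -1}\in K$ whenever $t_1\equiv t_2\pmod{p^n}$; (ii) $\Psi_1,\dots,\Psi_n\in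 A$ with $\Psi_i\cdot1=0$ such that for each $i,t$ there is $u_{i,t}\in\mathfrak{O}_K^\times$ with $\Psi_i\cdot\lambda_t\equiv u_{i,t}\lambda_{t+p^{n-i}b_i}$ if $\mathfrak{a}(t)_{(n-i)}\ge1$ and $\Psi_i\cdot\lambda_t\equiv0$ if $\mathfrak{a}(t)_{(n-i)}=0$, modulo $\lambda_{t+p^{n-i}b_i}\mathfrak{P}_L^{\mathfrak{T}}$ (equalities if $\mathfrak{T}=\infty$). Put $\Psi^{(s)}=\Psi_n^{s_{(0)}}\Psi_{n-1}^{s_{(1)}}\cdots\Psi_1^{s_{(n-1)}}$. Fix a uniformizer $\pi$ of $K$ and $h\in\mathbb{Z}$. Let $\mathfrak{A}=\{\alpha\in A:\alpha\cdot\mathfrak{P}_L^h\subseteq\mathfrak{P}_L^h\}$. Let $\mathbb{S}_{p^n}(h)=\{t\in\mathbb{Z}:h\le t<h+p^n\}$ and let $b$ be the unique element of $\mathbb{S}_{p^n}(h)$ with $\mathfrak{a}(b)=p^n-1$. For $s\in\mathbb{S}_{p^n}$ let $d(s)=\lfloor(\mathfrak{b}(s)+b-h)/p^n\rfloor$, $w(s)=\min\{d(u)-d(u-s):u\in\mathbb{S}_{p^n},\,u\succeq s\}$, and $\Phi^{(s)}=\pi^{ -w(s)}\Psi^{(s)}$. -}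

module Defs where

open import Level using (Level; 0ℓ; _⊔_) renaming (suc to lsuc)
open import Algebra.Bundles using (Ring; CommutativeRing; Semiring)
open import Algebra.Definitions using (Invertible)
import Algebra.Definitions.RawMonoid as RawMonoidDefs
import Algebra.Definitions.RawSemiring as RawSemiringDefs
open import Algebra.Module.Bundles using (LeftModule)
open import Algebra.Module.Structures using (IsLeftModule)
open import Algebra.Morphism.Structures using (module RingMorphisms)
import Algebra.Properties.Ring as RingProperties
import Algebra.Properties.AbelianGroup as AbelianGroupProperties
open import Data.Empty using (⊥-elim)
open import Data.Fin.Base using (Fin; zero; suc; toℕ; fromℕ<; opposite)
import Data.Fin.Properties as Fin
open import Data.Integer.Base as ℤ using (ℤ; +_; -[1+_]; 0ℤ; 1ℤ; _/ℕ_)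
open import Data.Integer.Coprimality using (Coprime)
import Data.Integer.DivMod as ℤ
open import Data.Integer.Divisibility.Signed using (_∣_; divides)
import Data.Integer.Properties as ℤ
open import Data.Integer.Tactic.RingSolver using (solve-∀)
open import Data.List.Base using (map; filter; upTo)
open import Data.List.Extrema ℤ.≤-totalOrder using (min)
open import Data.Maybe.Base using (zipWith) renaming (map to map∞)
open import Data.Maybe.Properties using (just-injective)
open import Data.Nat.Base as ℕ using (ℕ; zero; suc; _∸_; _^_; NonZero)
import Data.Nat.Coprimality as ℕ
import Data.Nat.DivMod as ℕ
import Data.Nat.Divisibility as ℕ
open import Data.Nat.GCD using (module Bézout)
open import Data.Nat.Primality using (Prime; prime⇒nonZero)
import Data.Nat.Properties as ℕ
open import Data.Product.Base using (Σ; ∃; _×_; _,_; proj₁; proj₂)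
open import Function.Base using (_∘_)
open import Function.Bundles using (_⇔_; Equivalence)
open import Function.Definitions using (Injective)
import Relation.Binary.Construct.Add.Supremum.NonStrict ℤ._≤_ as Sup
open import Relation.Binary.PropositionalEquality.Core
  using (_≡_; refl; sym; trans; cong; cong₂; subst)
open import Relation.Nullary.Construct.Add.Supremum using (_⁺; [_]; ⊤⁺)
open import Relation.Nullary.Decidable.Core using (Dec)
open import Relation.Nullary.Negation.Core using (¬_)
open import Relation.Unary using (Pred; _∈_)

-- A discrete field (nonzero elements are invertible), with the inverse made
-- total; the value of 0# ⁻¹ is unspecified.
record Field c ℓ : Set (lsuc (c ⊔ ℓ)) where
  infix 8 _⁻¹
  field
    commutativeRing : CommutativeRing c ℓ
  open CommutativeRing commutativeRing public
    renaming (refl to ≈-refl; sym to ≈-sym; trans to ≈-trans)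
  open RawSemiringDefs (Semiring.rawSemiring semiring) public
    using () renaming (_×_ to _×ᴺ_; _^_ to _^ᴺ_)
  field
    _⁻¹         : Carrier → Carrier
    ⁻¹-inverseʳ : ∀ x → ¬ x ≈ 0# → x * x ⁻¹ ≈ 1#
    1≉0         : ¬ 1# ≈ 0#

  _^ᶻ_ : Carrier → ℤ → Carrier
  x ^ᶻ (+ m)    = x ^ᴺ m
  x ^ᶻ -[1+ m ] = (x ⁻¹) ^ᴺ suc m

module _ {r ℓr m ℓm} {R : Ring r ℓr} (M : LeftModule R m ℓm) where
  open Ring R using (Carrier; _≈_; 0#)
  open LeftModule M
  open RawMonoidDefs +ᴹ-rawMonoid using (sum)

  linearCombination : ∀ {k} → (Fin k → Carrier) → (Fin k → Carrierᴹ) → Carrierᴹ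
  linearCombination c x = sum (λ j → c j *ₗ x j)

  record IsBasis {i} {I : Set i} (e : I → Carrierᴹ) : Set (r ⊔ ℓr ⊔ m ⊔ ℓm ⊔ i) where
    field
      independent : ∀ {k} (ι : Fin k → I) → Injective _≡_ _≡_ ι →
                    ∀ c → linearCombination c (e ∘ ι) ≈ᴹ 0ᴹ → ∀ j → c j ≈ 0#
      spanning    : ∀ x → ∃ λ k → Σ (Fin k → I) λ ι → Σ (Fin k → Carrier) λ c →
                    x ≈ᴹ linearCombination c (e ∘ ι)

  HasDimension : ℕ → Set (r ⊔ ℓr ⊔ m ⊔ ℓm)
  HasDimension d = Σ (Fin d → Carrierᴹ) IsBasis

  -- A basis is a subset of the module, so index sets in the universe of the
  -- carrier suffice.
  IsFree : Set (r ⊔ ℓr ⊔ lsuc m ⊔ ℓm)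
  IsFree = Σ (Set m) λ I → Σ (I → Carrierᴹ) IsBasis

record Subring {c ℓ} (R : Ring c ℓ) q : Set (c ⊔ ℓ ⊔ lsuc q) where
  open Ring R
  field
    Member : Pred Carrier q
    0-closed : Member 0#
    1-closed : Member 1#
    +-closed : ∀ {x y} → Member x → Member y → Member (x + y)
    *-closed : ∀ {x y} → Member x → Member y → Member (x * y)
    neg-closed : ∀ {x} → Member x → Member (- x)

  subring : Ring (c ⊔ q) ℓ
  subring = record
    { Carrier = Σ Carrier Member
    ; _≈_ = λ x y → proj₁ x ≈ proj₁ y
    ; _+_ = λ (x , mx) (y , my) → x + y , +-closed mx my
    ; _*_ = λ (x , mx) (y , my) → x * y , *-closed mx my
    ; -_ = λ (x , mx) → - x , neg-closed mx
    ; 0# = 0# , 0-closed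
    ; 1# = 1# , 1-closed
    ; isRing = record
      { +-isAbelianGroup = record
        { isGroup = record
          { isMonoid = record
            { isSemigroup = record
              { isMagma = record
                { isEquivalence = record
                  { refl = Ring.refl R ; sym = Ring.sym R ; trans = Ring.trans R }
                ; ∙-cong = +-cong }
              ; assoc = λ x y z → +-assoc _ _ _ }
            ; identity = (λ x → +-identityˡ _) , (λ x → +-identityʳ _) }
          ; inverse = (λ x → -‿inverseˡ _) , (λ x → -‿inverseʳ _)
          ; ⁻¹-cong = -‿cong }
        ; comm = λ x y → +-comm _ _ }
      ; *-cong = *-cong
      ; *-assoc = λ x y z → *-assoc _ _ _
      ; *-identity = (λ x → *-identityˡ _) , (λ x → *-identityʳ _)
      ; distrib = (λ x y z → distribˡ _ _ _) , (λ x y z → distribʳ _ _ _)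
      }
    }

-- An S-submodule of the R-module M, for a subring S of R.
record Submodule {c ℓ m ℓm q} {R : Ring c ℓ} (S : Subring R q)
                 (M : LeftModule R m ℓm) q′ : Set (c ⊔ m ⊔ q ⊔ lsuc q′) where
  open LeftModule M
  field
    Memberᴹ : Pred Carrierᴹ q′
    0ᴹ-closed : Memberᴹ 0ᴹ
    +ᴹ-closed : ∀ {x y} → Memberᴹ x → Memberᴹ y → Memberᴹ (x +ᴹ y)
    -ᴹ-closed : ∀ {x} → Memberᴹ x → Memberᴹ (-ᴹ x)
    *ₗ-closed : ∀ {a x} → Subring.Member S a → Memberᴹ x → Memberᴹ (a *ₗ x)

  submodule : LeftModule (Subring.subring S) (m ⊔ q′) ℓm
  submodule = record
    { Carrierᴹ = Σ Carrierᴹ Memberᴹ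
    ; _≈ᴹ_ = λ x y → proj₁ x ≈ᴹ proj₁ y
    ; _+ᴹ_ = λ (x , mx) (y , my) → x +ᴹ y , +ᴹ-closed mx my
    ; _*ₗ_ = λ (a , ma) (x , mx) → a *ₗ x , *ₗ-closed ma mx
    ; 0ᴹ = 0ᴹ , 0ᴹ-closed
    ; -ᴹ_ = λ (x , mx) → -ᴹ x , -ᴹ-closed mx
    ; isLeftModule = record
      { isLeftSemimodule = record
        { +ᴹ-isCommutativeMonoid = record
          { isMonoid = record
            { isSemigroup = record
              { isMagma = record
                { isEquivalence = record
                  { refl = ≈ᴹ-refl ; sym = ≈ᴹ-sym ; trans = ≈ᴹ-trans }
                ; ∙-cong = +ᴹ-cong }
              ; assoc = λ x y z → +ᴹ-assoc _ _ _ }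
            ; identity = (λ x → +ᴹ-identityˡ _) , (λ x → +ᴹ-identityʳ _) }
          ; comm = λ x y → +ᴹ-comm _ _ }
        ; isPreleftSemimodule = record
          { *ₗ-cong = *ₗ-cong
          ; *ₗ-zeroˡ = λ x → *ₗ-zeroˡ _
          ; *ₗ-distribʳ = λ x a b → *ₗ-distribʳ _ _ _
          ; *ₗ-identityˡ = λ x → *ₗ-identityˡ _
          ; *ₗ-assoc = λ a b x → *ₗ-assoc _ _ _
          ; *ₗ-zeroʳ = λ a → *ₗ-zeroʳ _
          ; *ₗ-distribˡ = λ a x y → *ₗ-distribˡ _ _ _
          }
        }
      ; -ᴹ‿cong = -ᴹ‿cong
      ; -ᴹ‿inverse = (λ x → -ᴹ‿inverseˡ _) , (λ x → -ᴹ‿inverseʳ _)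
      }
    }

record Algebra {k ℓk a ℓa} (K : Field k ℓk) (A : Ring a ℓa)
               : Set (k ⊔ ℓk ⊔ a ⊔ ℓa) where
  private
    module K = Field K
    module A = Ring A
  open RingMorphisms K.rawRing A.rawRing using (IsRingHomomorphism)
  field
    structureMap : K.Carrier → A.Carrier
    isRingHomomorphism : IsRingHomomorphism structureMap
    central : ∀ c x → structureMap c A.* x A.≈ x A.* structureMap c

  open IsRingHomomorphism isRingHomomorphism public

  asLeftModule : LeftModule K.ring a ℓa
  asLeftModule = record
    { Carrierᴹ = A.Carrier
    ; _≈ᴹ_ = A._≈_
    ; _+ᴹ_ = A._+_
    ; _*ₗ_ = λ c x → structureMap c A.* x
    ; 0ᴹ = A.0#
    ; -ᴹ_ = A.-_
    ; isLeftModule = record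
      { isLeftSemimodule = record
        { +ᴹ-isCommutativeMonoid = A.+-isCommutativeMonoid
        ; isPreleftSemimodule = record
          { *ₗ-cong = λ p q → A.*-cong (⟦⟧-cong p) q
          ; *ₗ-zeroˡ = λ x → A.trans (A.*-congʳ 0#-homo) (A.zeroˡ x)
          ; *ₗ-distribʳ = λ x c d → A.trans (A.*-congʳ (+-homo c d)) (A.distribʳ x _ _)
          ; *ₗ-identityˡ = λ x → A.trans (A.*-congʳ 1#-homo) (A.*-identityˡ x)
          ; *ₗ-assoc = λ c d x → A.trans (A.*-congʳ (*-homo c d)) (A.*-assoc _ _ x)
          ; *ₗ-zeroʳ = λ c → A.zeroʳ _
          ; *ₗ-distribˡ = λ c x y → A.distribˡ _ x y
          }
        }
      ; -ᴹ‿cong = A.-‿cong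
      ; -ᴹ‿inverse = A.-‿inverse
      }
    }

infix  4 _≤∞_
infixl 6 _+∞_ _⊓∞_

ℤ∞ : Set
ℤ∞ = ℤ ⁺

_≤∞_ : ℤ∞ → ℤ∞ → Set
_≤∞_ = Sup._≤⁺_

_+∞_ : ℤ∞ → ℤ∞ → ℤ∞
_+∞_ = zipWith ℤ._+_

_⊓∞_ : ℤ∞ → ℤ∞ → ℤ∞
[ i ] ⊓∞ [ j ] = [ i ℤ.⊓ j ]
[ i ] ⊓∞ ⊤⁺    = [ i ]
⊤⁺    ⊓∞ y     = y

≤∞-trans : ∀ {x y z} → x ≤∞ y → y ≤∞ z → x ≤∞ z
≤∞-trans = Sup.≤⁺-trans ℤ.≤-trans

⊓∞-glb : ∀ {x y z} → x ≤∞ y → x ≤∞ z → x ≤∞ y ⊓∞ z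
⊓∞-glb Sup.[ p ]     Sup.[ q ]     = Sup.[ ℤ.⊓-glb p q ]
⊓∞-glb Sup.[ p ]     (_ Sup.≤⊤⁺) = Sup.[ p ]
⊓∞-glb (_ Sup.≤⊤⁺) q             = q

+∞-mono-≤ : ∀ {w x y z} → w ≤∞ x → y ≤∞ z → w +∞ y ≤∞ x +∞ z
+∞-mono-≤ Sup.[ p ]     Sup.[ q ]     = Sup.[ ℤ.+-mono-≤ p q ]
+∞-mono-≤ {w} {y = y} Sup.[ p ] (_ Sup.≤⊤⁺) = (w +∞ y) Sup.≤⊤⁺
+∞-mono-≤ {w} {y = y} (_ Sup.≤⊤⁺) q = (w +∞ y) Sup.≤⊤⁺

x+x≡x⇒x≡0 : ∀ x → ¬ x ≡ ⊤⁺ → x +∞ x ≡ x → x ≡ [ 0ℤ ]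
x+x≡x⇒x≡0 ⊤⁺    x≢⊤ _ = ⊥-elim (x≢⊤ refl)
x+x≡x⇒x≡0 [ i ] _   e = cong [_] (∙-cancel i (just-injective e))
  where
  ∙-cancel : ∀ i → i ℤ.+ i ≡ i → i ≡ 0ℤ
  ∙-cancel i e = AbelianGroupProperties.identityˡ-unique ℤ.+-0-abelianGroup i i e

x+x≡0⇒x≡0 : ∀ x → x +∞ x ≡ [ 0ℤ ] → x ≡ [ 0ℤ ]
x+x≡0⇒x≡0 [ + 0 ] _ = refl

record NormalizedDiscreteValuation {c ℓ} (F : Field c ℓ) : Set (c ⊔ ℓ) where
  open Field F
  field
    v       : Carrier → ℤ∞
    v-cong  : ∀ {x y} → x ≈ y → v x ≡ v y
    v-∞     : ∀ x → v x ≡ ⊤⁺ ⇔ x ≈ 0#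
    v-*     : ∀ x y → v (x * y) ≡ v x +∞ v y
    v-+     : ∀ x y → v x ⊓∞ v y ≤∞ v (x + y)
    v-surj  : ∀ m → ∃ λ x → v x ≡ [ m ]

  -- The m-th power of the maximal ideal, a fractional ideal when m is negative
  -- and the zero ideal when m = ∞.
  𝔓 : ℤ∞ → Pred Carrier 0ℓ
  𝔓 m x = m ≤∞ v x

  v0 : v 0# ≡ ⊤⁺
  v0 = Equivalence.from (v-∞ 0#) ≈-refl

  v1 : v 1# ≡ [ 0ℤ ]
  v1 = x+x≡x⇒x≡0 (v 1#) (1≉0 ∘ Equivalence.to (v-∞ 1#))
         (trans (sym (v-* 1# 1#)) (v-cong (*-identityˡ 1#)))

  v-neg : ∀ x → v (- x) ≡ v x
  v-neg x = trans (v-cong (≈-sym (-1*x≈-x x)))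
    (trans (v-* (- 1#) x) (trans (cong (_+∞ v x) v[-1]) (0+∞ (v x))))
    where
    open RingProperties ring using (-1*x≈-x)
    open AbelianGroupProperties +-abelianGroup using (⁻¹-involutive)

    v[-1] : v (- 1#) ≡ [ 0ℤ ]
    v[-1] = x+x≡0⇒x≡0 (v (- 1#)) (trans (sym (v-* (- 1#) (- 1#)))
      (trans (v-cong (≈-trans (-1*x≈-x (- 1#)) (⁻¹-involutive 1#))) v1))

    0+∞ : ∀ y → [ 0ℤ ] +∞ y ≡ y
    0+∞ ⊤⁺    = refl
    0+∞ [ i ] = cong [_] (ℤ.+-identityˡ i)

  𝔓-0 : ∀ m → 𝔓 m 0#
  𝔓-0 m = subst (m ≤∞_) (sym v0) (m Sup.≤⊤⁺)

  𝔓-+ : ∀ {m x y} → 𝔓 m x → 𝔓 m y → 𝔓 m (x + y)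
  𝔓-+ p q = ≤∞-trans (⊓∞-glb p q) (v-+ _ _)

  𝔓-neg : ∀ {m x} → 𝔓 m x → 𝔓 m (- x)
  𝔓-neg {m} p = subst (m ≤∞_) (sym (v-neg _)) p

  𝔓-* : ∀ {m k x y} → 𝔓 m x → 𝔓 k y → 𝔓 (m +∞ k) (x * y)
  𝔓-* {m} {k} p q = subst (m +∞ k ≤∞_) (sym (v-* _ _)) (+∞-mono-≤ p q)

  𝔓-resp : ∀ {m x y} → x ≈ y → 𝔓 m x → 𝔓 m y
  𝔓-resp {m} e = subst (m ≤∞_) (v-cong e)

  𝔒 : Subring ring 0ℓ
  𝔒 = record
    { Member = 𝔓 [ 0ℤ ]
    ; 0-closed = 𝔓-0 [ 0ℤ ]
    ; 1-closed = subst ([ 0ℤ ] ≤∞_) (sym v1) Sup.[ ℤ.≤-refl ]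
    ; +-closed = 𝔓-+
    ; *-closed = 𝔓-*
    ; neg-closed = 𝔓-neg
    }

  Is𝔒Unit : Pred Carrier (c ⊔ ℓ)
  Is𝔒Unit u = Σ (u ∈ 𝔓 [ 0ℤ ]) λ u∈𝔒 → Invertible 𝔒._≈_ 𝔒.1# 𝔒._*_ (u , u∈𝔒)
    where module 𝔒 = Ring (Subring.subring 𝔒)

  IsUniformizer : Pred Carrier 0ℓ
  IsUniformizer π = v π ≡ [ 1ℤ ]

  IsComplete : Set c
  IsComplete = (x : ℕ → Carrier) →
    (∀ (m : ℤ) → ∃ λ N → ∀ i j → N ℕ.≤ i → N ℕ.≤ j → [ m ] ≤∞ v (x i - x j)) →
    ∃ λ y → ∀ (m : ℤ) → ∃ λ N → ∀ i → N ℕ.≤ i → [ m ] ≤∞ v (x i - y)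

  -- The kernel of ℤ → 𝔒 / 𝔓 is generated by p.
  HasResidueCharacteristic : ℕ → Set
  HasResidueCharacteristic p = ∀ m → (m ×ᴺ 1#) ∈ 𝔓 [ 1ℤ ] ⇔ p ℕ.∣ m

record IsTotallyRamified {k ℓk l ℓl} {K : Field k ℓk} {L : Field l ℓl}
  (L/K : Algebra K (Field.ring L))
  (vK : NormalizedDiscreteValuation K) (vL : NormalizedDiscreteValuation L)
  (degree : ℕ) : Set (k ⊔ ℓk ⊔ l ⊔ ℓl) where
  open Algebra L/K
  open NormalizedDiscreteValuation vK renaming (v to v-K)
  open NormalizedDiscreteValuation vL renaming (v to v-L)
  field
    hasDegree       : HasDimension asLeftModule degree
    ramificationIndex : ∀ x → v-L (structureMap x) ≡ map∞ (+ degree ℤ.*_) (v-K x)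

record Setting k ℓk l ℓl a ℓa : Set (lsuc (k ⊔ ℓk ⊔ l ⊔ ℓl ⊔ a ⊔ ℓa)) where
  field
    p n     : ℕ
    p-prime : Prime p

    K  : Field k ℓk
    vK : NormalizedDiscreteValuation K

    L   : Field l ℓl
    vL  : NormalizedDiscreteValuation L
    L/K : Algebra K (Field.ring L)

    A   : Ring a ℓa
    A/K : Algebra K A

  module K  = Field K
  module L  = Field L
  module A  = Ring A
  module vK = NormalizedDiscreteValuation vK
  module vL = NormalizedDiscreteValuation vL
  module L/K = Algebra L/K
  module A/K = Algebra A/K

  infixr 7 _·_
  field
    K-complete     : vK.IsComplete
    K-residueChar  : vK.HasResidueCharacteristic p
    totallyRamified : IsTotallyRamified L/K vK vL (p ^ n)
    A-dimension    : HasDimension A/K.asLeftModule (p ^ n)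

    _·_ : A.Carrier → L.Carrier → L.Carrier
    ·-isLeftModule : IsLeftModule A L._≈_ L._+_ L.0# L.-_ _·_
    ·-K-linear : ∀ c x → A/K.structureMap c · x L.≈ L/K.structureMap c L.* x

  L-module : LeftModule A l ℓl
  L-module = record { isLeftModule = ·-isLeftModule }

-- Indices 1, …, n are shifted down by one, so exponent i is the n - i of the
-- one-based convention.
exponent : ∀ {n} → Fin n → ℕ
exponent i = toℕ (opposite i)

module _ (p : ℕ) .{{_ : NonZero p}} where

  digit : ℕ → ℕ → ℕ
  digit s j = (s ℕ./ p ^ j) {{ℕ.m^n≢0 p j}} ℕ.% p

  weightedDigitSum : ∀ {n} → (Fin n → ℤ) → ℕ → ℤ
  weightedDigitSum bs s = sum (λ i → + (digit s (exponent i) ℕ.* p ^ exponent i) ℤ.* bs i)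
    where open RawMonoidDefs ℤ.+-0-rawMonoid using (sum)

infix 4 _≡_[mod_]
_≡_[mod_] : ℤ → ℤ → ℕ → Set
x ≡ y [mod m ] = + m ∣ x ℤ.- y

module _ {p : ℕ} .{{_ : NonZero p}} where
  open RawMonoidDefs ℤ.+-0-rawMonoid using (sum)

  sum-cong : ∀ {n} {f g : Fin n → ℤ} → (∀ i → f i ≡ g i) → sum f ≡ sum g
  sum-cong {zero}  e = refl
  sum-cong {suc n} e = cong₂ ℤ._+_ (e zero) (sum-cong (e ∘ suc))

  exponent<n : ∀ {n} (i : Fin n) → exponent i ℕ.< n
  exponent<n i = Fin.toℕ<n (opposite i)

  digit-+-below : ∀ s δ {n j} → j ℕ.< n → digit p (s ℕ.+ δ ℕ.* p ^ n) j ≡ digit p s j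
  digit-+-below s δ {n} {j} j<n = trans
    (cong (ℕ._% p) (trans (ℕ.+-distrib-/-∣ʳ s (ℕ.divides (δ ℕ.* p ^ k ℕ.* p) eq))
      (cong (s ℕ./ p ^ j ℕ.+_) (trans (cong (ℕ._/ p ^ j) eq) (ℕ.m*n/n≡m _ (p ^ j))))))
    (ℕ.[m+kn]%n≡m%n (s ℕ./ p ^ j) (δ ℕ.* p ^ k) p)
    where
    instance _ = ℕ.m^n≢0 p j
    k : ℕ
    k = n ∸ suc j
    p^n : p ^ n ≡ p ^ k ℕ.* p ℕ.* p ^ j
    p^n = trans (cong (p ^_) (sym (ℕ.m∸n+n≡m j<n)))
      (trans (ℕ.^-distribˡ-+-* p k (suc j)) (sym (ℕ.*-assoc (p ^ k) p (p ^ j))))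
    eq : δ ℕ.* p ^ n ≡ δ ℕ.* p ^ k ℕ.* p ℕ.* p ^ j
    eq = trans (cong (δ ℕ.*_) p^n) (trans (sym (ℕ.*-assoc δ (p ^ k ℕ.* p) (p ^ j)))
      (cong (ℕ._* p ^ j) (sym (ℕ.*-assoc δ (p ^ k) p))))

  digit-+-top : ∀ s δ n → s ℕ.< p ^ n → δ ℕ.< p → digit p (s ℕ.+ δ ℕ.* p ^ n) n ≡ δ
  digit-+-top s δ n s< δ< = trans
    (cong (ℕ._% p) (trans (ℕ.+-distrib-/-∣ʳ s {δ ℕ.* p ^ n} {p ^ n} (ℕ.divides δ refl))
      (cong₂ ℕ._+_ (ℕ.m<n⇒m/n≡0 s<) (ℕ.m*n/n≡m δ (p ^ n)))))
    (ℕ.m<n⇒m%n≡m δ<)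
    where instance _ = ℕ.m^n≢0 p n

  inverse-mod-ℕ : ∀ m → ℕ.Coprime m p → ∃ λ x → x ℤ.* + m ≡ 1ℤ [mod p ]
  inverse-mod-ℕ m c with ℕ.coprime-Bézout c
  ... | Bézout.+- x y eq = + x , divides (+ y)
    (trans (cong (ℤ._- 1ℤ) (trans (sym (ℤ.pos-* x m)) (trans (cong +_ (sym eq))
      (trans (ℤ.pos-+ 1 (y ℕ.* p)) (cong (ℤ._+_ 1ℤ) (ℤ.pos-* y p)))))) (lem (+ y ℤ.* + p)))
    where
    lem : ∀ z → 1ℤ ℤ.+ z ℤ.- 1ℤ ≡ z
    lem = solve-∀
  ... | Bézout.-+ x y eq = ℤ.- (+ x) , divides (ℤ.- (+ y))
    (trans (lem (+ x) (+ m)) (trans (cong ℤ.-_ (trans (cong (ℤ._+_ 1ℤ) (sym (ℤ.pos-* x m)))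
      (trans (sym (ℤ.pos-+ 1 (x ℕ.* m))) (trans (cong +_ eq) (ℤ.pos-* y p)))))
      (ℤ.neg-distribˡ-* (+ y) (+ p))))
    where
    lem : ∀ z m → ℤ.- z ℤ.* m ℤ.- 1ℤ ≡ ℤ.- (1ℤ ℤ.+ z ℤ.* m)
    lem = solve-∀

  inverse-mod : ∀ b → Coprime b (+ p) → ∃ λ x → x ℤ.* b ≡ 1ℤ [mod p ]
  inverse-mod (+ m)    c = inverse-mod-ℕ m c
  inverse-mod -[1+ m ] c with inverse-mod-ℕ (suc m) c
  ... | x , divides f eq = ℤ.- x , divides f (trans (cong (ℤ._- 1ℤ) (lem x (+ suc m))) eq)
    where
    lem : ∀ x y → ℤ.- x ℤ.* (ℤ.- y) ≡ x ℤ.* y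
    lem = solve-∀

  solve-mod : ∀ b → Coprime b (+ p) → ∀ q → ∃ λ δ → δ ℕ.< p × + p ∣ q ℤ.+ + δ ℤ.* b
  solve-mod b c q with inverse-mod b c
  ... | x , divides f eq = δ , ℤ.n%ℕd<d z p , divides (ℤ.- (q ℤ.* f) ℤ.- e ℤ.* b)
    (trans (cong (λ d → q ℤ.+ d ℤ.* b) δ≡)
      (trans (lem₁ q x b e (+ p)) (trans (cong (λ y → ℤ.- (q ℤ.* y) ℤ.- e ℤ.* b ℤ.* + p) eq)
        (lem₂ q f e b (+ p)))))
    where
    z e : ℤ
    z = ℤ.- (q ℤ.* x)
    e = z /ℕ p
    δ : ℕ
    δ = z ℤ.%ℕ p
    lem₀ : ∀ d y → d ≡ d ℤ.+ y ℤ.- y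
    lem₀ = solve-∀
    δ≡ : + δ ≡ z ℤ.- e ℤ.* + p
    δ≡ = trans (lem₀ (+ δ) (e ℤ.* + p)) (cong (ℤ._- e ℤ.* + p) (sym (ℤ.a≡a%ℕn+[a/ℕn]*n z p)))
    lem₁ : ∀ q x b e p → q ℤ.+ (ℤ.- (q ℤ.* x) ℤ.- e ℤ.* p) ℤ.* b ≡
                         ℤ.- (q ℤ.* (x ℤ.* b ℤ.- 1ℤ)) ℤ.- e ℤ.* b ℤ.* p
    lem₁ = solve-∀
    lem₂ : ∀ q f e b p → ℤ.- (q ℤ.* (f ℤ.* p)) ℤ.- e ℤ.* b ℤ.* p ≡
                         (ℤ.- (q ℤ.* f) ℤ.- e ℤ.* b) ℤ.* p
    lem₂ = solve-∀

  weightedDigitSum-step : ∀ {n} (bs : Fin (suc n) → ℤ) s δ → s ℕ.< p ^ n → δ ℕ.< p →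
    weightedDigitSum p bs (s ℕ.+ δ ℕ.* p ^ n) ≡
    + (δ ℕ.* p ^ n) ℤ.* bs zero ℤ.+ weightedDigitSum p (bs ∘ suc) s
  weightedDigitSum-step {n} bs s δ s< δ< = cong₂ ℤ._+_
    (cong (λ d → + d ℤ.* bs zero) (trans
      (cong (λ j → digit p (s ℕ.+ δ ℕ.* p ^ n) j ℕ.* p ^ j) (Fin.toℕ-fromℕ n))
      (cong (ℕ._* p ^ n) (digit-+-top s δ n s< δ<))))
    (sum-cong λ i → cong (λ d → + d ℤ.* bs (suc i)) (trans
      (cong (λ j → digit p (s ℕ.+ δ ℕ.* p ^ n) j ℕ.* p ^ j) (Fin.toℕ-inject₁ (opposite i)))
      (cong (ℕ._* p ^ exponent i) (digit-+-below s δ (exponent<n i)))))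

  weightedDigitSum-onto : ∀ {n} (bs : Fin n → ℤ) → (∀ i → Coprime (bs i) (+ p)) → ∀ t →
    ∃ λ s → s ℕ.< p ^ n × weightedDigitSum p bs s ≡ t [mod p ^ n ]
  weightedDigitSum-onto {zero}  bs c t =
    0 , ℕ.s≤s ℕ.z≤n , divides (0ℤ ℤ.- t) (sym (ℤ.*-identityʳ (0ℤ ℤ.- t)))
  weightedDigitSum-onto {suc n} bs c t with weightedDigitSum-onto (bs ∘ suc) (c ∘ suc) t
  ... | s , s< , divides Q eq with solve-mod (bs zero) (c zero) Q
  ... | δ , δ< , divides R eq′ = s ℕ.+ δ ℕ.* p ^ n , bound , divides R (
    trans (cong (ℤ._- t) (weightedDigitSum-step bs s δ s< δ<))
    (trans (cong (λ d → d ℤ.* bs zero ℤ.+ B ℤ.- t) (ℤ.pos-* δ (p ^ n)))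
    (trans (lem₁ (+ δ) (+ (p ^ n)) (bs zero) B t)
    (trans (cong (ℤ._+_ (+ δ ℤ.* + (p ^ n) ℤ.* bs zero)) eq)
    (trans (lem₂ (+ δ) (+ (p ^ n)) (bs zero) Q)
    (trans (cong (ℤ._* + (p ^ n)) eq′)
    (trans (ℤ.*-assoc R (+ p) (+ (p ^ n)))
    (cong (R ℤ.*_) (sym (ℤ.pos-* p (p ^ n)))))))))))
    where
    B : ℤ
    B = weightedDigitSum p (bs ∘ suc) s
    bound : s ℕ.+ δ ℕ.* p ^ n ℕ.< p ℕ.* p ^ n
    bound = ℕ.<-≤-trans (ℕ.+-monoˡ-< (δ ℕ.* p ^ n) s<) (ℕ.*-monoˡ-≤ (p ^ n) δ<)
    lem₁ : ∀ δ P b B t → δ ℤ.* P ℤ.* b ℤ.+ B ℤ.- t ≡ δ ℤ.* P ℤ.* b ℤ.+ (B ℤ.- t)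
    lem₁ = solve-∀
    lem₂ : ∀ δ P b Q → δ ℤ.* P ℤ.* b ℤ.+ Q ℤ.* P ≡ (Q ℤ.+ δ ℤ.* b) ℤ.* P
    lem₂ = solve-∀

record ShiftParameters (p n : ℕ) : Set where
  field
    shift   : Fin n → ℤ
    coprime : ∀ i → Coprime (shift i) (+ p)

module Shifts {p n : ℕ} (p-prime : Prime p) (β : ShiftParameters p n) where
  open ShiftParameters β

  private instance
    p≢0 : NonZero p
    p≢0 = prime⇒nonZero p-prime

    p^n≢0 : NonZero (p ^ n)
    p^n≢0 = ℕ.m^n≢0 p n

  -- Elements of 𝕊 = {0, …, p ^ n - 1} are represented by natural numbers
  -- together with a bound, or by Fin (p ^ n).
  infix 8 _⟨_⟩
  _⟨_⟩ : ℕ → ℕ → ℕ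
  s ⟨ j ⟩ = digit p s j

  𝔟 : ℕ → ℤ
  𝔟 = weightedDigitSum p shift

  abstract
    𝔞-exists : ∀ t → ∃ λ (s : Fin (p ^ n)) → 𝔟 (toℕ s) ≡ ℤ.- t [mod p ^ n ]
    𝔞-exists t with weightedDigitSum-onto shift coprime (ℤ.- t)
    ... | s , s< , e =
      fromℕ< s< , subst (λ u → 𝔟 u ≡ ℤ.- t [mod p ^ n ]) (sym (Fin.toℕ-fromℕ< s<)) e

  -- 𝔟 is onto modulo p ^ n on a set of p ^ n elements, so the choice is unique.
  𝔞 : ℤ → ℕ
  𝔞 t = toℕ (proj₁ (𝔞-exists t))

  infix 4 _⪯_ _⪯?_
  _⪯_ : ℕ → ℕ → Set
  s ⪯ t = ∀ (j : Fin n) → s ⟨ toℕ j ⟩ ℕ.≤ t ⟨ toℕ j ⟩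

  _⪯?_ : ∀ s t → Dec (s ⪯ t)
  s ⪯? t = Fin.all? λ j → s ⟨ toℕ j ⟩ ℕ.≤? t ⟨ toℕ j ⟩

  module _ (h b : ℤ) where

    -- _/ℕ_ rounds towards -∞.
    d : ℕ → ℤ
    d s = (𝔟 s ℤ.+ b ℤ.- h) /ℕ p ^ n

    -- The first argument of min is the term u = s, which occurs since s ⪯ s.
    w : ℕ → ℤ
    w s = min (d s ℤ.- d (s ∸ s))
              (map (λ u → d u ℤ.- d (u ∸ s)) (filter (s ⪯?_) (upTo (p ^ n))))

module _ {k ℓk l ℓl a ℓa} (S : Setting k ℓk l ℓl a ℓa) where
  open Setting S

  -- x ≡ y modulo z 𝔓_L^m
  Congruent : L.Carrier → ℤ∞ → L.Carrier → L.Carrier → Set (l ⊔ ℓl)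
  Congruent z m x y = ∃ λ e → e ∈ vL.𝔓 m × (x L.- y) L.≈ z L.* e

  record Scaffold (β : ShiftParameters p n) (𝔗 : ℤ∞)
                  : Set (k ⊔ ℓk ⊔ l ⊔ ℓl ⊔ a) where
    open ShiftParameters β
    open Shifts p-prime β
    field
      1≤𝔗 : [ 1ℤ ] ≤∞ 𝔗

      λ-     : ℤ → L.Carrier
      v-λ    : ∀ t → vL.v (λ- t) ≡ [ t ]
      λ-K    : ∀ t₁ t₂ → t₁ ≡ t₂ [mod p ^ n ] →
               ∃ λ c → λ- t₁ L.* λ- t₂ L.⁻¹ L.≈ L/K.structureMap c

      -- Ψ i is the element with index i + 1.
      Ψ      : Fin n → A.Carrier
      Ψ·1≈0  : ∀ i → Ψ i · L.1# L.≈ L.0#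
      Ψ-λ    : ∀ i t → ∃ λ u → vK.Is𝔒Unit u ×
               let t′ = t ℤ.+ + (p ^ exponent i) ℤ.* shift i in
               (1 ℕ.≤ 𝔞 t ⟨ exponent i ⟩ →
                 Congruent (λ- t′) 𝔗 (Ψ i · λ- t) (L/K.structureMap u L.* λ- t′)) ×
               (𝔞 t ⟨ exponent i ⟩ ≡ 0 →
                 Congruent (λ- t′) 𝔗 (Ψ i · λ- t) L.0#)

    -- Ψ_n ^ s₍₀₎ ⋯ Ψ_1 ^ s₍ₙ₋₁₎, in this order.
    Ψ^⟨_⟩ : ℕ → A.Carrier
    Ψ^⟨ s ⟩ = product λ (j : Fin n) → Ψ (opposite j) ^ᴬ (s ⟨ toℕ j ⟩)
      where open RawSemiringDefs (Semiring.rawSemiring A.semiring)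
              using (product) renaming (_^_ to _^ᴬ_)

    module _ (π : K.Carrier) (h b : ℤ) where
      Φ : Fin (p ^ n) → A.Carrier
      Φ s = A/K.structureMap (π K.^ᶻ (ℤ.- w h b (toℕ s))) A.* Ψ^⟨ toℕ s ⟩

  module AssociatedOrder (h : ℤ) where
    private
      open LeftModule L-module
        using (*ₗ-cong; *ₗ-zeroˡ; *ₗ-distribʳ; *ₗ-identityˡ; *ₗ-assoc)
      open AbelianGroupProperties L.+-abelianGroup using (inverseˡ-unique)

      neg-· : ∀ α x → (A.- α) · x L.≈ L.- (α · x)
      neg-· α x = inverseˡ-unique _ _
        (L.≈-trans (L.≈-sym (*ₗ-distribʳ x (A.- α) α))
          (L.≈-trans (*ₗ-cong (A.-‿inverseˡ α) L.≈-refl) (*ₗ-zeroˡ x)))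

    𝔄 : Subring A l
    𝔄 = record
      { Member = λ α → ∀ x → x ∈ vL.𝔓 [ h ] → α · x ∈ vL.𝔓 [ h ]
      ; 0-closed = λ x _ → vL.𝔓-resp (L.≈-sym (*ₗ-zeroˡ x)) (vL.𝔓-0 [ h ])
      ; 1-closed = λ x → vL.𝔓-resp (L.≈-sym (*ₗ-identityˡ x))
      ; +-closed = λ α∈ β∈ x x∈ →
          vL.𝔓-resp (L.≈-sym (*ₗ-distribʳ x _ _)) (vL.𝔓-+ (α∈ x x∈) (β∈ x x∈))
      ; *-closed = λ α∈ β∈ x x∈ →
          vL.𝔓-resp (L.≈-sym (*ₗ-assoc _ _ x)) (α∈ _ (β∈ x x∈))
      ; neg-closed = λ α∈ x x∈ →
          vL.𝔓-resp (L.≈-sym (neg-· _ x)) (vL.𝔓-neg (α∈ x x∈))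
      }

    open Subring 𝔄 public using () renaming (Member to Member𝔄)

    private
      0≤d* : ∀ d {x} → [ 0ℤ ] ≤∞ x → [ 0ℤ ] ≤∞ map∞ (+ d ℤ.*_) x
      0≤d* d {[ i ]} Sup.[ p ] = Sup.[ subst (ℤ._≤ + d ℤ.* i) (ℤ.*-zeroʳ (+ d)) (ℤ.*-monoˡ-≤-nonNeg (+ d) p) ]
      0≤d* d (_ Sup.≤⊤⁺) = [ 0ℤ ] Sup.≤⊤⁺

      scale-closed : ∀ {c x} → c ∈ vK.𝔓 [ 0ℤ ] → x ∈ vL.𝔓 [ h ] →
                     L/K.structureMap c L.* x ∈ vL.𝔓 [ h ]
      scale-closed {c} c∈ x∈ = subst (λ m → _ ∈ vL.𝔓 [ m ]) (ℤ.+-identityˡ h)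
        (vL.𝔓-* (subst ([ 0ℤ ] ≤∞_) (sym (IsTotallyRamified.ramificationIndex totallyRamified c))
          (0≤d* (p ^ n) c∈)) x∈)

    𝔄-over-𝔒K : LeftModule (Subring.subring vK.𝔒) (a ⊔ l) ℓa
    𝔄-over-𝔒K = Submodule.submodule {S = vK.𝔒} {M = A/K.asLeftModule} record
      { Memberᴹ = Member𝔄
      ; 0ᴹ-closed = Subring.0-closed 𝔄
      ; +ᴹ-closed = Subring.+-closed 𝔄
      ; -ᴹ-closed = Subring.neg-closed 𝔄
      ; *ₗ-closed = λ c∈ α∈ x x∈ → vL.𝔓-resp
          (L.≈-sym (L.≈-trans (*ₗ-assoc _ _ x) (·-K-linear _ _)))
          (scale-closed c∈ (α∈ x x∈))
      }

    𝔓ᴸ-over-𝔄 : LeftModule (Subring.subring 𝔄) l ℓl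
    𝔓ᴸ-over-𝔄 = Submodule.submodule {S = 𝔄} {M = L-module} record
      { Memberᴹ = vL.𝔓 [ h ]
      ; 0ᴹ-closed = vL.𝔓-0 [ h ]
      ; +ᴹ-closed = vL.𝔓-+
      ; -ᴹ-closed = vL.𝔓-neg
      ; *ₗ-closed = λ α∈ → α∈ _
      }

    Has𝔒K-Basis : ∀ {N} → (Fin N → A.Carrier) → Set (k ⊔ ℓk ⊔ a ⊔ ℓa ⊔ l)
    Has𝔒K-Basis Φ = Σ (∀ s → Φ s ∈ Member𝔄) λ Φ∈𝔄 →
      IsBasis 𝔄-over-𝔒K (λ s → Φ s , Φ∈𝔄 s)

    𝔓ᴸ≐𝔄·_ : L.Carrier → Set (l ⊔ ℓl ⊔ a)
    𝔓ᴸ≐𝔄· ρ = ∀ x → x ∈ vL.𝔓 [ h ] ⇔ ∃ λ α → α ∈ Member𝔄 × x L.≈ α · ρ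

{-# OPTIONS --safe #-}

-- Since 𝔟 is a bijection onto the residues modulo q = p^n, the elements Ψ^(s) · λ_b have valuations
-- b + 𝔟(s) in distinct residue classes. As v_L is q times v_K on K, a sum of elements with valuations in
-- distinct classes lies in an ideal only if each summand does; hence these elements form a K-basis
-- of L, the Ψ^(s) a K-basis of A, and coefficients can be read off valuation by valuation. If w = d, the
-- Φ^(s) · ρ have valuations filling [h, h + q), which settles everything. In general, apply α = Σ c_s Φ^(s)
-- to the λ_t for which Φ^(s) raises the valuation least: if all c_i lie in 𝔓^μ with μ < 0 and the tolerance
-- is at least q + b - h, the error terms are too small to interfere and c_s is in 𝔓^(μ+1). For the
-- converse in (ii), freeness forces rank one; for a generator η the coordinates of the Φ^(s) · η form a
-- matrix that is triangular modulo 𝔓_K, and its invertibility gives d(s) ≤ w(s) on the diagonal.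

module Submission where

open import Level using (Level; Lift; lift)
open import Defs
open import Algebra.Bundles using (Ring; Semiring; CommutativeMonoid)
import Algebra.Definitions.RawSemiring as RawSemiringDefs
open import Algebra.Module.Bundles using (LeftModule)
import Algebra.Properties.AbelianGroup as AbelianGroupProperties
import Algebra.Properties.CommutativeMonoid.Sum as CommutativeMonoidSum
import Algebra.Properties.CommutativeSemigroup as CommutativeSemigroupProperties
import Algebra.Properties.Ring as RingProperties
import Algebra.Properties.Semiring.Sum as SemiringSum
open import Data.Empty using (⊥-elim)
open import Data.Fin.Base using (Fin; zero; suc; toℕ; punchIn; fromℕ<; opposite; punchOut)
import Data.Fin.Properties as Fin
open import Data.Integer.Base as ℤ using (ℤ; +_; -[1+_]; 0ℤ; 1ℤ)
import Data.Integer.DivMod as ℤ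
open import Data.Integer.Divisibility.Signed using (_∣_; divides; ∣⇒∣ᵤ; ∣m∣n⇒∣m+n; ∣m⇒∣-m)
import Data.Integer.Properties as ℤ
open import Data.List.Extrema ℤ.≤-totalOrder using (min≤v⁺; argmin-sel)
open import Data.Integer.Tactic.RingSolver using (solve-∀)
open import Data.List.Base using (map; filter; upTo)
open import Data.List.Membership.Propositional.Properties
  using (∈-map⁺; ∈-map⁻; ∈-filter⁺; ∈-filter⁻; ∈-upTo⁺; ∈-upTo⁻)
import Data.List.Relation.Unary.Any as Any
open import Data.Maybe.Base using () renaming (map to map∞)
open import Data.Maybe.Properties using (just-injective)
open import Data.Nat.Base as ℕ using (ℕ; zero; suc; _∸_; _^_; NonZero)
import Data.Nat.DivMod as ℕ
import Data.Nat.Divisibility as ℕ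
open import Data.Nat.Primality using (Prime; prime⇒nonZero)
import Data.Nat.Properties as ℕ
open import Data.Product.Base using (Σ; ∃; _×_; _,_; proj₁; proj₂)
open import Data.Sum.Base using (_⊎_; inj₁; inj₂)
open import Data.Unit.Base using (⊤; tt)
open import Data.Vec.Functional using (insertAt; _∷_)
open import Data.Vec.Functional.Properties using (insertAt-lookup; insertAt-punchIn)
open import Function.Base using (_∘_)
open import Function.Bundles using (_⇔_; Equivalence; mk⇔)
open import Function.Definitions using (Injective)
import Relation.Binary.Construct.Add.Supremum.NonStrict ℤ._≤_ as Sup
open import Relation.Binary.Definitions using (tri<; tri≈; tri>)
open import Relation.Binary.PropositionalEquality.Core
  using (_≡_; refl; sym; trans; cong; cong₂; subst; subst₂)
import Relation.Binary.Reasoning.Setoid as SetoidReasoning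
open import Relation.Nullary.Construct.Add.Supremum using ([_]; ⊤⁺)
open import Relation.Nullary.Decidable.Core using (Dec; yes; no; decidable-stable)
open import Relation.Nullary.Negation.Core using (¬_; contradiction)
open import Relation.Unary using (_∈_)

-- `N` is a finite integer not exceeding the tolerance. After scaling by π^(-w(s)), every error in
-- the action of Φ^(s) on the lattice lies in 𝔓^(h + slack), where `slack` = N - (b - h). Both
-- hypotheses come from this exponent: N ≥ b - h keeps the errors inside the lattice, and N ≥ q + b
-- - h puts them inside π times the lattice. Apart from errors, Φ^(s) sends λ_(θ r) to a multiple of
-- λ_(θ (r + s)) if r + s has no carry in base p, and to 0 otherwise. The number w(s) is the largest
-- exponent for which all these multiples stay in the lattice. Under the strong hypothesis this
-- partial addition r ↦ r + s is the whole action modulo π, which is the source of the triangular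
-- matrix. A separate obstacle is the meaning of freeness: the index set of a basis is arbitrary,
-- without decidable equality. Rank one is therefore obtained only up to double negation. This
-- suffices, because the inequality d(s) ≤ w(s) drawn from it is decidable.

module CommutativeMonoidSums {m ℓm : Level} (M : CommutativeMonoid m ℓm) where
  open CommutativeMonoid M using (Carrier; _≈_; ε; ∙-cong; identityˡ; identityʳ)
    renaming (trans to ≈-trans)
  open CommutativeMonoidSum M public

  sum-ε : ∀ {n} {f : Fin n → Carrier} → (∀ i → f i ≈ ε) → sum f ≈ ε
  sum-ε {n} f≈ε = ≈-trans (sum-cong-≋ f≈ε) (sum-replicate-zero n)

  sum-single : ∀ {n} {f : Fin n → Carrier} i → (∀ j → ¬ j ≡ i → f j ≈ ε) → sum f ≈ f i
  sum-single zero off = ≈-trans (∙-cong (CommutativeMonoid.refl M) (sum-ε λ j → off (suc j) λ ()))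
    (identityʳ _)
  sum-single (suc i) off = ≈-trans
    (∙-cong (off zero λ ()) (sum-single i λ j j≢i → off (suc j) (j≢i ∘ Fin.suc-injective)))
    (identityˡ _)

-- Linear combinations in modules.

module LinearCombinations {r ℓr m ℓm : Level} {R : Ring r ℓr} (M : LeftModule R m ℓm) where
  open Ring R using (Carrier; _≈_; _+_; _*_; 0#; 1#)
  private module R = Ring R
  open LeftModule M
  open CommutativeMonoidSums +ᴹ-commutativeMonoid
  private module ΣR = CommutativeMonoidSums R.+-commutativeMonoid
  open SetoidReasoning ≈ᴹ-setoid

  lc : ∀ {k} → (Fin k → Carrier) → (Fin k → Carrierᴹ) → Carrierᴹ
  lc = linearCombination M

  δ : ∀ {n} → Fin n → Fin n → Carrier
  δ i j with i Fin.≟ j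
  ... | yes _ = 1#
  ... | no  _ = 0#

  δ-diagonal : ∀ {n} (i : Fin n) → δ i i ≡ 1#
  δ-diagonal i with i Fin.≟ i
  ... | yes _   = refl
  ... | no  i≢i = contradiction refl i≢i

  δ-off-diagonal : ∀ {n} {i j : Fin n} → ¬ j ≡ i → δ i j ≡ 0#
  δ-off-diagonal {i = i} {j} j≢i with i Fin.≟ j
  ... | yes i≡j = contradiction (sym i≡j) j≢i
  ... | no  _   = refl

  *ₗ-distribˡ-sum : ∀ {n} a (x : Fin n → Carrierᴹ) → a *ₗ sum x ≈ᴹ sum (λ i → a *ₗ x i)
  *ₗ-distribˡ-sum {zero}  a x = *ₗ-zeroʳ a
  *ₗ-distribˡ-sum {suc n} a x =
    ≈ᴹ-trans (*ₗ-distribˡ a _ _) (+ᴹ-cong ≈ᴹ-refl (*ₗ-distribˡ-sum a (x ∘ suc)))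

  *ₗ-distribʳ-sum : ∀ {n} (a : Fin n → Carrier) x → ΣR.sum a *ₗ x ≈ᴹ sum (λ i → a i *ₗ x)
  *ₗ-distribʳ-sum {zero}  a x = *ₗ-zeroˡ x
  *ₗ-distribʳ-sum {suc n} a x =
    ≈ᴹ-trans (*ₗ-distribʳ x _ _) (+ᴹ-cong ≈ᴹ-refl (*ₗ-distribʳ-sum (a ∘ suc) x))

  lc-cong : ∀ {k} {a b : Fin k → Carrier} {x y : Fin k → Carrierᴹ} →
            (∀ i → a i ≈ b i) → (∀ i → x i ≈ᴹ y i) → lc a x ≈ᴹ lc b y
  lc-cong a≈b x≈y = sum-cong-≋ λ i → *ₗ-cong (a≈b i) (x≈y i)

  lc-scale : ∀ {k} a (c : Fin k → Carrier) (x : Fin k → Carrierᴹ) →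
             a *ₗ lc c x ≈ᴹ lc (λ i → a * c i) x
  lc-scale a c x = ≈ᴹ-trans (*ₗ-distribˡ-sum a (λ i → c i *ₗ x i))
    (sum-cong-≋ λ i → ≈ᴹ-sym (*ₗ-assoc a (c i) (x i)))

  lc-+ : ∀ {k} (a b : Fin k → Carrier) (x : Fin k → Carrierᴹ) →
         lc (λ i → a i + b i) x ≈ᴹ lc a x +ᴹ lc b x
  lc-+ a b x = ≈ᴹ-trans (sum-cong-≋ λ i → *ₗ-distribʳ (x i) (a i) (b i))
    (∑-distrib-+ (λ i → a i *ₗ x i) (λ i → b i *ₗ x i))

  lc-- : ∀ {k} (a b : Fin k → Carrier) (x : Fin k → Carrierᴹ) →
         lc (λ i → a i R.- b i) x +ᴹ lc b x ≈ᴹ lc a x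
  lc-- a b x = ≈ᴹ-trans (≈ᴹ-sym (lc-+ (λ i → a i R.- b i) b x)) (lc-cong
    (λ i → R.trans (R.+-assoc (a i) (R.- b i) (b i))
        (R.trans (R.+-congˡ (R.-‿inverseˡ (b i))) (R.+-identityʳ (a i))))
    (λ i → ≈ᴹ-refl))

  lc-δ : ∀ {n} i (x : Fin n → Carrierᴹ) → lc (δ i) x ≈ᴹ x i
  lc-δ i x = ≈ᴹ-trans
    (sum-single {f = λ j → δ i j *ₗ x j} i
      λ j j≢i → ≈ᴹ-trans (*ₗ-congʳ (R.reflexive (δ-off-diagonal j≢i))) (*ₗ-zeroˡ (x j)))
    (≈ᴹ-trans (*ₗ-congʳ (R.reflexive (δ-diagonal i))) (*ₗ-identityˡ (x i)))

  lc-lc : ∀ {k n} (a : Fin k → Carrier) (B : Fin k → Fin n → Carrier) (x : Fin n → Carrierᴹ) →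
          lc a (λ i → lc (B i) x) ≈ᴹ lc (λ j → ΣR.sum (λ i → a i * B i j)) x
  lc-lc a B x = begin
    sum (λ i → a i *ₗ lc (B i) x)
      ≈⟨ sum-cong-≋ (λ i → lc-scale (a i) (B i) x) ⟩
    sum (λ i → sum (λ j → (a i * B i j) *ₗ x j))
      ≈⟨ ∑-comm (λ i j → (a i * B i j) *ₗ x j) ⟩
    sum (λ j → sum (λ i → (a i * B i j) *ₗ x j))
      ≈⟨ sum-cong-≋ (λ j → *ₗ-distribʳ-sum (λ i → a i * B i j) (x j)) ⟨
    lc (λ j → ΣR.sum (λ i → a i * B i j)) x ∎

  lc-reindex : ∀ {k n} (c : Fin k → Carrier) (ι : Fin k → Fin n) (x : Fin n → Carrierᴹ) →
               lc c (x ∘ ι) ≈ᴹ lc (λ j → ΣR.sum (λ i → c i * δ (ι i) j)) x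
  lc-reindex c ι x = ≈ᴹ-trans (lc-cong (λ i → R.refl) λ i → ≈ᴹ-sym (lc-δ (ι i) x))
    (lc-lc c (δ ∘ ι) x)

  Independent : ∀ {n} → (Fin n → Carrierᴹ) → Set _
  Independent x = ∀ c → lc c x ≈ᴹ 0ᴹ → ∀ i → c i ≈ 0#

  Spans : ∀ {n} → (Fin n → Carrierᴹ) → Set _
  Spans {n} x = ∀ y → Σ (Fin n → Carrier) λ c → y ≈ᴹ lc c x

  independent⇒unique : ∀ {n} {x : Fin n → Carrierᴹ} → Independent x →
                       ∀ {a b} → lc a x ≈ᴹ lc b x → ∀ i → a i ≈ b i
  independent⇒unique {x = x} x-independent {a} {b} a≈b i = x-y≈0⇒x≈y (a i) (b i)
      (x-independent (λ i → a i R.- b i)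
    (identityˡ-unique _ _ (≈ᴹ-trans (lc-- a b x) a≈b)) i)
    where
    open AbelianGroupProperties +ᴹ-abelianGroup using (identityˡ-unique)
    x-y≈0⇒x≈y : ∀ x y → x R.- y ≈ 0# → x ≈ y
    x-y≈0⇒x≈y = RingProperties.x∙y⁻¹≈ε⇒x≈y R

  -- The index family delivered by `spanning` may skip or repeat indices; the matrix `δ ∘ ι`
  -- collects its coefficients on the full index set.
  basis⇒spans : ∀ {n} {x : Fin n → Carrierᴹ} → IsBasis M x → Spans x
  basis⇒spans {x = x} x-basis y with IsBasis.spanning x-basis y
  ... | k , ι , c , y≈ = _ , ≈ᴹ-trans y≈ (lc-reindex c ι x)

-- Linear dependence over a field with decidable zero.

module LinearAlgebra {c ℓ : Level} (F : Field c ℓ)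
    (≈0? : (x : Field.Carrier F) → Dec (Field._≈_ F x (Field.0# F))) where
  open Field F hiding (zero)
  open CommutativeMonoidSums +-commutativeMonoid
    using (sum; sum-cong-≋; sum-remove; ∑-distrib-+; sum-ε)
  open SemiringSum semiring using (*-distribʳ-sum)
  open RingProperties ring using (-‿distribˡ-*; -‿distribʳ-*)
  open SetoidReasoning setoid

  ⁻¹-inverseˡ : ∀ x → ¬ x ≈ 0# → x ⁻¹ * x ≈ 1#
  ⁻¹-inverseˡ x x≉0 = ≈-trans (*-comm _ _) (⁻¹-inverseʳ x x≉0)

  -- A weak inverse of the pivot suffices, so that R = 0 needs no separate treatment.
  pivot : ∀ {n} (R : Fin (suc n) → Carrier) → ∃ λ j → ∃ λ r → ∀ i → R i * r * R j ≈ R i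
  pivot R with Fin.all? (λ i → ≈0? (R i))
  ... | yes R≈0 = zero , 0# , λ i → ≈-trans (*-congʳ (zeroʳ (R i)))
                    (≈-trans (zeroˡ (R zero)) (≈-sym (R≈0 i)))
  ... | no R≉0 with Fin.¬∀⟶∃¬ _ _ (λ i → ≈0? (R i)) R≉0
  ... | j , Rj≉0 = j , R j ⁻¹ , λ i → ≈-trans (*-assoc _ _ _)
                     (≈-trans (*-congˡ (⁻¹-inverseˡ (R j) Rj≉0)) (*-identityʳ (R i)))

  -- Gaussian elimination: multiples of the pivot row `q` clear the first column of the other rows.
  -- A kernel vector of the smaller matrix extends by the entry - (S * r) at `q`, which accounts for
  -- all the subtracted multiples at once.
  kernel-nontrivial : ∀ n (M : Fin (suc n) → Fin n → Carrier) →
    Σ (Fin (suc n) → Carrier) λ y → (∃ λ i → ¬ y i ≈ 0#) × (∀ j → sum (λ i → y i * M i j) ≈ 0#)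
  kernel-nontrivial zero    M = (λ _ → 1#) , (zero , 1≉0) , λ ()
  kernel-nontrivial (suc n) M with pivot (λ i → M i zero)
  ... | q , r , pivot-q with kernel-nontrivial n
          (λ i j → M (punchIn q i) (suc j) - M (punchIn q i) zero * r * M q (suc j))
  ... | y , (i₀ , y≉0) , y-kernel = y′ , (punchIn q i₀ , y′≉0) , y′-kernel
    where
    S : Carrier
    S = sum (λ i → y i * M (punchIn q i) zero)

    y′ : Fin (suc (suc n)) → Carrier
    y′ = insertAt y q (- (S * r))

    y′≉0 : ¬ y′ (punchIn q i₀) ≈ 0#
    y′≉0 = subst (λ z → ¬ z ≈ 0#) (sym (insertAt-punchIn y q _ i₀)) y≉0

    expand : ∀ y a b t → y * (a - b * r * t) ≈ y * a + y * b * - (r * t)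
    expand y a b t = begin
      y * (a - b * r * t)            ≈⟨ distribˡ y a _ ⟩
      y * a + y * - (b * r * t)      ≈⟨ +-congˡ (*-congˡ (-‿cong (*-assoc b r t))) ⟩
      y * a + y * - (b * (r * t))    ≈⟨ +-congˡ (*-congˡ (-‿distribʳ-* b (r * t))) ⟩
      y * a + y * (b * - (r * t))    ≈⟨ +-congˡ (*-assoc y b _) ⟨
      y * a + y * b * - (r * t)      ∎

    pull : ∀ t → - (S * r) * t ≈ S * - (r * t)
    pull t = begin
      - (S * r) * t    ≈⟨ -‿distribˡ-* (S * r) t ⟨
      - (S * r * t)    ≈⟨ -‿cong (*-assoc S r t) ⟩
      - (S * (r * t))  ≈⟨ -‿distribʳ-* S (r * t) ⟩
      S * - (r * t)    ∎

    reduced : ∀ j → sum (λ i → y′ i * M i j) ≈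
              sum (λ i → y i * (M (punchIn q i) j - M (punchIn q i) zero * r * M q j))
    reduced j = begin
      sum (λ i → y′ i * M i j)
        ≈⟨ sum-remove {i = q} (λ i → y′ i * M i j) ⟩
      y′ q * M q j + sum (λ i → y′ (punchIn q i) * M (punchIn q i) j)
        ≈⟨ +-cong (*-congʳ (reflexive (insertAt-lookup y q _)))
             (sum-cong-≋ λ i → *-congʳ {M (punchIn q i) j}
                 (reflexive (insertAt-punchIn y q (- (S * r)) i))) ⟩
      - (S * r) * M q j + sum a
        ≈⟨ +-congʳ (pull (M q j)) ⟩
      S * - (r * M q j) + sum a
        ≈⟨ +-comm _ _ ⟩
      sum a + S * - (r * M q j)
        ≈⟨ +-congˡ (*-distribʳ-sum (- (r * M q j)) (λ i → y i * M (punchIn q i) zero)) ⟩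
      sum a + sum b
        ≈⟨ ∑-distrib-+ a b ⟨
      sum (λ i → a i + b i)
        ≈⟨ sum-cong-≋ (λ i → expand (y i) (M (punchIn q i) j) (M (punchIn q i) zero) (M q j)) ⟨
      sum (λ i → y i * (M (punchIn q i) j - M (punchIn q i) zero * r * M q j)) ∎
      where
      a b : Fin (suc n) → Carrier
      a i = y i * M (punchIn q i) j
      b i = y i * M (punchIn q i) zero * - (r * M q j)

    y′-kernel : ∀ j → sum (λ i → y′ i * M i j) ≈ 0#
    -- The weak inverse `r` makes every summand vanish separately, even when the whole column is
    -- zero.
    y′-kernel zero = ≈-trans (reduced zero) (sum-ε λ i → ≈-trans (*-congˡ
      (≈-trans (+-congˡ (-‿cong (pivot-q (punchIn q i)))) (-‿inverseʳ _))) (zeroʳ (y i)))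
    y′-kernel (suc j) = ≈-trans (reduced (suc j)) (y-kernel j)

module LinearDependence {c ℓ m ℓm : Level} (F : Field c ℓ)
  (≈0? : (x : Field.Carrier F) → Dec (Field._≈_ F x (Field.0# F)))
  (V : LeftModule (Field.ring F) m ℓm) where
  open Field F hiding (zero)
  open LinearAlgebra F ≈0?
  open LeftModule V
  open LinearCombinations V
  private module Σᴹ = CommutativeMonoidSums +ᴹ-commutativeMonoid
  open AbelianGroupProperties +ᴹ-abelianGroup using (inverseˡ-unique)
  open RingProperties ring using (-1*x≈-x)
  open SetoidReasoning ≈ᴹ-setoid

  dependent : ∀ {n} → HasDimension V n → (x : Fin (suc n) → Carrierᴹ) →
              Σ (Fin (suc n) → Carrier) λ z → (∃ λ i → ¬ z i ≈ 0#) × lc z x ≈ᴹ 0ᴹ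
  dependent {n} (e , e-basis) x with kernel-nontrivial n (λ i → proj₁ (basis⇒spans e-basis (x i)))
  ... | z , z≉0 , z-kernel = z , z≉0 , (begin
    lc z x
      ≈⟨ lc-cong {a = z} (λ i → ≈-refl) (λ i → proj₂ (basis⇒spans e-basis (x i))) ⟩
    lc z (λ i → lc (proj₁ (basis⇒spans e-basis (x i))) e)
      ≈⟨ lc-lc z (λ i → proj₁ (basis⇒spans e-basis (x i))) e ⟩
    lc _ e
      ≈⟨ Σᴹ.sum-ε (λ j → ≈ᴹ-trans (*ₗ-congʳ (z-kernel j)) (*ₗ-zeroˡ (e j))) ⟩
    0ᴹ ∎)

  -- The n + 1 vectors `y ∷ x` satisfy a nontrivial relation. Independence of `x` prevents the
  -- coefficient of `y` from vanishing, so the relation can be solved for `y`.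
  independent⇒spans : ∀ {n} → HasDimension V n →
                      ∀ {x : Fin n → Carrierᴹ} → Independent x → Spans x
  independent⇒spans {n} dim {x} x-independent y with dependent dim (y ∷ x)
  ... | z , (i₀ , z≉0) , relation = (λ i → - (z zero ⁻¹) * z (suc i)) , (begin
      y                                            ≈⟨ *ₗ-identityˡ y ⟨
      1# *ₗ y                                      ≈⟨ *ₗ-congʳ (⁻¹-inverseˡ (z zero) z₀≉0) ⟨
      (z zero ⁻¹ * z zero) *ₗ y                    ≈⟨ *ₗ-assoc _ _ y ⟩
      z zero ⁻¹ *ₗ (z zero *ₗ y)                   ≈⟨ *ₗ-congˡ z₀y ⟩
      z zero ⁻¹ *ₗ (- 1# *ₗ lc (z ∘ suc) x)        ≈⟨ *ₗ-assoc _ _ _ ⟨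
      (z zero ⁻¹ * - 1#) *ₗ lc (z ∘ suc) x         ≈⟨ *ₗ-congʳ (≈-trans (*-comm _ _) (-1*x≈-x _)) ⟩
      - (z zero ⁻¹) *ₗ lc (z ∘ suc) x                ≈⟨ lc-scale _ _ x ⟩
      lc (λ i → - (z zero ⁻¹) * z (suc i)) x         ∎)
    where
    z₀y : z zero *ₗ y ≈ᴹ - 1# *ₗ lc (z ∘ suc) x
    z₀y = ≈ᴹ-trans (inverseˡ-unique _ _ relation) (≈ᴹ-sym (inverseˡ-unique _ _ (begin
      - 1# *ₗ lc (z ∘ suc) x +ᴹ lc (z ∘ suc) x
        ≈⟨ +ᴹ-cong ≈ᴹ-refl (*ₗ-identityˡ _) ⟨
      - 1# *ₗ lc (z ∘ suc) x +ᴹ 1# *ₗ lc (z ∘ suc) x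
        ≈⟨ *ₗ-distribʳ _ _ _ ⟨
      (- 1# + 1#) *ₗ lc (z ∘ suc) x
        ≈⟨ ≈ᴹ-trans (*ₗ-congʳ (-‿inverseˡ 1#)) (*ₗ-zeroˡ _) ⟩
      0ᴹ ∎)))

    z₀≉0 : ¬ z zero ≈ 0#
    z₀≉0 z₀≈0 = z≉0 (z≈0 i₀)
      where
      z≈0 : ∀ i → z i ≈ 0#
      z≈0 zero    = z₀≈0
      z≈0 (suc i) = x-independent (z ∘ suc) (≈ᴹ-trans (≈ᴹ-sym (+ᴹ-identityˡ _))
        (≈ᴹ-trans (+ᴹ-cong (≈ᴹ-sym (≈ᴹ-trans (*ₗ-congʳ z₀≈0) (*ₗ-zeroˡ y))) ≈ᴹ-refl) relation)) i

-- Valuations, sums without cancellation, and matrices modulo the maximal ideal.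

module ValuationProperties {c ℓ : Level} {F : Field c ℓ} (𝕧 : NormalizedDiscreteValuation F) where
  open Field F hiding (zero)
  open NormalizedDiscreteValuation 𝕧
  open CommutativeMonoidSums +-commutativeMonoid
    using (sum)
  open AbelianGroupProperties +-abelianGroup using (xyx⁻¹≈y; ⁻¹-∙-comm; ⁻¹-involutive)
  open CommutativeSemigroupProperties +-commutativeSemigroup using (interchange)

  i<suc[i] : ∀ {i} → i ℤ.< ℤ.suc i
  i<suc[i] = ℤ.suc[i]≤j⇒i<j ℤ.≤-refl

  <⇒≱∞ : ∀ {i j} → i ℤ.< j → ¬ [ j ] ≤∞ [ i ]
  <⇒≱∞ i<j Sup.[ j≤i ] = ℤ.<⇒≱ i<j j≤i

  -- The value ∞ is recognisable, so the valuation decides vanishing; this supplies the decidability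
  -- that the linear algebra asks for.
  ≈0? : ∀ x → Dec (x ≈ 0#)
  ≈0? x with v x in v-x
  ... | ⊤⁺    = yes (Equivalence.to (v-∞ x) v-x)
  ... | [ i ] = no λ x≈0 → case-[]≡⊤ (trans (sym v-x) (Equivalence.from (v-∞ x) x≈0))
    where
    case-[]≡⊤ : ¬ [ i ] ≡ ⊤⁺
    case-[]≡⊤ ()

  v-finite : ∀ {x i} → v x ≡ [ i ] → ¬ x ≈ 0#
  v-finite {x} v-x x≈0 with trans (sym v-x) (Equivalence.from (v-∞ x) x≈0)
  ... | ()

  ≉0⇒v : ∀ {x} → ¬ x ≈ 0# → ∃ λ i → v x ≡ [ i ]
  ≉0⇒v {x} x≉0 with v x in v-x
  ... | ⊤⁺    = contradiction (Equivalence.to (v-∞ x) v-x) x≉0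
  ... | [ i ] = i , refl

  𝔓-weaken : ∀ {i j x} → i ℤ.≤ j → x ∈ 𝔓 [ j ] → x ∈ 𝔓 [ i ]
  𝔓-weaken i≤j = ≤∞-trans Sup.[ i≤j ]

  v⇒∈𝔓 : ∀ {x i m} → v x ≡ [ i ] → m ℤ.≤ i → x ∈ 𝔓 [ m ]
  v⇒∈𝔓 {m = m} v-x m≤i = subst ([ m ] ≤∞_) (sym v-x) Sup.[ m≤i ]

  ∈𝔓⇒v : ∀ {x i m} → v x ≡ [ i ] → x ∈ 𝔓 [ m ] → m ℤ.≤ i
  ∈𝔓⇒v {m = m} v-x x∈ = Sup.[≤]-injective (subst ([ m ] ≤∞_) v-x x∈)

  𝔓-- : ∀ {m x y} → x ∈ 𝔓 m → y ∈ 𝔓 m → x - y ∈ 𝔓 m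
  𝔓-- x∈ y∈ = 𝔓-+ x∈ (𝔓-neg y∈)

  ≈0⇒∈𝔓 : ∀ {m x} → x ≈ 0# → x ∈ 𝔓 m
  ≈0⇒∈𝔓 x≈0 = 𝔓-resp (≈-sym x≈0) (𝔓-0 _)

  x-y+y≈x : ∀ x y → x - y + y ≈ x
  x-y+y≈x x y = ≈-trans (+-assoc x (- y) y) (≈-trans (+-congˡ (-‿inverseˡ y)) (+-identityʳ x))

  x-[x-y]≈y : ∀ x y → x - (x - y) ≈ y
  x-[x-y]≈y x y = ≈-trans (+-congˡ (≈-trans (≈-sym (⁻¹-∙-comm x (- y)))
    (+-congˡ (⁻¹-involutive y))))
    (≈-trans (≈-sym (+-assoc x (- x) y)) (≈-trans (+-congʳ (-‿inverseʳ x)) (+-identityˡ y)))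

  𝔓-transportʳ : ∀ {m x y} → x - y ∈ 𝔓 m → y ∈ 𝔓 m → x ∈ 𝔓 m
  𝔓-transportʳ x-y∈ y∈ = 𝔓-resp (x-y+y≈x _ _) (𝔓-+ x-y∈ y∈)

  𝔓-transportˡ : ∀ {m x y} → x - y ∈ 𝔓 m → x ∈ 𝔓 m → y ∈ 𝔓 m
  𝔓-transportˡ x-y∈ x∈ = 𝔓-resp (x-[x-y]≈y _ _) (𝔓-- x∈ x-y∈)

  ∉𝔓⇒v : ∀ {x m} → ¬ x ∈ 𝔓 [ m ] → ∃ λ i → v x ≡ [ i ] × i ℤ.< m
  ∉𝔓⇒v {x} {m} x∉ with v x
  ... | ⊤⁺    = contradiction ([ m ] Sup.≤⊤⁺) x∉
  ... | [ i ] = i , refl , ℤ.≰⇒> (x∉ ∘ Sup.[_])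

  _∈𝔓?_ : ∀ x m → Dec (x ∈ 𝔓 [ m ])
  x ∈𝔓? m = Sup.≤⁺-dec ℤ._≤?_ [ m ] (v x)

  ∈all𝔓⇒≈0 : ∀ {x} → (∀ m → x ∈ 𝔓 [ m ]) → x ≈ 0#
  ∈all𝔓⇒≈0 {x} x∈ with v x in v-x
  ... | ⊤⁺    = Equivalence.to (v-∞ x) v-x
  ... | [ i ] = contradiction (x∈ (ℤ.suc i)) (<⇒≱∞ (i<suc[i] {i}))

  v-dominant : ∀ {x y i} → v x ≡ [ i ] → x - y ∈ 𝔓 [ ℤ.suc i ] → v y ≡ [ i ]
  v-dominant {x} {y} {i} v-x x-y∈ with y ∈𝔓? ℤ.suc i
  ... | yes y∈ = contradiction (∈𝔓⇒v v-x (𝔓-transportʳ x-y∈ y∈)) (ℤ.<⇒≱ i<suc[i])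
  ... | no y∉ with ∉𝔓⇒v y∉
  ... | j , v-y , j<suc-i = trans v-y (cong [_] (ℤ.≤-antisym
    (subst (j ℤ.≤_) (ℤ.pred-suc i) (ℤ.i<j⇒i≤pred[j] j<suc-i))
    (∈𝔓⇒v v-y (𝔓-transportˡ (𝔓-weaken (ℤ.i≤suc[i] _) x-y∈) (v⇒∈𝔓 v-x ℤ.≤-refl)))))

  v-+ˡ : ∀ {x y i} → v x ≡ [ i ] → y ∈ 𝔓 [ ℤ.suc i ] → v (x + y) ≡ [ i ]
  v-+ˡ {x} {y} v-x y∈ = v-dominant v-x (𝔓-resp (≈-sym
    (≈-trans (+-congˡ (≈-sym (⁻¹-∙-comm x y))) (≈-trans (≈-sym (+-assoc x (- x) (- y)))
      (≈-trans (+-congʳ (-‿inverseʳ x)) (+-identityˡ (- y)))))) (𝔓-neg y∈))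

  -- Only finite values count, so several zero summands do not violate `Distinct`.
  SameValuation : Carrier → Carrier → Set
  SameValuation x y = ∃ λ i → v x ≡ [ i ] × v y ≡ [ i ]

  v-+-distinct : ∀ {x y} → ¬ SameValuation x y → v (x + y) ≡ v x ⊓∞ v y
  v-+-distinct {x} {y} x≁y with v x in v-x | v y in v-y
  ... | ⊤⁺    | _     = trans
      (v-cong (≈-trans (+-congʳ (Equivalence.to (v-∞ x) v-x)) (+-identityˡ y))) v-y
  ... | [ i ] | ⊤⁺    = trans
      (v-cong (≈-trans (+-congˡ (Equivalence.to (v-∞ y) v-y)) (+-identityʳ x))) v-x
  ... | [ i ] | [ j ] with ℤ.<-cmp i j
  ... | tri< i<j _ _ = trans (v-+ˡ v-x (v⇒∈𝔓 v-y (ℤ.i<j⇒suc[i]≤j i<j)))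
                         (cong [_] (sym (ℤ.i≤j⇒i⊓j≡i (ℤ.<⇒≤ i<j))))
  ... | tri≈ _ refl _ = contradiction (i , refl , refl) x≁y
  ... | tri> _ _ j<i = trans (v-cong (+-comm x y)) (trans (v-+ˡ v-y (v⇒∈𝔓 v-x (ℤ.i<j⇒suc[i]≤j j<i)))
                         (cong [_] (sym (ℤ.i≥j⇒i⊓j≡j (ℤ.<⇒≤ j<i)))))

  ⊓∞-sel : ∀ x y → x ⊓∞ y ≡ x ⊎ x ⊓∞ y ≡ y
  ⊓∞-sel [ i ] [ j ] with ℤ.⊓-sel i j
  ... | inj₁ e = inj₁ (cong [_] e)
  ... | inj₂ e = inj₂ (cong [_] e)
  ⊓∞-sel [ i ] ⊤⁺    = inj₁ refl
  ⊓∞-sel ⊤⁺    y     = inj₂ refl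

  ⊓∞-lowerˡ : ∀ x y → x ⊓∞ y ≤∞ x
  ⊓∞-lowerˡ [ i ] [ j ] = Sup.[ ℤ.i⊓j≤i i j ]
  ⊓∞-lowerˡ [ i ] ⊤⁺    = Sup.[ ℤ.≤-refl ]
  ⊓∞-lowerˡ ⊤⁺    y     = _ Sup.≤⊤⁺

  ⊓∞-lowerʳ : ∀ x y → x ⊓∞ y ≤∞ y
  ⊓∞-lowerʳ [ i ] [ j ] = Sup.[ ℤ.i⊓j≤j i j ]
  ⊓∞-lowerʳ [ i ] ⊤⁺    = _ Sup.≤⊤⁺
  ⊓∞-lowerʳ ⊤⁺    [ j ] = Sup.[ ℤ.≤-refl ]
  ⊓∞-lowerʳ ⊤⁺    ⊤⁺    = _ Sup.≤⊤⁺

  Distinct : ∀ {k} → (Fin k → Carrier) → Set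
  Distinct f = ∀ {i j} → SameValuation (f i) (f j) → i ≡ j

  tail-distinct : ∀ {k} {f : Fin (suc k) → Carrier} → Distinct f → Distinct (f ∘ suc)
  tail-distinct f-distinct = Fin.suc-injective ∘ f-distinct

  -- Joint induction with `head≁tail`: a finite value of the tail sum is the value of one term,
  -- hence not that of the head, and so the value of head plus tail is the smaller of the two.
  v-sum-attained : ∀ {k} (f : Fin k → Carrier) → Distinct f → ∀ {i} → v (sum f) ≡ [ i ] → ∃ λ j →
      v (f j) ≡ [ i ]
  head≁tail : ∀ {k} (f : Fin (suc k) → Carrier) → Distinct f →
      ¬ SameValuation (f zero) (sum (f ∘ suc))

  v-sum-attained {zero} f f-distinct v-sum = ⊥-elim (v-finite v-sum ≈-refl)
  v-sum-attained {suc k} f f-distinct {i} v-sum with ⊓∞-sel (v (f zero)) (v (sum (f ∘ suc)))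
  ... | inj₁ e = zero , trans (sym (trans (v-+-distinct (head≁tail f f-distinct)) e)) v-sum
  ... | inj₂ e with v-sum-attained (f ∘ suc) (tail-distinct f-distinct)
                      (trans (sym (trans (v-+-distinct (head≁tail f f-distinct)) e)) v-sum)
  ... | j , v-fj = suc j , v-fj

  head≁tail f f-distinct (i , v-head , v-tail) with v-sum-attained (f ∘ suc)
      (tail-distinct f-distinct) v-tail
  ... | j , v-fj with f-distinct (i , v-head , v-fj)
  ... | ()

  -- The value of the sum is the minimum of the values of head and tail, so a lower bound for it
  -- passes to both.
  sum-distinct : ∀ {k m} (f : Fin k → Carrier) → Distinct f → sum f ∈ 𝔓 [ m ] → ∀ j → f j ∈ 𝔓 [ m ]
  sum-distinct f f-distinct sum∈ zero =
    ≤∞-trans (subst (_ ≤∞_) (v-+-distinct (head≁tail f f-distinct)) sum∈) (⊓∞-lowerˡ _ _)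
  sum-distinct f f-distinct sum∈ (suc j) = sum-distinct (f ∘ suc) (tail-distinct f-distinct)
    (≤∞-trans (subst (_ ≤∞_) (v-+-distinct (head≁tail f f-distinct)) sum∈)
        (⊓∞-lowerʳ (v (f zero)) _)) j

  𝔓-sum : ∀ {k m} {f : Fin k → Carrier} → (∀ i → f i ∈ 𝔓 m) → sum f ∈ 𝔓 m
  𝔓-sum {zero}  f∈ = 𝔓-0 _
  𝔓-sum {suc k} f∈ = 𝔓-+ (f∈ zero) (𝔓-sum (f∈ ∘ suc))

  x-y-interchange : ∀ x y z w → (x - z) + (y - w) ≈ (x + y) - (z + w)
  x-y-interchange x y z w = ≈-trans (interchange x (- z) y (- w)) (+-congˡ (⁻¹-∙-comm z w))

  sum-cong-𝔓 : ∀ {k m} {f g : Fin k → Carrier} → (∀ i → f i - g i ∈ 𝔓 m) → sum f - sum g ∈ 𝔓 m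
  sum-cong-𝔓 {zero}  f≡g = ≈0⇒∈𝔓 (-‿inverseʳ 0#)
  sum-cong-𝔓 {suc k} f≡g = 𝔓-resp (x-y-interchange _ _ _ _)
      (𝔓-+ (f≡g zero) (sum-cong-𝔓 (f≡g ∘ suc)))

  sum-single-𝔓 : ∀ {k m} {f : Fin k → Carrier} i → (∀ j → ¬ j ≡ i → f j ∈ 𝔓 m) → sum f - f i ∈ 𝔓 m
  sum-single-𝔓 {f = f} zero off = 𝔓-resp (≈-sym (xyx⁻¹≈y (f zero) _)) (𝔓-sum λ j → off (suc j) λ ())
  sum-single-𝔓 (suc i) off = 𝔓-resp (≈-sym (+-assoc _ _ _))
    (𝔓-+ (off zero λ ()) (sum-single-𝔓 i λ j j≢i → off (suc j) (j≢i ∘ Fin.suc-injective)))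

  v-*-finite : ∀ {x y i j} → v x ≡ [ i ] → v y ≡ [ j ] → v (x * y) ≡ [ i ℤ.+ j ]
  v-*-finite v-x v-y = trans (v-* _ _) (cong₂ _+∞_ v-x v-y)

  v-quotient : ∀ {x y i j} → v y ≡ [ j ] → v (x * y) ≡ [ i ] → v x ≡ [ i ℤ.- j ]
  v-quotient {x} {y} {i} {j} v-y v-xy = cancel (v x)
      (trans (sym (trans (v-* x y) (cong (v x +∞_) v-y))) v-xy)
    where
    cancel : ∀ z → z +∞ [ j ] ≡ [ i ] → z ≡ [ i ℤ.- j ]
    cancel [ z ] e = cong [_] (trans (lem z j) (cong (ℤ._- j) (just-injective e)))
      where
      lem : ∀ z j → z ≡ z ℤ.+ j ℤ.- j
      lem = solve-∀

  v-⁻¹ : ∀ {x i} → v x ≡ [ i ] → v (x ⁻¹) ≡ [ ℤ.- i ]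
  v-⁻¹ {x} {i} v-x = trans
    (v-quotient v-x (trans (v-cong (≈-trans (*-comm (x ⁻¹) x) (⁻¹-inverseʳ x (v-finite v-x)))) v1))
    (cong [_] (ℤ.+-identityˡ (ℤ.- i)))

  v-^ᴺ : ∀ {x i} → v x ≡ [ i ] → ∀ m → v (x ^ᴺ m) ≡ [ + m ℤ.* i ]
  v-^ᴺ {i = i} v-x zero    = trans v1 (cong [_] (sym (ℤ.*-zeroˡ i)))
  v-^ᴺ {i = i} v-x (suc m) = trans (v-*-finite v-x (v-^ᴺ v-x m)) (cong [_] (sym (ℤ.suc-* (+ m) i)))

  v-^ᶻ : ∀ {π} → IsUniformizer π → ∀ m → v (π ^ᶻ m) ≡ [ m ]
  v-^ᶻ v-π (+ m)    = trans (v-^ᴺ v-π m) (cong [_] (ℤ.*-identityʳ (+ m)))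
  v-^ᶻ v-π -[1+ m ] = trans (v-^ᴺ (v-⁻¹ v-π) (suc m))
      (cong [_] (trans (ℤ.*-comm (+ suc m) ℤ.-1ℤ) (ℤ.-1*i≡-i (+ suc m))))

  v-*-cancelʳ : ∀ {x y m} → v y ≡ [ 0ℤ ] → x * y ∈ 𝔓 m → x ∈ 𝔓 m
  v-*-cancelʳ {x} {y} {m} v-y xy∈ = subst (m ≤∞_)
      (trans (v-* x y) (trans (cong (v x +∞_) v-y) (+∞-identityʳ (v x)))) xy∈
    where
    +∞-identityʳ : ∀ z → z +∞ [ 0ℤ ] ≡ z
    +∞-identityʳ ⊤⁺    = refl
    +∞-identityʳ [ i ] = cong [_] (ℤ.+-identityʳ i)

  𝔒-*-𝔓 : ∀ {x y m} → x ∈ 𝔓 [ 0ℤ ] → y ∈ 𝔓 [ m ] → x * y ∈ 𝔓 [ m ]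
  𝔒-*-𝔓 {m = m} x∈ y∈ = 𝔓-weaken (ℤ.≤-reflexive (sym (ℤ.+-identityˡ m))) (𝔓-* x∈ y∈)

  unit⇒v≡0 : ∀ {u} → Is𝔒Unit u → v u ≡ [ 0ℤ ]
  unit⇒v≡0 {u} (u∈ , (u′ , u′∈) , _ , uu′≈1) = squeeze (v u) (v u′) u∈ u′∈
    (trans (sym (v-* u u′)) (trans (v-cong uu′≈1) v1))
    where
    squeeze : ∀ x y → [ 0ℤ ] ≤∞ x → [ 0ℤ ] ≤∞ y → x +∞ y ≡ [ 0ℤ ] → x ≡ [ 0ℤ ]
    squeeze [ i ] [ j ] Sup.[ 0≤i ] Sup.[ 0≤j ] e = cong [_] (ℤ.≤-antisym
      (subst (i ℤ.≤_) (just-injective e) (ℤ.i≤i+j i j ⦃ ℤ.nonNegative 0≤j ⦄)) 0≤i)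

  -- The bound is a negated natural number, ready for recursion on it or for clearing denominators
  -- with a nonnegative power of `π`.
  bounded-below : ∀ {k} (f : Fin k → Carrier) → ∃ λ m → ∀ i → f i ∈ 𝔓 [ ℤ.- (+ m) ]
  bounded-below {zero}  f = 0 , λ ()
  bounded-below {suc k} f with bounded-below (f ∘ suc) | bound (v (f zero))
    where
    bound : ∀ x → ∃ λ m → [ ℤ.- (+ m) ] ≤∞ x
    bound ⊤⁺           = 0 , (_ Sup.≤⊤⁺)
    bound [ + i ]      = 0 , Sup.[ ℤ.+≤+ ℕ.z≤n ]
    bound [ -[1+ i ] ] = suc i , Sup.[ ℤ.≤-refl ]
  ... | m , tail∈ | m′ , head∈ = m ℕ.⊔ m′ , λ where
    zero    → 𝔓-weaken (ℤ.neg-mono-≤ (ℤ.+≤+ (ℕ.m≤n⊔m m m′))) head∈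
    (suc i) → 𝔓-weaken (ℤ.neg-mono-≤ (ℤ.+≤+ (ℕ.m≤m⊔n m m′))) (tail∈ i)

  -- Over the residue field, X and BX are upper triangular and BX has nonzero diagonal. Column 0 of
  -- BX is column 0 of B times X₀₀; hence X₀₀ is a unit and the rest of that column of B vanishes.
  -- Deleting the first row and column leaves the same situation, so no determinants are needed.
  triangular-units : ∀ n (B X : Fin n → Fin n → Carrier) →
    (∀ k s → B k s ∈ 𝔓 [ 0ℤ ]) → (∀ s j → X s j ∈ 𝔓 [ 0ℤ ]) →
    (∀ {s j} → toℕ j ℕ.< toℕ s → X s j ∈ 𝔓 [ 1ℤ ]) →
    (∀ {k j} → toℕ j ℕ.< toℕ k → sum (λ s → B k s * X s j) ∈ 𝔓 [ 1ℤ ]) →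
    (∀ k → ¬ sum (λ s → B k s * X s k) ∈ 𝔓 [ 1ℤ ]) →
    ∀ s → ¬ X s s ∈ 𝔓 [ 1ℤ ]
  triangular-units (suc n) B X B∈ X∈ upper lower diagonal = units
    where
    column₀ : ∀ k → sum (λ s → B k s * X s zero) - B k zero * X zero zero ∈ 𝔓 [ 1ℤ ]
    column₀ k = sum-single-𝔓 {f = λ s → B k s * X s zero} zero λ where
      zero    0≢0 → contradiction refl 0≢0
      (suc s) _   → 𝔒-*-𝔓 (B∈ k (suc s)) (upper (ℕ.s≤s ℕ.z≤n))

    X₀₀∉ : ¬ X zero zero ∈ 𝔓 [ 1ℤ ]
    X₀₀∉ X₀₀∈ = diagonal zero (𝔓-transportʳ (column₀ zero) (𝔒-*-𝔓 (B∈ zero zero) X₀₀∈))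

    v-X₀₀ : v (X zero zero) ≡ [ 0ℤ ]
    v-X₀₀ = let i , v-X , i<1 = ∉𝔓⇒v X₀₀∉ in
      trans v-X (cong [_] (ℤ.≤-antisym (ℤ.i<j⇒i≤pred[j] i<1) (∈𝔓⇒v v-X (X∈ zero zero))))

    Bₖ₀∈ : ∀ k → B (suc k) zero ∈ 𝔓 [ 1ℤ ]
    Bₖ₀∈ k = v-*-cancelʳ v-X₀₀ (𝔓-transportˡ (column₀ (suc k)) (lower (ℕ.s≤s ℕ.z≤n)))

    tail : ∀ k j → sum (λ s → B (suc k) s * X s (suc j)) -
                   sum (λ s → B (suc k) (suc s) * X (suc s) (suc j)) ∈ 𝔓 [ 1ℤ ]
    tail k j = 𝔓-resp
      (≈-sym (≈-trans (+-assoc _ _ _) (≈-trans (+-congˡ (-‿inverseʳ _)) (+-identityʳ _))))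
      (𝔓-weaken (ℤ.≤-reflexive (sym (ℤ.+-identityʳ 1ℤ))) (𝔓-* (Bₖ₀∈ k) (X∈ zero (suc j))))

    units : ∀ s → ¬ X s s ∈ 𝔓 [ 1ℤ ]
    units zero    = X₀₀∉
    units (suc s) = triangular-units n (λ k s → B (suc k) (suc s)) (λ s j → X (suc s) (suc j))
      (λ k s → B∈ (suc k) (suc s)) (λ s j → X∈ (suc s) (suc j)) (λ j<s → upper (ℕ.s≤s j<s))
      (λ {k} {j} j<k → 𝔓-transportˡ (tail k j) (lower (ℕ.s≤s j<k)))
      (λ k ∈𝔓 → diagonal (suc k) (𝔓-transportʳ (tail k k) ∈𝔓)) s

-- Congruences, counting and base-p digits.

module Congruence (m : ℕ) where
  mod-reflexive : ∀ x y → x ≡ y → x ≡ y [mod m ]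
  mod-reflexive x _ refl = divides 0ℤ (ℤ.+-inverseʳ x)

  mod-sym : ∀ x y → x ≡ y [mod m ] → y ≡ x [mod m ]
  mod-sym x y e = subst (+ m ∣_) (lem x y) (∣m⇒∣-m e)
    where
    lem : ∀ x y → ℤ.- (x ℤ.- y) ≡ y ℤ.- x
    lem = solve-∀

  mod-trans : ∀ x y z → x ≡ y [mod m ] → y ≡ z [mod m ] → x ≡ z [mod m ]
  mod-trans x y z e₁ e₂ = subst (+ m ∣_) (lem x y z) (∣m∣n⇒∣m+n e₁ e₂)
    where
    lem : ∀ x y z → x ℤ.- y ℤ.+ (y ℤ.- z) ≡ x ℤ.- z
    lem = solve-∀

  mod-neg : ∀ x y → x ≡ y [mod m ] → ℤ.- x ≡ ℤ.- y [mod m ]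
  mod-neg x y e = subst (+ m ∣_) (lem x y) (∣m⇒∣-m e)
    where
    lem : ∀ x y → ℤ.- (x ℤ.- y) ≡ ℤ.- x ℤ.- ℤ.- y
    lem = solve-∀

  mod-+-multiple : ∀ x k → x ℤ.+ k ℤ.* + m ≡ x [mod m ]
  mod-+-multiple x k = divides k (lem x (k ℤ.* + m))
    where
    lem : ∀ x y → x ℤ.+ y ℤ.- x ≡ y
    lem = solve-∀

  mod-+-cancelˡ : ∀ z x y → z ℤ.+ x ≡ z ℤ.+ y [mod m ] → x ≡ y [mod m ]
  mod-+-cancelˡ z x y e = subst (+ m ∣_) (lem z x y) e
    where
    lem : ∀ z x y → z ℤ.+ x ℤ.- (z ℤ.+ y) ≡ x ℤ.- y
    lem = solve-∀

  toℕ-mod-injective : ∀ (i j : Fin m) → + toℕ i ≡ + toℕ j [mod m ] → i ≡ j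
  toℕ-mod-injective i j e = Fin.toℕ-injective
      (ℤ.+-injective (ℤ.i-j≡0⇒i≡j _ _ (ℤ.∣i∣≡0⇒i≡0 (small (∣⇒∣ᵤ e)))))
    where
    bound : ℤ.∣ + toℕ i ℤ.- + toℕ j ∣ ℕ.< m
    bound = ℕ.≤-<-trans
        (subst (λ z → ℤ.∣ z ∣ ℕ.≤ toℕ i ℕ.⊔ toℕ j) (sym (ℤ.m-n≡m⊖n (toℕ i) (toℕ j)))
            (ℤ.∣m⊝n∣≤m⊔n (toℕ i) (toℕ j)))
      (ℕ.⊔-pres-<m (Fin.toℕ<n i) (Fin.toℕ<n j))
    small : m ℕ.∣ ℤ.∣ + toℕ i ℤ.- + toℕ j ∣ → ℤ.∣ + toℕ i ℤ.- + toℕ j ∣ ≡ 0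
    small m∣ with ℤ.∣ + toℕ i ℤ.- + toℕ j ∣ | bound
    ... | zero  | _   = refl
    ... | suc k | k<m = contradiction m∣ (ℕ.>⇒∤ k<m)

-- Finitely many doubly negated facts may be assumed together; this is how equalities of basis
-- indices become usable.
¬¬-all : ∀ {N a} {P : Fin N → Set a} → (∀ i → ¬ ¬ P i) → ¬ ¬ (∀ i → P i)
¬¬-all {zero}  ¬¬P ¬all = ¬all λ ()
¬¬-all {suc N} ¬¬P ¬all = ¬¬P zero λ P₀ → ¬¬-all (¬¬P ∘ suc) λ Pₛ → ¬all λ where
  zero    → P₀
  (suc i) → Pₛ i

-- If `j` were missed, `punchOut` at `j` would inject n + 1 elements into n.
injective⇒surjective : ∀ {n} {f : Fin n → Fin n} → Injective _≡_ _≡_ f → ∀ j → ∃ λ i → f i ≡ j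
injective⇒surjective {suc n} {f} f-injective j with Fin.any? (λ i → f i Fin.≟ j)
... | yes hit = hit
... | no miss = contradiction
  (Fin.injective⇒≤ {f = λ i → punchOut {i = j} (λ j≡fi → miss (i , sym j≡fi))}
    (λ e → f-injective (Fin.punchOut-injective {i = j} _ _ e)))
  ℕ.1+n≰n

module Digits (p : ℕ) .{{p≢0 : NonZero p}} where
  fromDigits : ℕ → (ℕ → ℕ) → ℕ
  fromDigits zero    f = 0
  fromDigits (suc n) f = fromDigits n f ℕ.+ f n ℕ.* p ^ n

  fromDigits-< : ∀ n {f} → (∀ {j} → j ℕ.< n → f j ℕ.< p) → fromDigits n f ℕ.< p ^ n
  fromDigits-< zero    f<p = ℕ.s≤s ℕ.z≤n
  fromDigits-< (suc n) {f} f<p = ℕ.<-≤-trans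
    (ℕ.+-monoˡ-< (f n ℕ.* p ^ n) (fromDigits-< n (f<p ∘ ℕ.m<n⇒m<1+n)))
    (ℕ.*-monoˡ-≤ (p ^ n) (f<p (ℕ.n<1+n n)))

  digit-fromDigits : ∀ n {f} → (∀ {j} → j ℕ.< n → f j ℕ.< p) →
                     ∀ {j} → j ℕ.< n → digit p (fromDigits n f) j ≡ f j
  digit-fromDigits (suc n) {f} f<p {j} j<1+n with j ℕ.≟ n
  ... | yes refl = digit-+-top (fromDigits n f) (f n) n
                     (fromDigits-< n (f<p ∘ ℕ.m<n⇒m<1+n)) (f<p j<1+n)
  ... | no j≢n = trans (digit-+-below (fromDigits n f) (f n) j<n)
                   (digit-fromDigits n (f<p ∘ ℕ.m<n⇒m<1+n) j<n)
    where
    j<n : j ℕ.< n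
    j<n = ℕ.≤∧≢⇒< (ℕ.s≤s⁻¹ j<1+n) j≢n

  fromDigits-cong : ∀ n {f g} → (∀ {j} → j ℕ.< n → f j ≡ g j) → fromDigits n f ≡ fromDigits n g
  fromDigits-cong zero    f≡g = refl
  fromDigits-cong (suc n) f≡g = cong₂ ℕ._+_ (fromDigits-cong n (f≡g ∘ ℕ.m<n⇒m<1+n))
    (cong (ℕ._* p ^ n) (f≡g (ℕ.n<1+n n)))

  fromDigits-mono : ∀ n {f g} → (∀ {j} → j ℕ.< n → f j ℕ.≤ g j) → fromDigits n f ℕ.≤ fromDigits n g
  fromDigits-mono zero    f≤g = ℕ.z≤n
  fromDigits-mono (suc n) f≤g = ℕ.+-mono-≤ (fromDigits-mono n (f≤g ∘ ℕ.m<n⇒m<1+n))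
    (ℕ.*-monoˡ-≤ (p ^ n) (f≤g (ℕ.n<1+n n)))

  fromDigits-+ : ∀ n f g → fromDigits n (λ j → f j ℕ.+ g j) ≡ fromDigits n f ℕ.+ fromDigits n g
  fromDigits-+ zero    f g = refl
  fromDigits-+ (suc n) f g = trans
    (cong₂ ℕ._+_ (fromDigits-+ n f g) (ℕ.*-distribʳ-+ (p ^ n) (f n) (g n)))
    (+-interchange (fromDigits n f) (fromDigits n g) (f n ℕ.* p ^ n) (g n ℕ.* p ^ n))
    where
    open import Algebra.Properties.CommutativeSemigroup ℕ.+-commutativeSemigroup using () renaming (interchange to +-interchange)

  fromDigits-digit : ∀ n {s} → s ℕ.< p ^ n → fromDigits n (digit p s) ≡ s
  fromDigits-digit zero    {zero} s< = refl
  fromDigits-digit zero    {suc s} (ℕ.s≤s ())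
  fromDigits-digit (suc n) {s} s< = trans
    (cong₂ ℕ._+_
        (trans (fromDigits-cong n λ {j} j<n → trans (cong (λ z → digit p z j) s≡)
            (digit-+-below s′ δ j<n))
                   (fromDigits-digit n s′<))
      (cong (ℕ._* p ^ n) (trans (cong (λ z → digit p z n) s≡) (digit-+-top s′ δ n s′< δ<))))
    (sym s≡)
    where
    instance _ = ℕ.m^n≢0 p n
    s′ δ : ℕ
    s′ = s ℕ.% p ^ n
    δ = s ℕ./ p ^ n
    s≡ : s ≡ s′ ℕ.+ δ ℕ.* p ^ n
    s≡ = ℕ.m≡m%n+[m/n]*n s (p ^ n)
    s′< : s′ ℕ.< p ^ n
    s′< = ℕ.m%n<n s (p ^ n)
    δ< : δ ℕ.< p
    δ< = ℕ.m<n*o⇒m/o<n s<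

  suc-fromDigits-max : ∀ n → suc (fromDigits n (λ _ → p ∸ 1)) ≡ p ^ n
  suc-fromDigits-max zero    = refl
  suc-fromDigits-max (suc n) = trans (cong (ℕ._+ (p ∸ 1) ℕ.* p ^ n) (suc-fromDigits-max n))
    (cong (ℕ._* p ^ n) (ℕ.suc-pred p))

  digit<p : ∀ s j → digit p s j ℕ.< p
  digit<p s j = ℕ.m%n<n _ p

  -- Applied to 𝔞 b = p^n - 1: the largest possible digits mean that no Ψ^(s) is killed on λ_b.
  digit-pred : ∀ n {m} → suc m ≡ p ^ n → ∀ {j} → j ℕ.< n → digit p m j ≡ p ∸ 1
  digit-pred n {m} e {j} j<n = trans
    (cong (λ z → digit p z j) (ℕ.suc-injective (trans e (sym (suc-fromDigits-max n)))))
    (digit-fromDigits n (λ _ → ℕ.≤-reflexive (ℕ.suc-pred p)) j<n)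

  module _ {n r s} (r< : r ℕ.< p ^ n) (s< : s ℕ.< p ^ n)
    (no-carry : ∀ {j} → j ℕ.< n → digit p r j ℕ.+ digit p s j ℕ.< p) where

    private
      r+s≡ : fromDigits n (λ j → digit p r j ℕ.+ digit p s j) ≡ r ℕ.+ s
      r+s≡ = trans (fromDigits-+ n _ _)
          (cong₂ ℕ._+_ (fromDigits-digit n r<) (fromDigits-digit n s<))

    +-no-carry-< : r ℕ.+ s ℕ.< p ^ n
    +-no-carry-< = subst (ℕ._< p ^ n) r+s≡ (fromDigits-< n no-carry)

    digit-+-no-carry : ∀ {j} → j ℕ.< n → digit p (r ℕ.+ s) j ≡ digit p r j ℕ.+ digit p s j
    digit-+-no-carry {j} j<n = trans (cong (λ z → digit p z j) (sym r+s≡))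
        (digit-fromDigits n no-carry j<n)

  module _ {n s u} (s< : s ℕ.< p ^ n) (u< : u ℕ.< p ^ n)
    (s⪯u : ∀ {j} → j ℕ.< n → digit p s j ℕ.≤ digit p u j) where

    private
      difference-< : ∀ {j} → j ℕ.< n → digit p u j ∸ digit p s j ℕ.< p
      difference-< {j} _ = ℕ.≤-<-trans (ℕ.m∸n≤m _ (digit p s j)) (digit<p u j)

      u∸s≡ : fromDigits n (λ j → digit p u j ∸ digit p s j) ≡ u ∸ s
      u∸s≡ = sym (trans (cong (_∸ s) u≡) (ℕ.m+n∸n≡m _ s))
        where
        u≡ : u ≡ fromDigits n (λ j → digit p u j ∸ digit p s j) ℕ.+ s
        u≡ = trans (sym (fromDigits-digit n u<)) (trans
          (fromDigits-cong n λ j<n → sym (ℕ.m∸n+n≡m (s⪯u j<n)))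
          (trans (fromDigits-+ n _ _) (cong (fromDigits n _ ℕ.+_) (fromDigits-digit n s<))))

    digit-∸ : ∀ {j} → j ℕ.< n → digit p (u ∸ s) j ≡ digit p u j ∸ digit p s j
    digit-∸ {j} j<n = trans (cong (λ z → digit p z j) (sym u∸s≡))
        (digit-fromDigits n difference-< j<n)

single : ℕ → ℕ → ℕ
single i j with i ℕ.≟ j
... | yes _ = 1
... | no  _ = 0

single-≡ : ∀ i → single i i ≡ 1
single-≡ i with i ℕ.≟ i
... | yes _   = refl
... | no  i≢i = contradiction refl i≢i

single-≢ : ∀ {i j} → ¬ i ≡ j → single i j ≡ 0
single-≢ {i} {j} i≢j with i ℕ.≟ j
... | yes i≡j = contradiction i≡j i≢j
... | no  _   = refl

exponent-injective : ∀ {n} {i j : Fin n} → exponent i ≡ exponent j → i ≡ j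
exponent-injective {i = i} {j} e = trans (sym (Fin.opposite-involutive i))
  (trans (cong opposite (Fin.toℕ-injective e)) (Fin.opposite-involutive j))

-- The weighted digit sum and its inverse `𝔞` modulo p^n.

module ShiftProperties {p n : ℕ} (p-prime : Prime p) (β : ShiftParameters p n) where
  open ShiftParameters β
  open Shifts p-prime β
  private instance
    p≢0 : NonZero p
    p≢0 = prime⇒nonZero p-prime
  open Digits p
  open Congruence (p ^ n)
  open CommutativeMonoidSums ℤ.+-0-commutativeMonoid using (sum; ∑-distrib-+; sum-ε; sum-single)

  -- Extends `𝔟` from numbers to arbitrary exponent functions. It is additive with no condition on
  -- carries, as products of monomials require.
  𝔹 : (ℕ → ℕ) → ℤ
  𝔹 f = sum (λ i → + (f (exponent i) ℕ.* p ^ exponent i) ℤ.* shift i)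

  𝔹-cong : ∀ {f g} → (∀ {j} → j ℕ.< n → f j ≡ g j) → 𝔹 f ≡ 𝔹 g
  𝔹-cong f≡g = sum-cong {p} λ i →
    cong (λ d → + (d ℕ.* p ^ exponent i) ℤ.* shift i) (f≡g (exponent<n {p} i))

  𝔹-+ : ∀ f g → 𝔹 (λ j → f j ℕ.+ g j) ≡ 𝔹 f ℤ.+ 𝔹 g
  𝔹-+ f g = trans
    (sum-cong {p} λ i → distrib (f (exponent i)) (g (exponent i)) (p ^ exponent i) (shift i))
    (∑-distrib-+ (λ i → + (f (exponent i) ℕ.* p ^ exponent i) ℤ.* shift i)
                 (λ i → + (g (exponent i) ℕ.* p ^ exponent i) ℤ.* shift i))
    where
    distrib : ∀ x y P b → + ((x ℕ.+ y) ℕ.* P) ℤ.* b ≡ + (x ℕ.* P) ℤ.* b ℤ.+ + (y ℕ.* P) ℤ.* b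
    distrib x y P b = trans
      (cong (ℤ._* b) (trans (cong +_ (ℕ.*-distribʳ-+ P x y)) (ℤ.pos-+ (x ℕ.* P) (y ℕ.* P))))
      (ℤ.*-distribʳ-+ b (+ (x ℕ.* P)) (+ (y ℕ.* P)))

  𝔹-0 : 𝔹 (λ _ → 0) ≡ 0ℤ
  𝔹-0 = sum-ε λ i → ℤ.*-zeroˡ (shift i)

  𝔹-single : ∀ i → 𝔹 (single (exponent i)) ≡ + (p ^ exponent i) ℤ.* shift i
  𝔹-single i = trans
    (sum-single i λ j j≢i → trans
      (cong (λ d → + (d ℕ.* p ^ exponent j) ℤ.* shift j)
        (single-≢ λ e → j≢i (exponent-injective (sym e))))
      (ℤ.*-zeroˡ (shift j)))
    (cong (ℤ._* shift i) (cong +_ (trans (cong (ℕ._* p ^ exponent i) (single-≡ (exponent i)))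
      (ℕ.*-identityˡ (p ^ exponent i)))))

  𝔟-+ : ∀ {r s u} → (∀ {j} → j ℕ.< n → u ⟨ j ⟩ ≡ r ⟨ j ⟩ ℕ.+ s ⟨ j ⟩) → 𝔟 u ≡ 𝔟 r ℤ.+ 𝔟 s
  𝔟-+ {r} {s} u≡ = trans (𝔹-cong u≡) (𝔹-+ (r ⟨_⟩) (s ⟨_⟩))

  𝔟-0 : 𝔟 0 ≡ 0ℤ
  𝔟-0 = trans (𝔹-cong λ {j} _ → digit-0 j) 𝔹-0
    where
    digit-0 : ∀ j → 0 ⟨ j ⟩ ≡ 0
    digit-0 j = trans (cong (ℕ._% p) (ℕ.0/n≡0 (p ^ j) ⦃ ℕ.m^n≢0 p j ⦄))
      (ℕ.m<n⇒m%n≡m (ℕ.>-nonZero⁻¹ p))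

  𝔟-𝔞 : ∀ t → 𝔟 (𝔞 t) ≡ ℤ.- t [mod p ^ n ]
  𝔟-𝔞 t = proj₂ (𝔞-exists t)

  𝔞-< : ∀ t → 𝔞 t ℕ.< p ^ n
  𝔞-< t = Fin.toℕ<n (proj₁ (𝔞-exists t))

  private
    residue : Fin (p ^ n) → Fin (p ^ n)
    residue i = proj₁ (𝔞-exists (ℤ.- (+ toℕ i)))

    𝔟-residue : ∀ i → 𝔟 (toℕ (residue i)) ≡ + toℕ i [mod p ^ n ]
    𝔟-residue i = subst (𝔟 (toℕ (residue i)) ≡_[mod p ^ n ]) (ℤ.neg-involutive (+ toℕ i))
      (𝔟-𝔞 (ℤ.- (+ toℕ i)))

    residue-reflects : ∀ i j → 𝔟 (toℕ (residue i)) ≡ 𝔟 (toℕ (residue j)) [mod p ^ n ] → i ≡ j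
    residue-reflects i j e = toℕ-mod-injective i j
      (mod-trans (+ toℕ i) (𝔟 (toℕ (residue i))) (+ toℕ j)
        (mod-sym (𝔟 (toℕ (residue i))) (+ toℕ i) (𝔟-residue i))
        (mod-trans (𝔟 (toℕ (residue i))) (𝔟 (toℕ (residue j))) (+ toℕ j) e (𝔟-residue j)))

    residue-injective : Injective _≡_ _≡_ residue
    residue-injective {i} {j} e = residue-reflects i j (mod-reflexive _ _ (cong (𝔟 ∘ toℕ) e))

  -- `residue` is a section of `𝔟` modulo p^n, hence injective, hence by counting a bijection; its
  -- one-sided inverse `𝔟` is therefore injective as well.
  𝔟-mod-injective : ∀ (s u : Fin (p ^ n)) → 𝔟 (toℕ s) ≡ 𝔟 (toℕ u) [mod p ^ n ] → s ≡ u
  𝔟-mod-injective s u e =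
    let i , i↦s = injective⇒surjective residue-injective s
        j , j↦u = injective⇒surjective residue-injective u
    in trans (sym i↦s) (trans (cong residue (residue-reflects i j
         (subst₂ (λ s u → 𝔟 (toℕ s) ≡ 𝔟 (toℕ u) [mod p ^ n ]) (sym i↦s) (sym j↦u) e))) j↦u)

  𝔞-unique : ∀ {u t} → u ℕ.< p ^ n → 𝔟 u ≡ ℤ.- t [mod p ^ n ] → 𝔞 t ≡ u
  𝔞-unique {u} {t} u< e = trans (cong toℕ (𝔟-mod-injective _ (fromℕ< u<)
    (mod-trans (𝔟 (𝔞 t)) (ℤ.- t) (𝔟 (toℕ (fromℕ< u<))) (𝔟-𝔞 t)
      (mod-sym (𝔟 (toℕ (fromℕ< u<))) (ℤ.- t)
        (subst (λ m → 𝔟 m ≡ ℤ.- t [mod p ^ n ]) (sym (Fin.toℕ-fromℕ< u<)) e)))))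
    (Fin.toℕ-fromℕ< u<)

  -- The condition for a monomial with exponents `f` to survive on λ_t: each application of a Ψ uses
  -- up one unit of the corresponding digit of 𝔞 t.
  _≼_ : (ℕ → ℕ) → ℤ → Set
  f ≼ t = ∀ {j} → j ℕ.< n → f j ℕ.≤ 𝔞 t ⟨ j ⟩

  _≼?_ : ∀ f t → Dec (f ≼ t)
  f ≼? t = ℕ.allUpTo? (λ j → f j ℕ.≤? 𝔞 t ⟨ j ⟩) n

  -- The digitwise differences form a number u with 𝔟 u = 𝔟 (𝔞 t) - 𝔹 f, which is congruent to - (t
  -- + 𝔹 f); uniqueness identifies u with 𝔞 (t + 𝔹 f).
  digit-𝔞-shift : ∀ {f t} → f ≼ t → ∀ {j} → j ℕ.< n → 𝔞 (t ℤ.+ 𝔹 f) ⟨ j ⟩ ≡ 𝔞 t ⟨ j ⟩ ∸ f j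
  digit-𝔞-shift {f} {t} f≼t {j} j<n = trans
    (cong (_⟨ j ⟩) (𝔞-unique (fromDigits-< n difference-<) 𝔟-u))
    (digit-fromDigits n difference-< j<n)
    where
    difference : ℕ → ℕ
    difference j = 𝔞 t ⟨ j ⟩ ∸ f j
    difference-< : ∀ {j} → j ℕ.< n → difference j ℕ.< p
    difference-< {j} _ = ℕ.≤-<-trans (ℕ.m∸n≤m _ (f j)) (digit<p (𝔞 t) j)
    u : ℕ
    u = fromDigits n difference
    𝔟-𝔞-split : 𝔟 (𝔞 t) ≡ 𝔟 u ℤ.+ 𝔹 f
    𝔟-𝔞-split = trans (𝔹-cong λ {j} j<n → trans (sym (ℕ.m∸n+n≡m (f≼t j<n)))
        (cong (ℕ._+ f j) (sym (digit-fromDigits n difference-< j<n))))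
      (𝔹-+ (u ⟨_⟩) f)
    rearrange : ∀ u f t → u ℤ.+ f ℤ.- ℤ.- t ≡ u ℤ.- ℤ.- (t ℤ.+ f)
    rearrange = solve-∀
    𝔟-u : 𝔟 u ≡ ℤ.- (t ℤ.+ 𝔹 f) [mod p ^ n ]
    𝔟-u = subst (+ (p ^ n) ∣_)
        (trans (cong (λ z → z ℤ.- ℤ.- t) 𝔟-𝔞-split) (rearrange (𝔟 u) (𝔹 f) t)) (𝔟-𝔞 t)

-- A linear inequality is reduced to an identity between the differences of its sides.
≤-from : ∀ {a b i j} → a ℤ.≤ b → b ℤ.- a ≡ j ℤ.- i → i ℤ.≤ j
≤-from a≤b e = ℤ.0≤i-j⇒j≤i (subst (0ℤ ℤ.≤_) e (ℤ.i≤j⇒0≤j-i a≤b))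

<-from : ∀ {a b i j} → a ℤ.≤ b → b ℤ.- a ≡ j ℤ.- (1ℤ ℤ.+ i) → i ℤ.< j
<-from a≤b e = ℤ.suc[i]≤j⇒i<j (≤-from a≤b e)

-- The extension L/K, K-linearity of the action, and families separated modulo q.

module Ramified {k ℓk l ℓl a ℓa : Level} (S : Setting k ℓk l ℓl a ℓa) where
  open Setting S
  module vKP = ValuationProperties vK
  module vLP = ValuationProperties vL
  open Congruence (p ^ n)

  instance
    q-nonZero : NonZero (p ^ n)
    q-nonZero = ℕ.m^n≢0 p n ⦃ prime⇒nonZero p-prime ⦄

    q-positive : ℤ.Positive (+ (p ^ n))
    q-positive = ℤ.positive (ℤ.+<+ (ℕ.>-nonZero⁻¹ (p ^ n)))

  q : ℤ
  q = + (p ^ n)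

  ι : K.Carrier → L.Carrier
  ι = L/K.structureMap

  module LM = LinearCombinations L/K.asLeftModule
  module AM = LinearCombinations A/K.asLeftModule
  module ΣL = CommutativeMonoidSums L.+-commutativeMonoid
  module ΣA = CommutativeMonoidSums A.+-commutativeMonoid
  module ΣK = CommutativeMonoidSums K.+-commutativeMonoid
  open LeftModule L-module
    using (*ₗ-congˡ; *ₗ-congʳ; *ₗ-zeroˡ; *ₗ-zeroʳ; *ₗ-distribʳ; *ₗ-distribˡ; *ₗ-assoc)

  v-ι : ∀ {c i} → vK.v c ≡ [ i ] → vL.v (ι c) ≡ [ q ℤ.* i ]
  v-ι {c} v-c = trans (IsTotallyRamified.ramificationIndex totallyRamified c)
      (cong (map∞ (q ℤ.*_)) v-c)

  v-ι-* : ∀ {c i x j} → vK.v c ≡ [ i ] → vL.v x ≡ [ j ] → vL.v (ι c L.* x) ≡ [ q ℤ.* i ℤ.+ j ]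
  v-ι-* v-c v-x = vLP.v-*-finite (v-ι v-c) v-x

  ι-𝔓 : ∀ {c i} → c ∈ vK.𝔓 [ i ] → ι c ∈ vL.𝔓 [ q ℤ.* i ]
  ι-𝔓 {c} {i} c∈ with vK.v c in v-c
  ... | ⊤⁺    = subst ([ q ℤ.* i ] ≤∞_) (sym (trans
    (IsTotallyRamified.ramificationIndex totallyRamified c) (cong (map∞ (q ℤ.*_)) v-c))) (_ Sup.≤⊤⁺)
  ... | [ j ] = vLP.v⇒∈𝔓 (v-ι v-c) (ℤ.*-monoˡ-≤-nonNeg q (Sup.[≤]-injective c∈))

  ι-*-𝔓 : ∀ {c i x m} → c ∈ vK.𝔓 [ i ] → x ∈ vL.𝔓 [ m ] → ι c L.* x ∈ vL.𝔓 [ q ℤ.* i ℤ.+ m ]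
  ι-*-𝔓 c∈ x∈ = vL.𝔓-* (ι-𝔓 c∈) x∈

  quotient-𝔓 : ∀ {u x i m} → vL.v x ≡ [ i ] → u L.* x ∈ vL.𝔓 [ m ] → u ∈ vL.𝔓 [ m ℤ.- i ]
  quotient-𝔓 {u} {x} {i} {m} v-x ux∈ with vL.v u in v-u
  ... | ⊤⁺    = _ Sup.≤⊤⁺
  ... | [ j ] = Sup.[ ≤-from (vLP.∈𝔓⇒v (vLP.v-*-finite v-u v-x) ux∈) (lem j i m) ]
    where
    lem : ∀ j i m → j ℤ.+ i ℤ.- m ≡ j ℤ.- (m ℤ.- i)
    lem = solve-∀

  -- The size of `u` is read off from u * x and reused for u * y. With `y` the image of a basis
  -- vector `x`, this carries a bound on a term of an expansion to its image.
  replace-𝔓 : ∀ {u x y i j m} → vL.v x ≡ [ i ] → u L.* x ∈ vL.𝔓 [ m ] →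
              y ∈ vL.𝔓 [ i ℤ.+ j ] → u L.* y ∈ vL.𝔓 [ m ℤ.+ j ]
  replace-𝔓 {i = i} {j} {m} v-x ux∈ y∈ =
    vLP.𝔓-weaken (ℤ.≤-reflexive (lem m i j)) (vL.𝔓-* (quotient-𝔓 v-x ux∈) y∈)
    where
    lem : ∀ m i j → m ℤ.+ j ≡ m ℤ.- i ℤ.+ (i ℤ.+ j)
    lem = solve-∀

  -- Values of `ι c` are multiples of q, so a bound on v(c) that is reached only up to less than q
  -- rounds up to the full bound.
  coefficient-𝔓 : ∀ {c x i j m} → vL.v x ≡ [ i ] → ι c L.* x ∈ vL.𝔓 [ m ] →
                  i ℤ.+ q ℤ.* j ℤ.< m ℤ.+ q → c ∈ vK.𝔓 [ j ]
  coefficient-𝔓 {c} {x} {i} {j} {m} v-x cx∈ bound with vK.v c in v-c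
  ... | ⊤⁺    = _ Sup.≤⊤⁺
  ... | [ z ] = Sup.[ ≤-from (ℤ.i<j⇒suc[i]≤j (ℤ.*-cancelˡ-<-nonNeg {j} {ℤ.suc z} q
                    (<-from (ℤ.+-mono-≤ (ℤ.i<j⇒suc[i]≤j bound) (vLP.∈𝔓⇒v (v-ι-* v-c v-x) cx∈))
                      (lem₁ i j m z q)))) (lem₂ j z) ]
    where
    lem₁ : ∀ i j m z q → (m ℤ.+ q ℤ.+ (q ℤ.* z ℤ.+ i)) ℤ.- (1ℤ ℤ.+ (i ℤ.+ q ℤ.* j) ℤ.+ m) ≡
                         q ℤ.* (1ℤ ℤ.+ z) ℤ.- (1ℤ ℤ.+ q ℤ.* j)
    lem₁ = solve-∀
    lem₂ : ∀ j z → (1ℤ ℤ.+ z) ℤ.- (1ℤ ℤ.+ j) ≡ z ℤ.- j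
    lem₂ = solve-∀

  lcL : ∀ {N} → (Fin N → K.Carrier) → (Fin N → L.Carrier) → L.Carrier
  lcL = linearCombination L/K.asLeftModule

  lcA : ∀ {N} → (Fin N → K.Carrier) → (Fin N → A.Carrier) → A.Carrier
  lcA = linearCombination A/K.asLeftModule

  ·-ι : ∀ α c x → α · (ι c L.* x) L.≈ ι c L.* (α · x)
  ·-ι α c x = begin
    α · (ι c L.* x)                        ≈⟨ *ₗ-congˡ (·-K-linear c x) ⟨
    α · (A/K.structureMap c · x)           ≈⟨ *ₗ-assoc α _ x ⟨
    (α A.* A/K.structureMap c) · x         ≈⟨ *ₗ-congʳ (A/K.central c α) ⟨
    (A/K.structureMap c A.* α) · x         ≈⟨ *ₗ-assoc _ α x ⟩
    A/K.structureMap c · (α · x)           ≈⟨ ·-K-linear c (α · x) ⟩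
    ι c L.* (α · x)                        ∎
    where open SetoidReasoning L.setoid

  scale-· : ∀ c α x → (A/K.structureMap c A.* α) · x L.≈ ι c L.* (α · x)
  scale-· c α x = L.≈-trans (*ₗ-assoc _ α x) (·-K-linear c (α · x))

  ·-neg : ∀ α x → α · (L.- x) L.≈ L.- (α · x)
  ·-neg α x = inverseˡ-unique _ _ (L.≈-trans (L.≈-sym (*ₗ-distribˡ α (L.- x) x))
    (L.≈-trans (*ₗ-congˡ (L.-‿inverseˡ x)) (*ₗ-zeroʳ α)))
    where open AbelianGroupProperties L.+-abelianGroup using (inverseˡ-unique)

  ·-- : ∀ α x y → α · (x L.- y) L.≈ α · x L.- α · y
  ·-- α x y = L.≈-trans (*ₗ-distribˡ α x (L.- y)) (L.+-congˡ (·-neg α y))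

  ·-lcL : ∀ {N} α (c : Fin N → K.Carrier) x → α · lcL c x L.≈ lcL c (λ i → α · x i)
  ·-lcL {zero}  α c x = *ₗ-zeroʳ α
  ·-lcL {suc N} α c x = L.≈-trans (*ₗ-distribˡ α _ _)
    (L.+-cong (·-ι α (c zero) (x zero)) (·-lcL α (c ∘ suc) (x ∘ suc)))

  lcA-· : ∀ {N} (c : Fin N → K.Carrier) α x → lcA c α · x L.≈ lcL c (λ i → α i · x)
  lcA-· {zero}  c α x = *ₗ-zeroˡ x
  lcA-· {suc N} c α x = L.≈-trans (*ₗ-distribʳ x _ _)
    (L.+-cong (scale-· (c zero) (α zero) x) (lcA-· (c ∘ suc) (α ∘ suc) x))

  record Separated {N} (x : Fin N → L.Carrier) : Set where
    field
      valuation : Fin N → ℤ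
      v-x       : ∀ i → vL.v (x i) ≡ [ valuation i ]
      separated : ∀ {i j} → valuation i ≡ valuation j [mod p ^ n ] → i ≡ j

    term-residue : ∀ c i {m} → vL.v (ι (c i) L.* x i) ≡ [ m ] → m ≡ valuation i [mod p ^ n ]
    term-residue c i {m} v-term with vK.v (c i) in v-c
    ... | ⊤⁺ = contradiction (L.≈-trans (L.*-congʳ (L.≈-trans
                 (L/K.⟦⟧-cong (Equivalence.to (vK.v-∞ (c i)) v-c)) L/K.0#-homo)) (L.zeroˡ (x i)))
               (vLP.v-finite v-term)
    ... | [ z ] = divides z
        (trans (cong (ℤ._- valuation i) (just-injective (trans (sym v-term) (v-ι-* v-c (v-x i)))))
                    (lem q z (valuation i)))
      where
      lem : ∀ q z m → q ℤ.* z ℤ.+ m ℤ.- m ≡ z ℤ.* q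
      lem = solve-∀

    terms-distinct : ∀ c → vLP.Distinct (λ i → ι (c i) L.* x i)
    terms-distinct c {i} {j} (m , v-i , v-j) = separated
      (mod-trans (valuation i) m (valuation j) (mod-sym m (valuation i) (term-residue c i v-i))
          (term-residue c j v-j))

    terms-𝔓 : ∀ c {m} → lcL c x ∈ vL.𝔓 [ m ] → ∀ i → ι (c i) L.* x i ∈ vL.𝔓 [ m ]
    terms-𝔓 c = vLP.sum-distinct (λ i → ι (c i) L.* x i) (terms-distinct c)

    independent : LM.Independent x
    independent c lc≈0 i with vK.v (c i) in v-c
    ... | ⊤⁺    = Equivalence.to (vK.v-∞ (c i)) v-c
    ... | [ z ] = contradiction (vLP.∈all𝔓⇒≈0 λ m → terms-𝔓 c (vLP.≈0⇒∈𝔓 lc≈0) i)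
                    (vLP.v-finite (v-ι-* v-c (v-x i)))

  reindex-separated : ∀ {N N′} {x : Fin N → L.Carrier} → Separated x → {τ : Fin N′ → Fin N} →
                      Injective _≡_ _≡_ τ → Separated (x ∘ τ)
  reindex-separated sep {τ} τ-injective = record
    { valuation = valuation ∘ τ ; v-x = v-x ∘ τ ; separated = τ-injective ∘ separated }
    where open Separated sep

  separated-spans : {x : Fin (p ^ n) → L.Carrier} → Separated x → LM.Spans x
  separated-spans sep = LinearDependence.independent⇒spans K vKP.≈0? L/K.asLeftModule
    (IsTotallyRamified.hasDegree totallyRamified) (Separated.independent sep)

-- The action of monomials in the Ψ on the λ, with relative error N.

module ScaffoldAction {k ℓk l ℓl a ℓa : Level} (S : Setting k ℓk l ℓl a ℓa)
  (β : ShiftParameters (Setting.p S) (Setting.n S)) (𝔗 : ℤ∞) (scaffold : Scaffold S β 𝔗)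
  (N : ℤ) (1≤N : 1ℤ ℤ.≤ N) (N≤𝔗 : [ N ] ≤∞ 𝔗) where
  open Setting S
  open Ramified S
  open Congruence (p ^ n)
  open ShiftParameters β
  open Shifts p-prime β
  open ShiftProperties p-prime β
  open Scaffold scaffold
  open LeftModule L-module using (*ₗ-congˡ; *ₗ-identityˡ; *ₗ-assoc)

  -- α acts like a monomial in the Ψ's whose exponent at weight p^j b is f j.
  record Monomial (α : A.Carrier) (f : ℕ → ℕ) : Set (k Level.⊔ ℓk Level.⊔ l Level.⊔ ℓl) where
    field
      raises : ∀ {m x} → x ∈ vL.𝔓 [ m ] → α · x ∈ vL.𝔓 [ m ℤ.+ 𝔹 f ]
      hits   : ∀ t → f ≼ t → ∃ λ c → vK.v c ≡ [ 0ℤ ] ×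
               (α · λ- t L.- ι c L.* λ- (t ℤ.+ 𝔹 f)) ∈ vL.𝔓 [ t ℤ.+ 𝔹 f ℤ.+ N ]
      kills  : ∀ t → ¬ f ≼ t → α · λ- t ∈ vL.𝔓 [ t ℤ.+ 𝔹 f ℤ.+ N ]

  open Monomial

  λ-𝔓 : ∀ t → λ- t ∈ vL.𝔓 [ t ]
  λ-𝔓 t = vLP.v⇒∈𝔓 (v-λ t) ℤ.≤-refl

  λ-separated : Separated (λ (i : Fin (p ^ n)) → λ- (+ toℕ i))
  λ-separated = record
    { valuation = λ i → + toℕ i ; v-x = λ i → v-λ (+ toℕ i) ; separated = toℕ-mod-injective _ _ }

  -- The elements λ_0, ..., λ_(q-1) form a K-basis with separated valuations, so each term in the
  -- expansion of x lies in the same ideal as x and can be treated alone.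
  raises-λ⇒raises : ∀ {α m} → (∀ t → α · λ- t ∈ vL.𝔓 [ t ℤ.+ m ]) →
                    ∀ {i x} → x ∈ vL.𝔓 [ i ] → α · x ∈ vL.𝔓 [ i ℤ.+ m ]
  raises-λ⇒raises {α} raises-λ {i} {x} x∈ with separated-spans λ-separated x
  ... | c , x≈ = vL.𝔓-resp (L.≈-sym (L.≈-trans (*ₗ-congˡ x≈) (·-lcL α c _)))
    (vLP.𝔓-sum λ j → replace-𝔓 (v-λ (+ toℕ j))
      (Separated.terms-𝔓 λ-separated c (vL.𝔓-resp x≈ x∈) j) (raises-λ (+ toℕ j)))

  Congruent⇒𝔓 : ∀ {t x y} → Congruent S (λ- t) 𝔗 x y → x L.- y ∈ vL.𝔓 [ t ℤ.+ N ]
  Congruent⇒𝔓 {t} (e , e∈ , x-y≈) = vL.𝔓-resp (L.≈-sym x-y≈) (vL.𝔓-* (λ-𝔓 t) (≤∞-trans N≤𝔗 e∈))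

  t≤t+N : ∀ t → t ℤ.≤ t ℤ.+ N
  t≤t+N t = ≤-from (ℤ.≤-trans (ℤ.+≤+ {0} {1} ℕ.z≤n) 1≤N) (lem t N)
    where
    lem : ∀ t N → N ℤ.- 0ℤ ≡ t ℤ.+ N ℤ.- t
    lem = solve-∀

  x-0≈x : ∀ x → x L.- L.0# L.≈ x
  x-0≈x x = L.≈-trans (L.+-congˡ ε⁻¹≈ε) (L.+-identityʳ x)
    where open AbelianGroupProperties L.+-abelianGroup using (ε⁻¹≈ε)

  unit-*-𝔓 : ∀ {c x m} → vK.v c ≡ [ 0ℤ ] → x ∈ vL.𝔓 [ m ] → ι c L.* x ∈ vL.𝔓 [ m ]
  unit-*-𝔓 v-c = vLP.𝔒-*-𝔓 (vLP.v⇒∈𝔓 (v-ι v-c) (ℤ.≤-reflexive (sym (ℤ.*-zeroʳ q))))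

  single-≼ : ∀ (i : Fin n) t → 1 ℕ.≤ 𝔞 t ⟨ exponent i ⟩ → single (exponent i) ≼ t
  single-≼ i t 1≤ {j} j<n with exponent i ℕ.≟ j
  ... | yes refl = 1≤
  ... | no _     = ℕ.z≤n

  Ψ-monomial : ∀ i → Monomial (Ψ i) (single (exponent i))
  Ψ-monomial i = record
    { raises = raises-λ⇒raises λ t → raise t (decide t)
    ; hits   = λ t f≼t → hit t (proj₁ (proj₂ (proj₂ (Ψ-λ i t)))
        (subst (ℕ._≤ 𝔞 t ⟨ exponent i ⟩) (single-≡ (exponent i)) (f≼t (exponent<n′ i))))
    ; kills  = λ t f⋠t → kill t
        (proj₂ (proj₂ (proj₂ (Ψ-λ i t))) (ℕ.n<1⇒n≡0 (ℕ.≰⇒> (f⋠t ∘ single-≼ i t))))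
    }
    where
    exponent<n′ : ∀ i → exponent i ℕ.< n
    exponent<n′ i = Fin.toℕ<n (opposite i)

    t′ : ℤ → ℤ
    t′ t = t ℤ.+ + (p ^ exponent i) ℤ.* shift i

    t′≡ : ∀ t → t′ t ≡ t ℤ.+ 𝔹 (single (exponent i))
    t′≡ t = cong (λ z → t ℤ.+ z) (sym (𝔹-single i))

    unit : ∀ t → vK.v (proj₁ (Ψ-λ i t)) ≡ [ 0ℤ ]
    unit t = vKP.unit⇒v≡0 (proj₁ (proj₂ (Ψ-λ i t)))

    hit : ∀ t → Congruent S (λ- (t′ t)) 𝔗 (Ψ i · λ- t) (ι (proj₁ (Ψ-λ i t)) L.* λ- (t′ t)) →
          ∃ λ c → vK.v c ≡ [ 0ℤ ] × (Ψ i · λ- t L.- ι c L.* λ- (t ℤ.+ 𝔹 (single (exponent i))))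
                                      ∈ vL.𝔓 [ t ℤ.+ 𝔹 (single (exponent i)) ℤ.+ N ]
    hit t e = proj₁ (Ψ-λ i t) , unit t ,
      subst (λ t′ → (Ψ i · λ- t L.- ι (proj₁ (Ψ-λ i t)) L.* λ- t′) ∈ vL.𝔓 [ t′ ℤ.+ N ]) (t′≡ t)
          (Congruent⇒𝔓 e)

    kill : ∀ t → Congruent S (λ- (t′ t)) 𝔗 (Ψ i · λ- t) L.0# →
           Ψ i · λ- t ∈ vL.𝔓 [ t ℤ.+ 𝔹 (single (exponent i)) ℤ.+ N ]
    kill t e = subst (λ t′ → Ψ i · λ- t ∈ vL.𝔓 [ t′ ℤ.+ N ]) (t′≡ t)
        (vL.𝔓-resp (x-0≈x _) (Congruent⇒𝔓 e))

    decide : ∀ t → Dec (1 ℕ.≤ 𝔞 t ⟨ exponent i ⟩)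
    decide t = 1 ℕ.≤? 𝔞 t ⟨ exponent i ⟩

    raise : ∀ t → Dec (1 ℕ.≤ 𝔞 t ⟨ exponent i ⟩) →
        Ψ i · λ- t ∈ vL.𝔓 [ t ℤ.+ 𝔹 (single (exponent i)) ]
    raise t (yes 1≤) = let c , v-c , close = hit t (proj₁ (proj₂ (proj₂ (Ψ-λ i t))) 1≤) in
      vLP.𝔓-transportʳ (vLP.𝔓-weaken (t≤t+N _) close)
        (unit-*-𝔓 v-c (λ-𝔓 _))
    raise t (no 1≰) = vLP.𝔓-weaken (t≤t+N _)
        (kill t (proj₂ (proj₂ (proj₂ (Ψ-λ i t))) (ℕ.n<1⇒n≡0 (ℕ.≰⇒> 1≰))))

  congruence-trans : ∀ {m x y z} → (x L.- y) ∈ vL.𝔓 m → (y L.- z) ∈ vL.𝔓 m → (x L.- z) ∈ vL.𝔓 m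
  congruence-trans {x = x} {y} {z} x≡y y≡z = vL.𝔓-resp
    (L.≈-trans (L.≈-sym (L.+-assoc (x L.- y) y (L.- z))) (L.+-congʳ (vLP.x-y+y≈x x y)))
    (vL.𝔓-+ x≡y y≡z)

  one-monomial : Monomial A.1# (λ _ → 0)
  one-monomial = record
    { raises = λ {m} x∈ → subst (λ m → _ ∈ vL.𝔓 [ m ]) (+𝔹0 m)
        (vL.𝔓-resp (L.≈-sym (*ₗ-identityˡ _)) x∈)
    ; hits   = λ t _ → K.1# , vK.v1 , subst
        (λ t′ → (A.1# · λ- t L.- ι K.1# L.* λ- t′) ∈ vL.𝔓 [ t′ ℤ.+ N ]) (+𝔹0 t)
        (vLP.≈0⇒∈𝔓 (L.≈-trans (L.+-cong (*ₗ-identityˡ _)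
          (L.-‿cong (L.≈-trans (L.*-congʳ L/K.1#-homo) (L.*-identityˡ _)))) (L.-‿inverseʳ _)))
    ; kills  = λ t 0⋠t → ⊥-elim (0⋠t λ _ → ℕ.z≤n)
    }
    where
    +𝔹0 : ∀ m → m ≡ m ℤ.+ 𝔹 (λ _ → 0)
    +𝔹0 m = trans (sym (ℤ.+-identityʳ m)) (cong (λ z → m ℤ.+ z) (sym 𝔹-0))

  -- The right factor moves t to t + 𝔹 g and leaves the digits of 𝔞 t reduced by `g`, so the left
  -- factor survives there exactly if f + g fits under 𝔞 t. A failure occurs either at the first
  -- factor or at the second, and `raises` keeps the first error at relative size N.
  monomial-* : ∀ {α α′ f g} → Monomial α f → Monomial α′ g → Monomial (α A.* α′) (λ j → f j ℕ.+ g j)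
  monomial-* {α} {α′} {f} {g} M M′ = record
    { raises = λ {m} {x} x∈ → subst (λ m → (α A.* α′) · x ∈ vL.𝔓 [ m ]) (+𝔹 m)
        (vL.𝔓-resp (L.≈-sym (*ₗ-assoc α α′ x)) (raises M (raises M′ x∈)))
    ; hits   = λ t f+g≼t → hit t f+g≼t (hits M′ t (g≼ t f+g≼t))
    ; kills  = λ t f+g⋠t → kill t f+g⋠t (g ≼? t)
    }
    where
    +𝔹 : ∀ m → m ℤ.+ 𝔹 g ℤ.+ 𝔹 f ≡ m ℤ.+ 𝔹 (λ j → f j ℕ.+ g j)
    +𝔹 m = trans (lem m (𝔹 g) (𝔹 f)) (cong (λ z → m ℤ.+ z) (sym (𝔹-+ f g)))
      where
      lem : ∀ m x y → m ℤ.+ x ℤ.+ y ≡ m ℤ.+ (y ℤ.+ x)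
      lem = solve-∀

    swapN : ∀ m → m ℤ.+ N ℤ.+ 𝔹 f ≡ m ℤ.+ 𝔹 f ℤ.+ N
    swapN m = lem m N (𝔹 f)
      where
      lem : ∀ m x y → m ℤ.+ x ℤ.+ y ≡ m ℤ.+ y ℤ.+ x
      lem = solve-∀

    raised : ∀ m {x} → x ∈ vL.𝔓 [ m ℤ.+ N ] → α · x ∈ vL.𝔓 [ m ℤ.+ 𝔹 f ℤ.+ N ]
    raised m {x} x∈ = subst (λ m → α · x ∈ vL.𝔓 [ m ]) (swapN m) (raises M x∈)

    g≼ : ∀ t → (λ j → f j ℕ.+ g j) ≼ t → g ≼ t
    g≼ t f+g≼t {j} j<n = ℕ.≤-trans (ℕ.m≤n+m (g j) (f j)) (f+g≼t j<n)

    f≼ : ∀ t → (λ j → f j ℕ.+ g j) ≼ t → f ≼ (t ℤ.+ 𝔹 g)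
    f≼ t f+g≼t {j} j<n = subst (f j ℕ.≤_) (sym (digit-𝔞-shift {g} {t} (λ {j} → g≼ t f+g≼t {j}) j<n))
      (ℕ.m+n≤o⇒m≤o∸n (f j) (f+g≼t j<n))

    f⋠ : ∀ t → g ≼ t → ¬ (λ j → f j ℕ.+ g j) ≼ t → ¬ f ≼ (t ℤ.+ 𝔹 g)
    f⋠ t g≼t f+g⋠t f≼t′ = f+g⋠t λ {j} j<n → subst (f j ℕ.+ g j ℕ.≤_) (ℕ.m∸n+n≡m (g≼t j<n))
      (ℕ.+-monoˡ-≤ (g j)
          (subst (f j ℕ.≤_) (digit-𝔞-shift {g} {t} (λ {j} → g≼t {j}) j<n) (f≼t′ j<n)))

    f+g : ℕ → ℕ
    f+g j = f j ℕ.+ g j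

    apply : ∀ {t c} → (α′ · λ- t L.- ι c L.* λ- (t ℤ.+ 𝔹 g)) ∈ vL.𝔓 [ t ℤ.+ 𝔹 g ℤ.+ N ] →
            ((α A.* α′) · λ- t L.- ι c L.* (α · λ- (t ℤ.+ 𝔹 g))) ∈ vL.𝔓 [ t ℤ.+ 𝔹 g ℤ.+ 𝔹 f ℤ.+ N ]
    apply {t} {c} close = vL.𝔓-resp eq (raised (t ℤ.+ 𝔹 g) close)
      where
      eq : α · (α′ · λ- t L.- ι c L.* λ- (t ℤ.+ 𝔹 g)) L.≈ (α A.* α′) · λ- t L.- ι c L.*
          (α · λ- (t ℤ.+ 𝔹 g))
      eq = L.≈-trans (·-- α (α′ · λ- t) (ι c L.* λ- (t ℤ.+ 𝔹 g)))
        (L.+-cong (L.≈-sym (*ₗ-assoc α α′ (λ- t))) (L.-‿cong (·-ι α c (λ- (t ℤ.+ 𝔹 g)))))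

    scale : ∀ {t c c′} → vK.v c ≡ [ 0ℤ ] →
        (α · λ- t L.- ι c′ L.* λ- (t ℤ.+ 𝔹 f)) ∈ vL.𝔓 [ t ℤ.+ 𝔹 f ℤ.+ N ] →
            (ι c L.* (α · λ- t) L.- ι (c K.* c′) L.* λ- (t ℤ.+ 𝔹 f)) ∈ vL.𝔓 [ t ℤ.+ 𝔹 f ℤ.+ N ]
    scale {t} {c} {c′} v-c close = vL.𝔓-resp eq (unit-*-𝔓 v-c close)
      where
      open RingProperties L.ring using (x[y-z]≈xy-xz)
      eq : ι c L.* (α · λ- t L.- ι c′ L.* λ- (t ℤ.+ 𝔹 f)) L.≈ ι c L.* (α · λ- t) L.- ι
          (c K.* c′) L.* λ- (t ℤ.+ 𝔹 f)
      eq = L.≈-trans (x[y-z]≈xy-xz (ι c) (α · λ- t) (ι c′ L.* λ- (t ℤ.+ 𝔹 f)))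
        (L.+-congˡ (L.-‿cong (L.≈-trans (L.≈-sym (L.*-assoc (ι c) (ι c′) (λ- (t ℤ.+ 𝔹 f))))
          (L.*-congʳ (L.≈-sym (L/K.*-homo c c′))))))

    hit : ∀ t → f+g ≼ t →
          (∃ λ c → vK.v c ≡ [ 0ℤ ] ×
              (α′ · λ- t L.- ι c L.* λ- (t ℤ.+ 𝔹 g)) ∈ vL.𝔓 [ t ℤ.+ 𝔹 g ℤ.+ N ]) →
          ∃ λ c → vK.v c ≡ [ 0ℤ ] ×
              ((α A.* α′) · λ- t L.- ι c L.* λ- (t ℤ.+ 𝔹 f+g)) ∈ vL.𝔓 [ t ℤ.+ 𝔹 f+g ℤ.+ N ]
    hit t f+g≼t (c , v-c , close) =
      let c′ , v-c′ , close′ = hits M (t ℤ.+ 𝔹 g) (f≼ t f+g≼t) in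
      c K.* c′ , vKP.v-*-finite v-c v-c′ ,
      subst (λ t′ → ((α A.* α′) · λ- t L.- ι (c K.* c′) L.* λ- t′) ∈ vL.𝔓 [ t′ ℤ.+ N ]) (+𝔹 t)
        (congruence-trans {x = (α A.* α′) · λ- t} {ι c L.* (α · λ- (t ℤ.+ 𝔹 g))}
          {ι (c K.* c′) L.* λ- (t ℤ.+ 𝔹 g ℤ.+ 𝔹 f)} (apply {t} {c} close)
              (scale {t ℤ.+ 𝔹 g} {c} {c′} v-c close′))

    kill : ∀ t → ¬ f+g ≼ t → Dec (g ≼ t) → (α A.* α′) · λ- t ∈ vL.𝔓 [ t ℤ.+ 𝔹 f+g ℤ.+ N ]
    kill t f+g⋠t (yes g≼t) = let c , v-c , close = hits M′ t g≼t in
      subst (λ t′ → (α A.* α′) · λ- t ∈ vL.𝔓 [ t′ ℤ.+ N ]) (+𝔹 t)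
      (vLP.𝔓-transportʳ {x = (α A.* α′) · λ- t} {ι c L.* (α · λ- (t ℤ.+ 𝔹 g))} (apply {t} {c} close)
        (unit-*-𝔓 v-c (kills M (t ℤ.+ 𝔹 g) (f⋠ t g≼t f+g⋠t))))
    kill t f+g⋠t (no g⋠t) = subst (λ t′ → (α A.* α′) · λ- t ∈ vL.𝔓 [ t′ ℤ.+ N ]) (+𝔹 t)
      (vL.𝔓-resp (L.≈-sym (*ₗ-assoc α α′ (λ- t))) (raised (t ℤ.+ 𝔹 g) (kills M′ t g⋠t)))

  monomial-cong : ∀ {α f g} → (∀ {j} → j ℕ.< n → f j ≡ g j) → Monomial α f → Monomial α g
  monomial-cong {α} {f} {g} f≡g M = record
    { raises = λ {m} {x} x∈ → subst (λ b → α · x ∈ vL.𝔓 [ m ℤ.+ b ]) (𝔹-cong f≡g) (raises M x∈)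
    ; hits   = λ t g≼t → subst (λ b → ∃ λ c → vK.v c ≡ [ 0ℤ ] ×
        (α · λ- t L.- ι c L.* λ- (t ℤ.+ b)) ∈ vL.𝔓 [ t ℤ.+ b ℤ.+ N ]) (𝔹-cong f≡g)
        (hits M t λ j<n → ℕ.≤-trans (ℕ.≤-reflexive (f≡g j<n)) (g≼t j<n))
    ; kills  = λ t g⋠t → subst (λ b → α · λ- t ∈ vL.𝔓 [ t ℤ.+ b ℤ.+ N ]) (𝔹-cong f≡g)
        (kills M t λ f≼t → g⋠t λ j<n → ℕ.≤-trans (ℕ.≤-reflexive (sym (f≡g j<n))) (f≼t j<n))
    }

  open RawSemiringDefs (Semiring.rawSemiring A.semiring) using (product) renaming (_^_ to _^ᴬ_)
  open CommutativeMonoidSums ℕ.+-0-commutativeMonoid using (sum; sum-single)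

  monomial-^ : ∀ {α f} → Monomial α f → ∀ m → Monomial (α ^ᴬ m) (λ j → m ℕ.* f j)
  monomial-^ M zero    = one-monomial
  monomial-^ M (suc m) = monomial-* M (monomial-^ M m)

  monomial-product : ∀ {N} {α : Fin N → A.Carrier} {f : Fin N → ℕ → ℕ} →
                     (∀ i → Monomial (α i) (f i)) → Monomial (product α) (λ j → sum (λ i → f i j))
  monomial-product {zero}  M = one-monomial
  monomial-product {suc N} M = monomial-* (M zero) (monomial-product (M ∘ suc))

  Ψ^-monomial : ∀ s → Monomial Ψ^⟨ s ⟩ (s ⟨_⟩)
  Ψ^-monomial s = monomial-cong collect
    (monomial-product {f = λ i j → s ⟨ toℕ i ⟩ ℕ.* single (toℕ i) j} λ i → monomial-^
      -- Reversing twice shows that the factor at place i of the product has weight p^i.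
      (subst (λ e → Monomial (Ψ (opposite i)) (single e)) (cong toℕ (Fin.opposite-involutive i))
          (Ψ-monomial (opposite i)))
      (s ⟨ toℕ i ⟩))
    where
    collect : ∀ {j} → j ℕ.< n → sum (λ (i : Fin n) → s ⟨ toℕ i ⟩ ℕ.* single (toℕ i) j) ≡ s ⟨ j ⟩
    collect {j} j<n = trans
      (sum-single {f = λ i → s ⟨ toℕ i ⟩ ℕ.* single (toℕ i) j} (fromℕ< j<n) λ i i≢ → trans
        (cong (s ⟨ toℕ i ⟩ ℕ.*_)
            (single-≢ λ e → i≢ (Fin.toℕ-injective (trans e (sym (Fin.toℕ-fromℕ< j<n))))))
        (ℕ.*-zeroʳ (s ⟨ toℕ i ⟩)))
      (trans (cong (λ i → s ⟨ i ⟩ ℕ.* single i j) (Fin.toℕ-fromℕ< j<n))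
        (trans (cong (s ⟨ j ⟩ ℕ.*_) (single-≡ j)) (ℕ.*-identityʳ (s ⟨ j ⟩))))

-- The elements Φ^(s), the lattice 𝔓^h and the weak hypothesis.

module AssociatedOrderBasis {k ℓk l ℓl a ℓa : Level} (S : Setting k ℓk l ℓl a ℓa)
  (β : ShiftParameters (Setting.p S) (Setting.n S)) (𝔗 : ℤ∞) (scaffold : Scaffold S β 𝔗)
  (N : ℤ) (1≤N : 1ℤ ℤ.≤ N) (N≤𝔗 : [ N ] ≤∞ 𝔗)
  (π : Field.Carrier (Setting.K S))
  (v-π : NormalizedDiscreteValuation.IsUniformizer (Setting.vK S) π)
  (h b : ℤ) (h≤b : h ℤ.≤ b) (b<h+q : b ℤ.< h ℤ.+ + (Setting.p S ^ Setting.n S))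
  (𝔞b : suc (Shifts.𝔞 (Setting.p-prime S) β b) ≡ Setting.p S ^ Setting.n S)
  (b-h≤N : b ℤ.- h ℤ.≤ N) where
  open Setting S
  open Ramified S
  open ScaffoldAction S β 𝔗 scaffold N 1≤N N≤𝔗
  open Monomial
  open Congruence (p ^ n)
  open Shifts p-prime β
  open ShiftProperties p-prime β
  open Scaffold scaffold
  open AssociatedOrder S h
  open LeftModule L-module using (*ₗ-congˡ; *ₗ-congʳ; *ₗ-zeroˡ; *ₗ-distribʳ)
  private instance
    p≢0 : NonZero p
    p≢0 = prime⇒nonZero p-prime
  open Digits p

  D W : ℕ → ℤ
  D = d h b
  W = w h b

  -- The representative of the class of b + 𝔟 r in [h, h + q).
  θ : ℕ → ℤ
  θ r = b ℤ.+ 𝔟 r ℤ.- q ℤ.* D r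

  qD≤ : ∀ r → q ℤ.* D r ℤ.≤ 𝔟 r ℤ.+ b ℤ.- h
  qD≤ r = subst (ℤ._≤ 𝔟 r ℤ.+ b ℤ.- h) (ℤ.*-comm (D r) q) (ℤ.[n/ℕd]*d≤n (𝔟 r ℤ.+ b ℤ.- h) (p ^ n))

  <q[1+D] : ∀ r → 𝔟 r ℤ.+ b ℤ.- h ℤ.< q ℤ.* ℤ.suc (D r)
  <q[1+D] r = subst (𝔟 r ℤ.+ b ℤ.- h ℤ.<_) (ℤ.*-comm (ℤ.suc (D r)) q)
      (ℤ.n<s[n/ℕd]*d (𝔟 r ℤ.+ b ℤ.- h) (p ^ n))

  h≤θ : ∀ r → h ℤ.≤ θ r
  h≤θ r = ≤-from (qD≤ r) (lem (𝔟 r) b h (q ℤ.* D r))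
    where
    lem : ∀ x b h y → x ℤ.+ b ℤ.- h ℤ.- y ≡ b ℤ.+ x ℤ.- y ℤ.- h
    lem = solve-∀

  θ<h+q : ∀ r → θ r ℤ.< h ℤ.+ q
  θ<h+q r = <-from (ℤ.i<j⇒suc[i]≤j (<q[1+D] r)) (lem (𝔟 r) b h (D r) q)
    where
    lem : ∀ x b h D q →
        q ℤ.* (1ℤ ℤ.+ D) ℤ.- (1ℤ ℤ.+ (x ℤ.+ b ℤ.- h)) ≡ h ℤ.+ q ℤ.- (1ℤ ℤ.+ (b ℤ.+ x ℤ.- q ℤ.* D))
    lem = solve-∀

  -- The number b - h lies in [0, q), so its quotient by q rounds down to 0. This makes index 0
  -- correspond to λ_b itself.
  D0≡0 : D 0 ≡ 0ℤ
  D0≡0 = ℤ.≤-antisym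
    (ℤ.i<j⇒i≤pred[j] (ℤ.*-cancelˡ-<-nonNeg {D 0} {1ℤ} q
      (<-from (ℤ.+-mono-≤ (qD≤ 0) (ℤ.i<j⇒suc[i]≤j b<h+q))
        (trans (cong (λ x → x ℤ.+ b ℤ.- h ℤ.+ (h ℤ.+ q) ℤ.- (q ℤ.* D 0 ℤ.+ (1ℤ ℤ.+ b))) 𝔟-0)
          (lem h q b (D 0))))))
    (ℤ.0≤n⇒0≤n/ℕd _ (p ^ n) (subst (λ x → 0ℤ ℤ.≤ x ℤ.+ b ℤ.- h) (sym 𝔟-0) (≤-from h≤b (lem′ b h))))
    where
    lem : ∀ h q b D →
        0ℤ ℤ.+ b ℤ.- h ℤ.+ (h ℤ.+ q) ℤ.- (q ℤ.* D ℤ.+ (1ℤ ℤ.+ b)) ≡ q ℤ.* 1ℤ ℤ.- (1ℤ ℤ.+ q ℤ.* D)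
    lem = solve-∀
    lem′ : ∀ b h → b ℤ.- h ≡ 0ℤ ℤ.+ b ℤ.- h ℤ.- 0ℤ
    lem′ = solve-∀

  θ0≡b : θ 0 ≡ b
  θ0≡b = trans (cong₂ (λ x y → b ℤ.+ x ℤ.- q ℤ.* y) 𝔟-0 D0≡0) (lem b q)
    where
    lem : ∀ b q → b ℤ.+ 0ℤ ℤ.- q ℤ.* 0ℤ ≡ b
    lem = solve-∀

  θ-mod : ∀ r → θ r ≡ b ℤ.+ 𝔟 r [mod p ^ n ]
  θ-mod r = subst (_≡ b ℤ.+ 𝔟 r [mod p ^ n ]) (lem (b ℤ.+ 𝔟 r) (D r) q)
      (mod-+-multiple (b ℤ.+ 𝔟 r) (ℤ.- D r))
    where
    lem : ∀ x D q → x ℤ.+ ℤ.- D ℤ.* q ≡ x ℤ.- q ℤ.* D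
    lem = solve-∀

  θ-separated : ∀ (i j : Fin (p ^ n)) → θ (toℕ i) ≡ θ (toℕ j) [mod p ^ n ] → i ≡ j
  θ-separated i j e = 𝔟-mod-injective i j (mod-+-cancelˡ b (𝔟 (toℕ i)) (𝔟 (toℕ j))
    (mod-trans (b ℤ.+ 𝔟 (toℕ i)) (θ (toℕ i)) (b ℤ.+ 𝔟 (toℕ j))
      (mod-sym (θ (toℕ i)) (b ℤ.+ 𝔟 (toℕ i)) (θ-mod (toℕ i)))
      (mod-trans (θ (toℕ i)) (θ (toℕ j)) (b ℤ.+ 𝔟 (toℕ j)) e (θ-mod (toℕ j)))))

  digit-𝔞b : ∀ {j} → j ℕ.< n → 𝔞 b ⟨ j ⟩ ≡ p ∸ 1
  digit-𝔞b = digit-pred n 𝔞b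

  -- Every digit of 𝔞 b is p - 1, so all Ψ^(s) act on λ_b with known valuation.
  ≼b : ∀ s → (s ⟨_⟩) ≼ b
  ≼b s {j} j<n = subst (s ⟨ j ⟩ ℕ.≤_) (sym (digit-𝔞b j<n)) (ℕ.<⇒≤pred (digit<p s j))

  digit-𝔞θ : ∀ r {j} → j ℕ.< n → 𝔞 (θ r) ⟨ j ⟩ ≡ p ∸ 1 ∸ r ⟨ j ⟩
  digit-𝔞θ r {j} j<n = trans (cong (_⟨ j ⟩) (𝔞-unique (𝔞-< (b ℤ.+ 𝔟 r))
      (mod-trans (𝔟 (𝔞 (b ℤ.+ 𝔟 r))) (ℤ.- (b ℤ.+ 𝔟 r)) (ℤ.- θ r) (𝔟-𝔞 (b ℤ.+ 𝔟 r))
        (mod-neg (b ℤ.+ 𝔟 r) (θ r) (mod-sym (θ r) (b ℤ.+ 𝔟 r) (θ-mod r))))))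
    (trans (digit-𝔞-shift {r ⟨_⟩} {b} (≼b r) j<n) (cong (_∸ r ⟨ j ⟩) (digit-𝔞b j<n)))

  module _ {r s} (r< : r ℕ.< p ^ n) (s< : s ℕ.< p ^ n) where
    -- Digit j of 𝔞 (θ r) is p - 1 minus digit j of r; surviving on λ_(θ r) thus means that r and s
    -- add without carry.
    ≼θ⇒no-carry : (s ⟨_⟩) ≼ θ r → ∀ {j} → j ℕ.< n → r ⟨ j ⟩ ℕ.+ s ⟨ j ⟩ ℕ.< p
    ≼θ⇒no-carry s≼ {j} j<n = ℕ.≤-<-trans
      (ℕ.+-monoʳ-≤ (r ⟨ j ⟩) (subst (s ⟨ j ⟩ ℕ.≤_) (digit-𝔞θ r j<n) (s≼ j<n)))
      (ℕ.≤-<-trans (ℕ.≤-reflexive (ℕ.m+[n∸m]≡n (ℕ.<⇒≤pred (digit<p r j))))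
          (ℕ.≤-reflexive (ℕ.suc-pred p)))

    no-carry⇒≼θ : (∀ {j} → j ℕ.< n → r ⟨ j ⟩ ℕ.+ s ⟨ j ⟩ ℕ.< p) → (s ⟨_⟩) ≼ θ r
    no-carry⇒≼θ no-carry {j} j<n = subst (s ⟨ j ⟩ ℕ.≤_) (sym (digit-𝔞θ r j<n))
      (ℕ.m+n≤o⇒m≤o∸n (s ⟨ j ⟩)
          (ℕ.<⇒≤pred (subst (ℕ._< p) (ℕ.+-comm (r ⟨ j ⟩) (s ⟨ j ⟩)) (no-carry j<n))))

  ⪯⇒digit : ∀ {s u} → s ⪯ u → ∀ {j} → j ℕ.< n → s ⟨ j ⟩ ℕ.≤ u ⟨ j ⟩
  ⪯⇒digit {s} {u} s⪯u j<n = subst (λ j → s ⟨ j ⟩ ℕ.≤ u ⟨ j ⟩) (Fin.toℕ-fromℕ< j<n)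
      (s⪯u (fromℕ< j<n))

  W≤ : ∀ {s u} → u ℕ.< p ^ n → s ⪯ u → W s ℤ.≤ D u ℤ.- D (u ∸ s)
  W≤ {s} {u} u< s⪯u = min≤v⁺ _ _ (inj₂ (Any.map (λ { refl → ℤ.≤-refl })
    (∈-map⁺ (λ u → D u ℤ.- D (u ∸ s)) (∈-filter⁺ (s ⪯?_) (∈-upTo⁺ u<) s⪯u))))

  W-attained : ∀ {s} → s ℕ.< p ^ n → ∃ λ u → u ℕ.< p ^ n × s ⪯ u × W s ≡ D u ℤ.- D (u ∸ s)
  W-attained {s} s< with argmin-sel (λ x → x) (D s ℤ.- D (s ∸ s))
      (map (λ u → D u ℤ.- D (u ∸ s)) (filter (s ⪯?_) (upTo (p ^ n))))
  ... | inj₁ e = s , s< , (λ j → ℕ.≤-refl) , e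
  ... | inj₂ W∈ with ∈-map⁻ (λ u → D u ℤ.- D (u ∸ s)) W∈
  ... | u , u∈ , e with ∈-filter⁻ (s ⪯?_) {xs = upTo (p ^ n)} u∈
  ... | u∈upTo , s⪯u = u , ∈-upTo⁻ u∈upTo , s⪯u , e

  -- The choice u = s in the minimum, with D 0 = 0.
  W≤D : ∀ {s} → s ℕ.< p ^ n → W s ℤ.≤ D s
  W≤D {s} s< = subst (W s ℤ.≤_)
    (trans (cong (λ z → D s ℤ.- z) (trans (cong D (ℕ.n∸n≡0 s)) D0≡0)) (ℤ.+-identityʳ (D s)))
    (W≤ s< (λ j → ℕ.≤-refl))

  π^-W : ℕ → K.Carrier
  π^-W s = π K.^ᶻ (ℤ.- W s)

  v-π^-W : ∀ s → vK.v (π^-W s) ≡ [ ℤ.- W s ]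
  v-π^-W s = vKP.v-^ᶻ v-π (ℤ.- W s)

  φ : ℕ → A.Carrier
  φ s = A/K.structureMap (π^-W s) A.* Ψ^⟨ s ⟩

  φ-· : ∀ s x → φ s · x L.≈ ι (π^-W s) L.* (Ψ^⟨ s ⟩ · x)
  φ-· s x = scale-· (π^-W s) Ψ^⟨ s ⟩ x

  Ψ^-λ : ∀ {s t} → (s ⟨_⟩) ≼ t → vL.v (Ψ^⟨ s ⟩ · λ- t) ≡ [ t ℤ.+ 𝔟 s ]
  Ψ^-λ {s} {t} s≼t = let c , v-c , close = hits (Ψ^-monomial s) t s≼t in vLP.v-dominant
    (trans (v-ι-* v-c (v-λ (t ℤ.+ 𝔟 s))) (cong [_] (lem q (t ℤ.+ 𝔟 s))))
    (vLP.𝔓-weaken (≤-from 1≤N (lem′ (t ℤ.+ 𝔟 s) N))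
      (vL.𝔓-resp (⁻¹-anti-homo‿- _ _) (vL.𝔓-neg close)))
    where
    open RingProperties L.ring using (⁻¹-anti-homo‿-)
    lem : ∀ q t → q ℤ.* 0ℤ ℤ.+ t ≡ t
    lem = solve-∀
    lem′ : ∀ t N → N ℤ.- 1ℤ ≡ t ℤ.+ N ℤ.- (1ℤ ℤ.+ t)
    lem′ = solve-∀

  φ-v : ∀ {s x m} → vL.v (Ψ^⟨ s ⟩ · x) ≡ [ m ] → vL.v (φ s · x) ≡ [ q ℤ.* (ℤ.- W s) ℤ.+ m ]
  φ-v {s} {x} v-Ψx = trans (vL.v-cong (φ-· s x)) (v-ι-* (v-π^-W s) v-Ψx)

  slack : ℤ
  slack = N ℤ.- (b ℤ.- h)

  h≤h+slack : h ℤ.≤ h ℤ.+ slack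
  h≤h+slack = ≤-from b-h≤N (lem h N (b ℤ.- h))
    where
    lem : ∀ h N x → N ℤ.- x ≡ h ℤ.+ (N ℤ.- x) ℤ.- h
    lem = solve-∀

  q*W≤ : ∀ {s i} → W s ℤ.≤ i → q ℤ.* W s ℤ.≤ q ℤ.* i
  q*W≤ W≤i = ℤ.*-monoˡ-≤-nonNeg q W≤i

  -- Scaling costs q * W s ≤ q * D s ≤ 𝔟 s + b - h, while the starting valuation θ r is at least h.
  -- The term 𝔟 s cancels, leaving N - (b - h) above h.
  error-bound : ∀ r {s} → s ℕ.< p ^ n → h ℤ.+ slack ℤ.≤ q ℤ.* (ℤ.- W s) ℤ.+ (θ r ℤ.+ 𝔟 s ℤ.+ N)
  error-bound r {s} s< = ≤-from (ℤ.+-mono-≤ (ℤ.+-mono-≤ (h≤θ r) (qD≤ s)) (q*W≤ {s} (W≤D s<)))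
    (lem h (θ r) (𝔟 s) b q (D s) (W s) N)
    where
    lem : ∀ h t x b q D W N → t ℤ.+ (x ℤ.+ b ℤ.- h) ℤ.+ q ℤ.* D ℤ.- (h ℤ.+ q ℤ.* D ℤ.+ q ℤ.* W) ≡
      q ℤ.* (ℤ.- W) ℤ.+ (t ℤ.+ x ℤ.+ N) ℤ.- (h ℤ.+ (N ℤ.- (b ℤ.- h)))
    lem = solve-∀

  φ-kills : ∀ r {s} → s ℕ.< p ^ n → ¬ (s ⟨_⟩) ≼ θ r → φ s · λ- (θ r) ∈ vL.𝔓 [ h ℤ.+ slack ]
  φ-kills r {s} s< s⋠ = vLP.𝔓-weaken (error-bound r s<) (vL.𝔓-resp (L.≈-sym (φ-· s _))
    (ι-*-𝔓 (vKP.v⇒∈𝔓 (v-π^-W s) ℤ.≤-refl) (kills (Ψ^-monomial s) (θ r) s⋠)))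

  φ-hits : ∀ r {s} → s ℕ.< p ^ n → (s ⟨_⟩) ≼ θ r →
           ∃ λ c → (φ s · λ- (θ r) L.- ι c L.* λ- (θ r ℤ.+ 𝔟 s)) ∈ vL.𝔓 [ h ℤ.+ slack ]
  φ-hits r {s} s< s≼ = let c , _ , close = hits (Ψ^-monomial s) (θ r) s≼ in π^-W s K.* c , vLP.𝔓-weaken (error-bound r s<) (vL.𝔓-resp
    (L.≈-trans (x[y-z]≈xy-xz _ _ _) (L.+-cong (L.≈-sym (φ-· s _)) (L.-‿cong
      (L.≈-trans (L.≈-sym (L.*-assoc _ _ _)) (L.*-congʳ (L.≈-sym (L/K.*-homo _ _)))))))
    (ι-*-𝔓 (vKP.v⇒∈𝔓 (v-π^-W s) ℤ.≤-refl) close))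
    where open RingProperties L.ring using (x[y-z]≈xy-xz)

  module NoCarry {r s} (r< : r ℕ.< p ^ n) (s< : s ℕ.< p ^ n) (s≼ : (s ⟨_⟩) ≼ θ r) where
    private
      no-carry : ∀ {j} → j ℕ.< n → r ⟨ j ⟩ ℕ.+ s ⟨ j ⟩ ℕ.< p
      no-carry = ≼θ⇒no-carry r< s< s≼

    r+s< : r ℕ.+ s ℕ.< p ^ n
    r+s< = +-no-carry-< r< s< no-carry

    𝔟-r+s : 𝔟 (r ℕ.+ s) ≡ 𝔟 r ℤ.+ 𝔟 s
    𝔟-r+s = 𝔟-+ {r} {s} {r ℕ.+ s} (digit-+-no-carry r< s< no-carry)

    W≤D-D : W s ℤ.≤ D (r ℕ.+ s) ℤ.- D r
    W≤D-D = subst (λ z → W s ℤ.≤ D (r ℕ.+ s) ℤ.- D z) (ℕ.m+n∸n≡m r s) (W≤ r+s< λ j →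
      subst (s ⟨ toℕ j ⟩ ℕ.≤_) (sym (digit-+-no-carry r< s< no-carry (Fin.toℕ<n j)))
          (ℕ.m≤n+m _ (r ⟨ toℕ j ⟩)))

    θ+𝔟≡ : θ r ℤ.+ 𝔟 s ≡ θ (r ℕ.+ s) ℤ.+ q ℤ.* (D (r ℕ.+ s) ℤ.- D r)
    θ+𝔟≡ = trans (lem b (𝔟 r) (𝔟 s) q (D r) (D (r ℕ.+ s)))
      (cong (λ z → b ℤ.+ z ℤ.- q ℤ.* D (r ℕ.+ s) ℤ.+ q ℤ.* (D (r ℕ.+ s) ℤ.- D r)) (sym 𝔟-r+s))
      where
      lem : ∀ b x y q Dr Du →
          b ℤ.+ x ℤ.- q ℤ.* Dr ℤ.+ y ≡ b ℤ.+ (x ℤ.+ y) ℤ.- q ℤ.* Du ℤ.+ q ℤ.* (Du ℤ.- Dr)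
      lem = solve-∀

    v-φ : vL.v (φ s · λ- (θ r)) ≡ [ q ℤ.* (ℤ.- W s) ℤ.+ (θ r ℤ.+ 𝔟 s) ]
    v-φ = φ-v {s} (Ψ^-λ {s} s≼)

    -- The valuation equals θ (r + s) + q * (D (r + s) - D r - W s), and u = r + s is one of the
    -- competitors in the minimum defining w(s).
    h≤v-φ : h ℤ.≤ q ℤ.* (ℤ.- W s) ℤ.+ (θ r ℤ.+ 𝔟 s)
    h≤v-φ = subst (λ z → h ℤ.≤ q ℤ.* (ℤ.- W s) ℤ.+ z) (sym θ+𝔟≡)
      (≤-from (ℤ.+-mono-≤ (h≤θ (r ℕ.+ s)) (q*W≤ {s} W≤D-D))
        (lem (θ (r ℕ.+ s)) (D (r ℕ.+ s) ℤ.- D r) (W s) h q))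
      where
      lem : ∀ t x W h q →
          t ℤ.+ q ℤ.* x ℤ.- (h ℤ.+ q ℤ.* W) ≡ q ℤ.* (ℤ.- W) ℤ.+ (t ℤ.+ q ℤ.* x) ℤ.- h
      lem = solve-∀

  φ-θ-𝔓 : ∀ {r s} → r ℕ.< p ^ n → s ℕ.< p ^ n → φ s · λ- (θ r) ∈ vL.𝔓 [ h ]
  φ-θ-𝔓 {r} {s} r< s< = by-cases ((s ⟨_⟩) ≼? θ r)
    where
    by-cases : Dec ((s ⟨_⟩) ≼ θ r) → φ s · λ- (θ r) ∈ vL.𝔓 [ h ]
    by-cases (yes s≼) = vLP.v⇒∈𝔓 (NoCarry.v-φ r< s< s≼) (NoCarry.h≤v-φ r< s< s≼)
    by-cases (no s⋠)  = vLP.𝔓-weaken h≤h+slack (φ-kills r s< s⋠)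

  e : Fin (p ^ n) → L.Carrier
  e i = λ- (θ (toℕ i))

  e-separated : Separated e
  e-separated = record { valuation = θ ∘ toℕ ; v-x = λ i → v-λ
      (θ (toℕ i)) ; separated = θ-separated _ _ }

  -- A nonintegral coefficient would lower a valuation below h + q by at least q, hence below h, and
  -- separated terms cannot cancel.
  lattice-coefficients : ∀ {N} {x : Fin N → L.Carrier} (sep : Separated x) →
    (∀ i → Separated.valuation sep i ℤ.< h ℤ.+ q) →
    ∀ {c} → lcL c x ∈ vL.𝔓 [ h ] → ∀ i → c i ∈ vK.𝔓 [ 0ℤ ]
  lattice-coefficients sep bound {c} lc∈ i = coefficient-𝔓 (Separated.v-x sep i)
      (Separated.terms-𝔓 sep c lc∈ i)
    (subst (ℤ._< h ℤ.+ q) (lem q (Separated.valuation sep i)) (bound i))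
    where
    lem : ∀ q x → x ≡ x ℤ.+ q ℤ.* 0ℤ
    lem = solve-∀

  𝔒-*-𝔓ᴸ : ∀ {c x m} → c ∈ vK.𝔓 [ 0ℤ ] → x ∈ vL.𝔓 [ m ] → ι c L.* x ∈ vL.𝔓 [ m ]
  𝔒-*-𝔓ᴸ {m = m} c∈ x∈ = subst (λ i → _ ∈ vL.𝔓 [ i ]) (lem q m) (ι-*-𝔓 c∈ x∈)
    where
    lem : ∀ q m → q ℤ.* 0ℤ ℤ.+ m ≡ m
    lem = solve-∀

  φ∈𝔄 : ∀ {s} → s ℕ.< p ^ n → φ s ∈ Member𝔄
  φ∈𝔄 {s} s< x x∈ = let c , x≈ = separated-spans e-separated x in vL.𝔓-resp (L.≈-sym (L.≈-trans (*ₗ-congˡ x≈) (·-lcL (φ s) c e)))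
    (vLP.𝔓-sum λ i → 𝔒-*-𝔓ᴸ
      (lattice-coefficients e-separated (θ<h+q ∘ toℕ) (vL.𝔓-resp x≈ x∈) i) (φ-θ-𝔓 (Fin.toℕ<n i) s<))

  Φ∈𝔄 : ∀ s → Φ π h b s ∈ Member𝔄
  Φ∈𝔄 s = φ∈𝔄 (Fin.toℕ<n s)

  q-pos : 0 ℕ.< p ^ n
  q-pos = ℕ.>-nonZero⁻¹ (p ^ n)

  0F : Fin (p ^ n)
  0F = fromℕ< q-pos

  θ0F≡b : θ (toℕ 0F) ≡ b
  θ0F≡b = trans (cong θ (Fin.toℕ-fromℕ< q-pos)) θ0≡b

  -- Only `e 0F` has valuation congruent to b, so every other term of the expansion of ρ, lying in
  -- 𝔓^b, already lies in 𝔓^(b+1). This reduces an arbitrary ρ of valuation b to λ_b.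
  leading-term : ∀ {ρ} → vL.v ρ ≡ [ b ] → ∃ λ c → (ρ L.- ι c L.* λ- b) ∈ vL.𝔓 [ ℤ.suc b ]
  leading-term {ρ} v-ρ = c 0F , subst (λ t → (ρ L.- ι (c 0F) L.* λ- t) ∈ vL.𝔓 [ ℤ.suc b ]) θ0F≡b
    (vL.𝔓-resp (L.+-congʳ (L.≈-sym ρ≈))
      (vLP.sum-single-𝔓 {f = λ i → ι (c i) L.* e i} 0F λ j j≢0 → higher j j≢0
          ((ι (c j) L.* e j) vLP.∈𝔓? ℤ.suc b)))
    where
    open Separated e-separated using (term-residue; terms-𝔓)
    c : Fin (p ^ n) → K.Carrier
    c = proj₁ (separated-spans e-separated ρ)
    ρ≈ : ρ L.≈ lcL c e
    ρ≈ = proj₂ (separated-spans e-separated ρ)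
    terms∈ : ∀ j → ι (c j) L.* e j ∈ vL.𝔓 [ b ]
    terms∈ = terms-𝔓 c (vL.𝔓-resp ρ≈ (vLP.v⇒∈𝔓 v-ρ ℤ.≤-refl))
    v≡b : ∀ {j m} → vL.v (ι (c j) L.* e j) ≡ [ m ] → m ℤ.< ℤ.suc b → m ≡ b
    v≡b {j} {m} v-term m< = ℤ.≤-antisym
      (subst (m ℤ.≤_) (ℤ.pred-suc b) (ℤ.i<j⇒i≤pred[j] m<)) (vLP.∈𝔓⇒v v-term (terms∈ j))
    higher : ∀ j → ¬ j ≡ 0F → Dec (ι (c j) L.* e j ∈ vL.𝔓 [ ℤ.suc b ]) →
        ι (c j) L.* e j ∈ vL.𝔓 [ ℤ.suc b ]
    higher j j≢0 (yes ∈suc) = ∈suc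
    higher j j≢0 (no ∉suc) = let m , v-term , m< = vLP.∉𝔓⇒v ∉suc in
      contradiction
          (θ-separated j 0F
              (subst (θ (toℕ j) ≡_[mod p ^ n ]) (trans (v≡b {j} v-term m<) (sym θ0F≡b))
        (mod-sym m (θ (toℕ j)) (term-residue c j v-term)))) j≢0

  v-Ψ^ρ : ∀ {ρ} → vL.v ρ ≡ [ b ] → ∀ s → vL.v (Ψ^⟨ s ⟩ · ρ) ≡ [ b ℤ.+ 𝔟 s ]
  v-Ψ^ρ {ρ} v-ρ s = vLP.v-dominant v-leading close
    where
    open RingProperties L.ring using (⁻¹-anti-homo‿-)
    c : K.Carrier
    c = proj₁ (leading-term v-ρ)
    v-cλ : vL.v (ι c L.* λ- b) ≡ [ b ]
    v-cλ = vLP.v-dominant v-ρ (proj₂ (leading-term v-ρ))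
    v-leading : vL.v (ι c L.* (Ψ^⟨ s ⟩ · λ- b)) ≡ [ b ℤ.+ 𝔟 s ]
    v-leading = trans (vLP.v-*-finite (vLP.v-quotient (v-λ b) v-cλ) (Ψ^-λ {s} (≼b s)))
      (cong [_] (lem b (b ℤ.+ 𝔟 s)))
      where
      lem : ∀ b x → b ℤ.- b ℤ.+ x ≡ x
      lem = solve-∀
    close : (ι c L.* (Ψ^⟨ s ⟩ · λ- b) L.- Ψ^⟨ s ⟩ · ρ) ∈ vL.𝔓 [ ℤ.suc (b ℤ.+ 𝔟 s) ]
    close = subst (λ m → (ι c L.* (Ψ^⟨ s ⟩ · λ- b) L.- Ψ^⟨ s ⟩ · ρ) ∈ vL.𝔓 [ m ])
        (ℤ.+-assoc 1ℤ b (𝔟 s))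
      (vL.𝔓-resp
        (L.≈-trans
            (L.-‿cong (L.≈-trans (·-- Ψ^⟨ s ⟩ ρ _) (L.+-congˡ (L.-‿cong (·-ι Ψ^⟨ s ⟩ c (λ- b))))))
          (⁻¹-anti-homo‿- _ _))
        (vL.𝔓-neg (raises (Ψ^-monomial s) (proj₂ (leading-term v-ρ)))))

  orbit : L.Carrier → Fin (p ^ n) → L.Carrier
  orbit ρ s = Φ π h b s · ρ

  orbit-separated : ∀ {ρ} → vL.v ρ ≡ [ b ] → Separated (orbit ρ)
  orbit-separated v-ρ = record
    { valuation = λ s → q ℤ.* (ℤ.- W (toℕ s)) ℤ.+ (b ℤ.+ 𝔟 (toℕ s))
    ; v-x       = λ s → φ-v {toℕ s} (v-Ψ^ρ v-ρ (toℕ s))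
    ; separated = λ {i} {j} i≡j → 𝔟-mod-injective i j (mod-+-cancelˡ b (𝔟 (toℕ i)) (𝔟 (toℕ j))
        (mod-trans (b ℤ.+ 𝔟 (toℕ i)) (q ℤ.* (ℤ.- W (toℕ i)) ℤ.+ (b ℤ.+ 𝔟 (toℕ i))) (b ℤ.+ 𝔟 (toℕ j))
          (mod-sym (q ℤ.* (ℤ.- W (toℕ i)) ℤ.+ (b ℤ.+ 𝔟 (toℕ i))) (b ℤ.+ 𝔟 (toℕ i))
              (residue (W (toℕ i)) (b ℤ.+ 𝔟 (toℕ i))))
          (mod-trans (q ℤ.* (ℤ.- W (toℕ i)) ℤ.+ (b ℤ.+ 𝔟 (toℕ i)))
              (q ℤ.* (ℤ.- W (toℕ j)) ℤ.+ (b ℤ.+ 𝔟 (toℕ j))) (b ℤ.+ 𝔟 (toℕ j))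
            i≡j (residue (W (toℕ j)) (b ℤ.+ 𝔟 (toℕ j))))))
    }
    where
    residue : ∀ w x → q ℤ.* (ℤ.- w) ℤ.+ x ≡ x [mod p ^ n ]
    residue w x = divides (ℤ.- w) (lem q w x)
      where
      lem : ∀ q w x → q ℤ.* (ℤ.- w) ℤ.+ x ℤ.- x ≡ ℤ.- w ℤ.* q
      lem = solve-∀

  Φ-independent : ∀ {k} {τ : Fin k → Fin (p ^ n)} → Injective _≡_ _≡_ τ →
      AM.Independent (Φ π h b ∘ τ)
  Φ-independent {τ = τ} τ-injective c lc≈0 = Separated.independent
    (reindex-separated (orbit-separated (v-λ b)) τ-injective) c
    (L.≈-trans (L.≈-sym (lcA-· c (Φ π h b ∘ τ) (λ- b)))
        (L.≈-trans (*ₗ-congʳ lc≈0) (*ₗ-zeroˡ (λ- b))))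

  Φ-spans : AM.Spans (Φ π h b)
  Φ-spans = LinearDependence.independent⇒spans K vKP.≈0? A/K.asLeftModule A-dimension
    (Φ-independent {τ = λ i → i} (λ e → e))

  proj-lc : ∀ {k} (c : Fin k → Ring.Carrier (Subring.subring vK.𝔒))
      (α : Fin k → LeftModule.Carrierᴹ 𝔄-over-𝔒K) →
            proj₁ (linearCombination 𝔄-over-𝔒K c α) A.≈ lcA (proj₁ ∘ c) (proj₁ ∘ α)
  proj-lc {zero}  c α = A.refl
  proj-lc {suc k} c α = A.+-cong A.refl (proj-lc (c ∘ suc) (α ∘ suc))

  -- Φ is already a K-basis of A contained in 𝔄, so only the integrality of coordinates is at stake.
  𝔒-coefficients⇒basis : (∀ c → lcA c (Φ π h b) ∈ Member𝔄 → ∀ i → c i ∈ vK.𝔓 [ 0ℤ ]) →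
      Has𝔒K-Basis (Φ π h b)
  𝔒-coefficients⇒basis integral = Φ∈𝔄 , record
    { independent = λ τ τ-injective c lc≈0 → Φ-independent τ-injective (proj₁ ∘ c)
        (A.trans (A.sym (proj-lc c (λ j → Φ π h b (τ j) , Φ∈𝔄 (τ j)))) lc≈0)
    ; spanning = λ (α , α∈) → p ^ n , (λ i → i) ,
        (λ i → proj₁ (Φ-spans α) i , integral (proj₁ (Φ-spans α))
            (Member-resp (proj₂ (Φ-spans α)) α∈) i) ,
        A.trans (proj₂ (Φ-spans α)) (A.sym (proj-lc _ (λ s → Φ π h b s , Φ∈𝔄 s)))
    }
    where
    Member-resp : ∀ {α α′} → α A.≈ α′ → α ∈ Member𝔄 → α′ ∈ Member𝔄
    Member-resp α≈ α∈ x x∈ = vL.𝔓-resp (*ₗ-congʳ α≈) (α∈ x x∈)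

  lc∈𝔄 : ∀ {N} (c : Fin N → K.Carrier) {α : Fin N → A.Carrier} → (∀ i → c i ∈ vK.𝔓 [ 0ℤ ]) →
         (∀ i → α i ∈ Member𝔄) → lcA c α ∈ Member𝔄
  lc∈𝔄 c {α} c∈ α∈ x x∈ = vL.𝔓-resp (L.≈-sym (lcA-· c α x))
      (vLP.𝔓-sum λ i → 𝔒-*-𝔓ᴸ (c∈ i) (α∈ i x x∈))

  v≡b⇒∈𝔓 : ∀ {ρ} → vL.v ρ ≡ [ b ] → ρ ∈ vL.𝔓 [ h ]
  v≡b⇒∈𝔓 v-ρ = vLP.v⇒∈𝔓 v-ρ h≤b

  generator⇒free : ∀ {ρ} → ρ ∈ vL.𝔓 [ h ] → 𝔓ᴸ≐𝔄· ρ → (∀ α → α · ρ L.≈ L.0# → α A.≈ A.0#) →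
      IsFree 𝔓ᴸ-over-𝔄
  generator⇒free {ρ} ρ∈ generates faithful = Lift l ⊤ , (λ _ → ρ , ρ∈) , record
    { independent = free
    ; spanning    = λ (x , x∈) → let α , α∈ , x≈ = Equivalence.to (generates x) x∈ in
        1 , (λ _ → lift tt) , (λ _ → α , α∈) , L.≈-trans x≈ (L.≈-sym (L.+-identityʳ (α · ρ)))
    }
    where
    free : ∀ {k} (τ : Fin k → Lift l ⊤) → Injective _≡_ _≡_ τ → ∀ c →
           proj₁ (linearCombination 𝔓ᴸ-over-𝔄 c (λ _ → ρ , ρ∈)) L.≈ L.0# → ∀ j → proj₁
               (c j) A.≈ A.0#
    free {suc zero} τ τ-injective c lc≈0 zero = faithful (proj₁ (c zero))
        (L.≈-trans (L.≈-sym (L.+-identityʳ _)) lc≈0)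
    -- An injective family of indices in a one-element set has at most one member.
    free {suc (suc k)} τ τ-injective c lc≈0 j with τ-injective {zero} {suc zero} refl
    ... | ()

  module TightWeights (W≡D : ∀ (s : Fin (p ^ n)) → W (toℕ s) ≡ D (toℕ s)) {ρ}
      (v-ρ : vL.v ρ ≡ [ b ]) where
    private
      sep : Separated (orbit ρ)
      sep = orbit-separated v-ρ

      valuation≡θ : ∀ s → Separated.valuation sep s ≡ θ (toℕ s)
      valuation≡θ s = trans (cong (λ w → q ℤ.* (ℤ.- w) ℤ.+ (b ℤ.+ 𝔟 (toℕ s))) (W≡D s))
        (lem q (D (toℕ s)) (b ℤ.+ 𝔟 (toℕ s)))
        where
        lem : ∀ q w x → q ℤ.* (ℤ.- w) ℤ.+ x ≡ x ℤ.- q ℤ.* w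
        lem = solve-∀

      orbit-coefficients : ∀ {c} → lcL c (orbit ρ) ∈ vL.𝔓 [ h ] → ∀ i → c i ∈ vK.𝔓 [ 0ℤ ]
      orbit-coefficients = lattice-coefficients sep
        λ s → subst (ℤ._< h ℤ.+ q) (sym (valuation≡θ s)) (θ<h+q (toℕ s))

    integral : ∀ c → lcA c (Φ π h b) ∈ Member𝔄 → ∀ i → c i ∈ vK.𝔓 [ 0ℤ ]
    integral c α∈ = orbit-coefficients {c} (vL.𝔓-resp (lcA-· c (Φ π h b) ρ) (α∈ ρ (v≡b⇒∈𝔓 v-ρ)))

    generates : 𝔓ᴸ≐𝔄· ρ
    generates x = mk⇔ to λ (α , α∈ , x≈) → vL.𝔓-resp (L.≈-sym x≈) (α∈ ρ (v≡b⇒∈𝔓 v-ρ))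
      where
      to : x ∈ vL.𝔓 [ h ] → ∃ λ α → α ∈ Member𝔄 × x L.≈ α · ρ
      to x∈ = let c , x≈ = separated-spans sep x in
        lcA c (Φ π h b) , lc∈𝔄 c (orbit-coefficients {c} (vL.𝔓-resp x≈ x∈)) Φ∈𝔄 ,
        L.≈-trans x≈ (L.≈-sym (lcA-· c (Φ π h b) ρ))

    faithful : ∀ α → α · ρ L.≈ L.0# → α A.≈ A.0#
    faithful α αρ≈0 = let c , α≈ = Φ-spans α
                          c≈0 = Separated.independent sep c
                            (L.≈-trans (L.≈-sym (lcA-· c (Φ π h b) ρ))
                                (L.≈-trans (*ₗ-congʳ (A.sym α≈)) αρ≈0))
      in A.trans α≈
          (ΣA.sum-ε λ i → A.trans (A.*-congʳ (A.trans (A/K.⟦⟧-cong (c≈0 i)) A/K.0#-homo))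
              (A.zeroˡ _))

    free : IsFree 𝔓ᴸ-over-𝔄
    free = generator⇒free (v≡b⇒∈𝔓 v-ρ) generates faithful

  -- Integrality of coordinates under the strong hypothesis.

  module StrongTolerance (strong : q ℤ.+ b ℤ.- h ℤ.≤ N) where
    h+q≤h+slack : h ℤ.+ q ℤ.≤ h ℤ.+ slack
    h+q≤h+slack = ≤-from strong (lem q b h N)
      where
      lem : ∀ q b h N → N ℤ.- (q ℤ.+ b ℤ.- h) ≡ h ℤ.+ (N ℤ.- (b ℤ.- h)) ℤ.- (h ℤ.+ q)
      lem = solve-∀

    -- Testing α on λ_{θ r}, with r + s = u attaining the minimum in w(s), isolates the coefficient of Φ^(s).
    module Improve (c : Fin (p ^ n) → K.Carrier) (α∈ : lcA c (Φ π h b) ∈ Member𝔄)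
      (μ : ℤ) (μ<0 : ℤ.suc μ ℤ.≤ 0ℤ) (c∈ : ∀ i → c i ∈ vK.𝔓 [ μ ]) (s : Fin (p ^ n))
      {u : ℕ} (u< : u ℕ.< p ^ n) (s⪯u : toℕ s ⪯ u) (W≡ : W (toℕ s) ≡ D u ℤ.- D (u ∸ toℕ s)) where
      r : ℕ
      r = u ∸ toℕ s

      s≤u : toℕ s ℕ.≤ u
      s≤u = subst₂ ℕ._≤_ (fromDigits-digit n (Fin.toℕ<n s)) (fromDigits-digit n u<)
        (fromDigits-mono n (⪯⇒digit {toℕ s} {u} s⪯u))

      r+s≡u : r ℕ.+ toℕ s ≡ u
      r+s≡u = ℕ.m∸n+n≡m s≤u

      r< : r ℕ.< p ^ n
      r< = ℕ.≤-<-trans (ℕ.m∸n≤m u (toℕ s)) u<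

      s≼ : (toℕ s ⟨_⟩) ≼ θ r
      s≼ = no-carry⇒≼θ r< (Fin.toℕ<n s) λ {j} j<n → subst (ℕ._< p)
        (sym (trans
            (cong (ℕ._+ toℕ s ⟨ j ⟩) (digit-∸ (Fin.toℕ<n s) u< (⪯⇒digit {toℕ s} {u} s⪯u) j<n))
          (ℕ.m∸n+n≡m (⪯⇒digit {toℕ s} {u} s⪯u j<n))))
        (digit<p u j)

      -- Since `slack` is at least q, a killed term with coefficient in 𝔓_K^μ lies in 𝔓^(qμ + h +
      -- q), whose exponent is `M`. As μ < 0, the image of λ_(θ r) under α, known to lie in 𝔓^h,
      -- lies in 𝔓^M too.
      M : ℤ
      M = h ℤ.+ q ℤ.* ℤ.suc μ

      M≤h : M ℤ.≤ h
      M≤h = ≤-from (ℤ.*-monoˡ-≤-nonNeg q μ<0) (lem q (ℤ.suc μ) h)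
        where
        lem : ∀ q x h → q ℤ.* 0ℤ ℤ.- q ℤ.* x ≡ h ℤ.- (h ℤ.+ q ℤ.* x)
        lem = solve-∀

      full : Fin (p ^ n) → L.Carrier
      full i = ι (c i) L.* (φ (toℕ i) · λ- (θ r))

      full∈ : ΣL.sum full ∈ vL.𝔓 [ M ]
      full∈ = vLP.𝔓-weaken M≤h (vL.𝔓-resp (lcA-· c (Φ π h b) (λ- (θ r)))
        (α∈ (λ- (θ r)) (vLP.v⇒∈𝔓 (v-λ (θ r)) (h≤θ r))))

      -- Killed terms have no known residue class and are replaced by 0, whose infinite value
      -- clashes with nothing. The decision is an argument so that lemmas about one term can match
      -- on it.
      kept : ∀ i → Dec ((toℕ i ⟨_⟩) ≼ θ r) → L.Carrier
      kept i (yes _) = full i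
      kept i (no _)  = L.0#

      dec : ∀ (i : Fin (p ^ n)) → Dec ((toℕ i ⟨_⟩) ≼ θ r)
      dec i = (toℕ i ⟨_⟩) ≼? θ r

      full≡kept : ∀ i (i≼? : Dec ((toℕ i ⟨_⟩) ≼ θ r)) → (full i L.- kept i i≼?) ∈ vL.𝔓 [ M ]
      full≡kept i (yes _) = vLP.≈0⇒∈𝔓 (L.-‿inverseʳ (full i))
      full≡kept i (no i⋠) = vL.𝔓-resp (L.≈-sym (x-0≈x (full i)))
        (vLP.𝔓-weaken (≤-from h+q≤h+slack (lem h q μ slack))
            (ι-*-𝔓 (c∈ i) (φ-kills r (Fin.toℕ<n i) i⋠)))
        where
        lem : ∀ h q μ x → h ℤ.+ x ℤ.- (h ℤ.+ q) ≡ q ℤ.* μ ℤ.+ (h ℤ.+ x) ℤ.- (h ℤ.+ q ℤ.* (1ℤ ℤ.+ μ))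
        lem = solve-∀

      kept-residue : ∀ i (i≼? : Dec ((toℕ i ⟨_⟩) ≼ θ r)) {m} → vL.v (kept i i≼?) ≡ [ m ] →
                     m ≡ θ r ℤ.+ 𝔟 (toℕ i) [mod p ^ n ]
      kept-residue i (yes i≼) {m} v-term = mod-trans m
          (q ℤ.* (ℤ.- W (toℕ i)) ℤ.+ (θ r ℤ.+ 𝔟 (toℕ i))) (θ r ℤ.+ 𝔟 (toℕ i))
        (Separated.term-residue single-term (λ _ → c i) zero v-term)
        (divides (ℤ.- W (toℕ i)) (lem q (W (toℕ i)) (θ r ℤ.+ 𝔟 (toℕ i))))
        where
        single-term : Separated {1} (λ _ → φ (toℕ i) · λ- (θ r))
        single-term = record
          { valuation = λ _ → q ℤ.* (ℤ.- W (toℕ i)) ℤ.+ (θ r ℤ.+ 𝔟 (toℕ i))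
          ; v-x = λ _ → NoCarry.v-φ r< (Fin.toℕ<n i) i≼
          ; separated = λ { {zero} {zero} _ → refl } }
        lem : ∀ q w x → q ℤ.* (ℤ.- w) ℤ.+ x ℤ.- x ≡ ℤ.- w ℤ.* q
        lem = solve-∀
      kept-residue i (no _) v-0 = ⊥-elim (vLP.v-finite v-0 L.≈-refl)

      kept-distinct : vLP.Distinct (λ i → kept i (dec i))
      kept-distinct {i} {j} (m , v-i , v-j) = 𝔟-mod-injective i j
          (mod-+-cancelˡ (θ r) (𝔟 (toℕ i)) (𝔟 (toℕ j))
        (mod-trans (θ r ℤ.+ 𝔟 (toℕ i)) m (θ r ℤ.+ 𝔟 (toℕ j))
          (mod-sym m (θ r ℤ.+ 𝔟 (toℕ i)) (kept-residue i (dec i) v-i))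
              (kept-residue j (dec j) v-j)))

      kept-s∈ : ∀ (s≼? : Dec ((toℕ s ⟨_⟩) ≼ θ r)) → kept s s≼? ∈ vL.𝔓 [ M ] → full s ∈ vL.𝔓 [ M ]
      kept-s∈ (yes _) = λ ∈M → ∈M
      kept-s∈ (no s⋠) = ⊥-elim (s⋠ s≼)

      full-s∈ : full s ∈ vL.𝔓 [ M ]
      full-s∈ = kept-s∈ (dec s) (vLP.sum-distinct (λ i → kept i (dec i)) kept-distinct
        (vLP.𝔓-transportˡ
            (vLP.sum-cong-𝔓 {f = full} {λ i → kept i (dec i)} λ i → full≡kept i (dec i)) full∈) s)

      -- Because u attains the minimum, W s cancels D u - D r exactly and the valuation falls into
      -- [h, h + q).
      v-φs : vL.v (φ (toℕ s) · λ- (θ r)) ≡ [ θ u ]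
      v-φs = trans (NoCarry.v-φ r< (Fin.toℕ<n s) s≼) (cong [_]
        (trans (cong₂ (λ w x → q ℤ.* (ℤ.- w) ℤ.+ x) W≡
          (trans (NoCarry.θ+𝔟≡ r< (Fin.toℕ<n s) s≼)
              (cong (λ u → θ u ℤ.+ q ℤ.* (D u ℤ.- D r)) r+s≡u)))
          (lem q (D u ℤ.- D r) (θ u))))
        where
        lem : ∀ q x t → q ℤ.* (ℤ.- x) ℤ.+ (t ℤ.+ q ℤ.* x) ≡ t
        lem = solve-∀

      improved : c s ∈ vK.𝔓 [ ℤ.suc μ ]
      -- From θ u < h + q follows θ u + q * (μ + 1) < M + q, which gains one full power of 𝔓_K.
      improved = coefficient-𝔓 v-φs full-s∈
        (<-from (ℤ.i<j⇒suc[i]≤j (θ<h+q u)) (lem h q (θ u) (ℤ.suc μ)))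
        where
        lem : ∀ h q t x → h ℤ.+ q ℤ.- (1ℤ ℤ.+ t) ≡ h ℤ.+ q ℤ.* x ℤ.+ q ℤ.- (1ℤ ℤ.+ (t ℤ.+ q ℤ.* x))
        lem = solve-∀

    -- Each round improves the common bound of all coefficients by one. A round needs μ < 0, so the
    -- descent ends exactly at integrality.
    integral : ∀ c → lcA c (Φ π h b) ∈ Member𝔄 → ∀ i → c i ∈ vK.𝔓 [ 0ℤ ]
    integral c α∈ = let m , c∈ = vKP.bounded-below c in descend m c∈
      where
      descend : ∀ m → (∀ i → c i ∈ vK.𝔓 [ ℤ.- (+ m) ]) → ∀ i → c i ∈ vK.𝔓 [ 0ℤ ]
      descend zero    c∈ = c∈
      descend (suc m) c∈ = descend m λ s → let u , u< , s⪯u , W≡ = W-attained (Fin.toℕ<n s) in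
        subst (λ μ → c s ∈ vK.𝔓 [ μ ]) (suc-neg m)
          (Improve.improved c α∈ (ℤ.- (+ suc m)) (ℤ.i<j⇒suc[i]≤j (ℤ.-<+ {m} {0})) c∈ s u< s⪯u W≡)
        where
        suc-neg : ∀ m → ℤ.suc (ℤ.- (+ suc m)) ≡ ℤ.- (+ m)
        suc-neg zero    = refl
        suc-neg (suc m) = refl

  -- Coordinates in the lattice basis `e` and their reduction modulo 𝔓_K.

  open Separated e-separated using () renaming (independent to e-independent; terms-𝔓 to e-terms-𝔓)

  coord : L.Carrier → Fin (p ^ n) → K.Carrier
  coord x = proj₁ (separated-spans e-separated x)

  coord-lc : ∀ x → x L.≈ lcL (coord x) e
  coord-lc x = proj₂ (separated-spans e-separated x)

  coord-unique : ∀ {x c} → x L.≈ lcL c e → ∀ i → coord x i K.≈ c i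
  coord-unique {x} {c} x≈ = LM.independent⇒unique e-independent {coord x} {c}
      (L.≈-trans (L.≈-sym (coord-lc x)) x≈)

  coord-linear : ∀ {N} (a : Fin N → K.Carrier) (y : Fin N → L.Carrier) {x} → x L.≈ lcL a y →
                 ∀ i → coord x i K.≈ ΣK.sum (λ j → a j K.* coord (y j) i)
  coord-linear a y x≈ = coord-unique (L.≈-trans x≈
    (L.≈-trans (LM.lc-cong {a = a} (λ _ → K.≈-refl) (coord-lc ∘ y)) (LM.lc-lc a (coord ∘ y) e)))

  coord-e : ∀ k i → coord (e k) i K.≈ LM.δ k i
  coord-e k = coord-unique (L.≈-sym (LM.lc-δ k e))

  coord-𝔒 : ∀ {x} → x ∈ vL.𝔓 [ h ] → ∀ i → coord x i ∈ vK.𝔓 [ 0ℤ ]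
  coord-𝔒 {x} x∈ = lattice-coefficients e-separated (θ<h+q ∘ toℕ) {coord x}
      (vL.𝔓-resp (coord-lc x) x∈)

  term∈⇒∈𝔓 : ∀ {c m} k → h ℤ.+ q ℤ.≤ m → ι c L.* e k ∈ vL.𝔓 [ m ] → c ∈ vK.𝔓 [ 1ℤ ]
  term∈⇒∈𝔓 {c} {m} k h+q≤m term∈ = coefficient-𝔓 (v-λ (θ (toℕ k))) term∈
    (<-from (ℤ.+-mono-≤ (ℤ.i<j⇒suc[i]≤j (θ<h+q (toℕ k))) h+q≤m) (lem (θ (toℕ k)) (h ℤ.+ q) m q))
    where
    lem : ∀ t x m q → x ℤ.+ m ℤ.- (1ℤ ℤ.+ t ℤ.+ x) ≡ m ℤ.+ q ℤ.- (1ℤ ℤ.+ (t ℤ.+ q ℤ.* 1ℤ))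
    lem = solve-∀

  -- The difference is π times a lattice element, and its separated expansion shows this for each
  -- coordinate; those away from `u` are unaffected by the subtracted multiple.
  coord-multiple : ∀ {x c u k} → (x L.- ι c L.* e u) ∈ vL.𝔓 [ h ℤ.+ q ] → ¬ k ≡ u →
      coord x k ∈ vK.𝔓 [ 1ℤ ]
  coord-multiple {x} {c} {u} {k} close k≢u = vK.𝔓-resp cancel (term∈⇒∈𝔓 k ℤ.≤-refl
    (e-terms-𝔓 (λ i → coord x i K.- c K.* LM.δ u i) (vL.𝔓-resp difference close) k))
    where
    open SetoidReasoning L.setoid
    cδ : Fin (p ^ n) → K.Carrier
    cδ i = c K.* LM.δ u i
    cδ-lc : lcL cδ e L.≈ ι c L.* e u
    cδ-lc = L.≈-trans (L.≈-sym (LM.lc-scale c (LM.δ u) e)) (L.*-congˡ (LM.lc-δ u e))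
    difference : x L.- ι c L.* e u L.≈ lcL (λ i → coord x i K.- cδ i) e
    difference = begin
      x L.- ι c L.* e u
        ≈⟨ L.+-cong (coord-lc x) (L.-‿cong (L.≈-sym cδ-lc)) ⟩
      lcL (coord x) e L.- lcL cδ e
        ≈⟨ L.+-congʳ (LM.lc-- (coord x) cδ e) ⟨
      lcL (λ i → coord x i K.- cδ i) e L.+ lcL cδ e L.- lcL cδ e
        ≈⟨ L.≈-trans (L.+-assoc _ _ _) (L.≈-trans (L.+-congˡ (L.-‿inverseʳ _)) (L.+-identityʳ _)) ⟩
      lcL (λ i → coord x i K.- cδ i) e ∎
    cancel : coord x k K.- cδ k K.≈ coord x k
    cancel = K.≈-trans
        (K.+-congˡ
            (K.-‿cong (K.≈-trans (K.*-congˡ (K.reflexive (LM.δ-off-diagonal k≢u))) (K.zeroʳ c))))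
      (K.≈-trans (K.+-congˡ ε⁻¹≈ε) (K.+-identityʳ _))
      where open AbelianGroupProperties K.+-abelianGroup using (ε⁻¹≈ε)

  -- The quotient condition of the scaffold gives an exact multiple; comparing valuations alone
  -- would leave a remainder of higher valuation.
  λ-multiple : ∀ {t} u → t ≡ θ (toℕ u) [mod p ^ n ] → ∃ λ c → λ- t L.≈ ι c L.* e u
  λ-multiple {t} u t≡ = let c , λλ⁻¹≈ = λ-K t (θ (toℕ u)) t≡ in c , (begin
    λ- t                            ≈⟨ L.*-identityʳ (λ- t) ⟨
    λ- t L.* L.1#                   ≈⟨ L.*-congˡ
        (L.⁻¹-inverseʳ (e u) (vLP.v-finite (v-λ (θ (toℕ u))))) ⟨
    λ- t L.* (e u L.* e u L.⁻¹)     ≈⟨ L.*-congˡ (L.*-comm (e u) (e u L.⁻¹)) ⟩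
    λ- t L.* (e u L.⁻¹ L.* e u)     ≈⟨ L.*-assoc (λ- t) (e u L.⁻¹) (e u) ⟨
    λ- t L.* e u L.⁻¹ L.* e u       ≈⟨ L.*-congʳ λλ⁻¹≈ ⟩
    ι c L.* e u                     ∎)
    where open SetoidReasoning L.setoid

  module Freeness (strong : q ℤ.+ b ℤ.- h ℤ.≤ N) where
    open StrongTolerance strong

    Y : (s r : Fin (p ^ n)) → Fin (p ^ n) → K.Carrier
    Y s r = coord (φ (toℕ s) · e r)

    -- Errors lie in π times the lattice. Modulo them Φ^(s) · e_r is 0 or, when r + s has no carry,
    -- a multiple of e_(r+s).
    Y-off : ∀ s r k → ¬ toℕ k ≡ toℕ r ℕ.+ toℕ s → Y s r k ∈ vK.𝔓 [ 1ℤ ]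
    Y-off s r k k≢r+s = by-cases ((toℕ s ⟨_⟩) ≼? θ (toℕ r))
      where
      by-cases : Dec ((toℕ s ⟨_⟩) ≼ θ (toℕ r)) → Y s r k ∈ vK.𝔓 [ 1ℤ ]
      by-cases (no s⋠) = term∈⇒∈𝔓 k h+q≤h+slack
        (e-terms-𝔓 (Y s r)
            (vL.𝔓-resp (coord-lc (φ (toℕ s) · e r)) (φ-kills (toℕ r) (Fin.toℕ<n s) s⋠)) k)
      by-cases (yes s≼) = let c , close = φ-hits (toℕ r) (Fin.toℕ<n s) s≼
                              c′ , λ≈ = λ-multiple u θ≡ in
        coord-multiple {c = c K.* c′} {u} (vL.𝔓-resp (L.+-congˡ (L.-‿cong (L.≈-trans (L.*-congˡ λ≈)
          (L.≈-trans (L.≈-sym (L.*-assoc _ _ _)) (L.*-congʳ (L.≈-sym (L/K.*-homo c c′)))))))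
          (vLP.𝔓-weaken h+q≤h+slack close))
          λ k≡u → k≢r+s (trans (cong toℕ k≡u) (Fin.toℕ-fromℕ< r+s<))
        where
        open NoCarry (Fin.toℕ<n r) (Fin.toℕ<n s) s≼ using (r+s<; θ+𝔟≡)
        u : Fin (p ^ n)
        u = fromℕ< r+s<
        θ≡ : θ (toℕ r) ℤ.+ 𝔟 (toℕ s) ≡ θ (toℕ u) [mod p ^ n ]
        θ≡ = subst (_≡ θ (toℕ u) [mod p ^ n ])
          (trans (cong (λ v → θ v ℤ.+ (D (toℕ r ℕ.+ toℕ s) ℤ.- D (toℕ r)) ℤ.* q)
              (Fin.toℕ-fromℕ< r+s<))
            (trans (cong (λ z → θ (toℕ r ℕ.+ toℕ s) ℤ.+ z)
                (ℤ.*-comm (D (toℕ r ℕ.+ toℕ s) ℤ.- D (toℕ r)) q)) (sym θ+𝔟≡)))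
          (mod-+-multiple (θ (toℕ u)) (D (toℕ r ℕ.+ toℕ s) ℤ.- D (toℕ r)))

    -- A coordinate outside 𝔓_K forces the valuation b + 𝔟 s - q * W s below h + q. Hence (𝔟 s + b -
    -- h) / q < W s + 1, and rounding down gives the claim.
    Y₀-diagonal : ∀ s → ¬ Y s 0F s ∈ vK.𝔓 [ 1ℤ ] → D (toℕ s) ℤ.≤ W (toℕ s)
    Y₀-diagonal s Y∉ = by-cases (h ℤ.+ q ℤ.≤? V)
      where
      V : ℤ
      V = q ℤ.* (ℤ.- W (toℕ s)) ℤ.+ (b ℤ.+ 𝔟 (toℕ s))
      v-φ₀ : vL.v (φ (toℕ s) · e 0F) ≡ [ V ]
      v-φ₀ = φ-v {toℕ s} (v-Ψ^ρ (subst (λ t → vL.v (λ- t) ≡ [ b ]) (sym θ0F≡b) (v-λ b)) (toℕ s))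
      by-cases : Dec (h ℤ.+ q ℤ.≤ V) → D (toℕ s) ℤ.≤ W (toℕ s)
      by-cases (yes h+q≤V) = contradiction (term∈⇒∈𝔓 s h+q≤V
        (e-terms-𝔓 (Y s 0F)
            (vL.𝔓-resp (coord-lc (φ (toℕ s) · e 0F)) (vLP.v⇒∈𝔓 v-φ₀ ℤ.≤-refl)) s)) Y∉
      by-cases (no h+q≰V) = subst (D (toℕ s) ℤ.≤_) (ℤ.pred-suc (W (toℕ s))) (ℤ.i<j⇒i≤pred[j]
        (ℤ.*-cancelˡ-<-nonNeg {D (toℕ s)} {ℤ.suc (W (toℕ s))} q
          (<-from (ℤ.+-mono-≤ (qD≤ (toℕ s)) (ℤ.i<j⇒suc[i]≤j (ℤ.≰⇒> h+q≰V)))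
            (lem (𝔟 (toℕ s)) b h q (D (toℕ s)) (W (toℕ s))))))
        where
        lem : ∀ x b h q D W →
            x ℤ.+ b ℤ.- h ℤ.+ (h ℤ.+ q) ℤ.- (q ℤ.* D ℤ.+ (1ℤ ℤ.+ (q ℤ.* (ℤ.- W) ℤ.+ (b ℤ.+ x)))) ≡
          q ℤ.* (1ℤ ℤ.+ W) ℤ.- (1ℤ ℤ.+ q ℤ.* D)
        lem = solve-∀

    -- Modulo 𝔓_K the coordinates of the Φ^(s) · η form a triangular matrix, which is invertible since the
    -- Φ^(s) · η span the lattice; its diagonal entries are multiples of those for η = λ_b.
    cyclic⇒D≤W : ∀ {η} → η ∈ vL.𝔓 [ h ] → (∀ k → ∃ λ α → α ∈ Member𝔄 × e k L.≈ α · η) →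
                 ∀ s → D (toℕ s) ℤ.≤ W (toℕ s)
    cyclic⇒D≤W {η} η∈ cyclic s = Y₀-diagonal s λ Y∈ → X-units s (vKP.𝔓-transportʳ (X-leading s)
      (vKP.𝔒-*-𝔓 (coord-𝔒 η∈ 0F) Y∈))
      where
      X : Fin (p ^ n) → Fin (p ^ n) → K.Carrier
      X s = coord (φ (toℕ s) · η)

      X-sum : ∀ s k → X s k K.≈ ΣK.sum (λ r → coord η r K.* Y s r k)
      X-sum s = coord-linear (coord η) (λ r → φ (toℕ s) · e r)
        (L.≈-trans (*ₗ-congˡ (coord-lc η)) (·-lcL (φ (toℕ s)) (coord η) e))

      term-off : ∀ s r k → ¬ toℕ k ≡ toℕ r ℕ.+ toℕ s → coord η r K.* Y s r k ∈ vK.𝔓 [ 1ℤ ]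
      term-off s r k k≢r+s = vKP.𝔒-*-𝔓 (coord-𝔒 η∈ r) (Y-off s r k k≢r+s)

      -- A term that is nonzero modulo 𝔓_K needs k = r + s, hence s ≤ k.
      X-upper : ∀ {s k} → toℕ k ℕ.< toℕ s → X s k ∈ vK.𝔓 [ 1ℤ ]
      X-upper {s} {k} k<s = vK.𝔓-resp (K.≈-sym (X-sum s k)) (vKP.𝔓-sum λ r → term-off s r k
        λ k≡r+s → ℕ.<⇒≱ k<s (subst (toℕ s ℕ.≤_) (sym k≡r+s) (ℕ.m≤n+m (toℕ s) (toℕ r))))

      -- On the diagonal k = s the condition k = r + s leaves only r = 0.
      X-leading : ∀ s → (X s s K.- coord η 0F K.* Y s 0F s) ∈ vK.𝔓 [ 1ℤ ]
      X-leading s = vK.𝔓-resp (K.+-congʳ (K.≈-sym (X-sum s s)))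
        (vKP.sum-single-𝔓 {f = λ r → coord η r K.* Y s r s} 0F λ r r≢0 → term-off s r s λ s≡r+s →
          r≢0 (Fin.toℕ-injective
              (trans (ℕ.+-cancelʳ-≡ (toℕ s) (toℕ r) 0 (sym s≡r+s)) (sym (Fin.toℕ-fromℕ< q-pos)))))

      -- Coordinates in Φ of the elements carrying η to the basis vectors; they are integral because
      -- Φ is an 𝔒_K-basis of 𝔄 in the strong case.
      B : Fin (p ^ n) → Fin (p ^ n) → K.Carrier
      B k = proj₁ (Φ-spans (proj₁ (cyclic k)))

      B-lc : ∀ k → proj₁ (cyclic k) A.≈ lcA (B k) (Φ π h b)
      B-lc k = proj₂ (Φ-spans (proj₁ (cyclic k)))

      B-𝔒 : ∀ k i → B k i ∈ vK.𝔓 [ 0ℤ ]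
      B-𝔒 k = integral (B k) λ x x∈ → vL.𝔓-resp (*ₗ-congʳ (B-lc k)) (proj₁ (proj₂ (cyclic k)) x x∈)

      BX≈δ : ∀ k j → ΣK.sum (λ s → B k s K.* X s j) K.≈ LM.δ k j
      BX≈δ k j = K.≈-trans (K.≈-sym (coord-linear (B k) (λ s → φ (toℕ s) · η)
        (L.≈-trans (proj₂ (proj₂ (cyclic k)))
            (L.≈-trans (*ₗ-congʳ (B-lc k)) (lcA-· (B k) (Φ π h b) η))) j))
        (coord-e k j)

      X-units : ∀ s → ¬ X s s ∈ vK.𝔓 [ 1ℤ ]
      X-units = vKP.triangular-units (p ^ n) B X B-𝔒 (λ s → coord-𝔒 (Φ∈𝔄 s η η∈))
          (λ {s} {k} → X-upper {s} {k})
        (λ {k} {j} j<k → vKP.≈0⇒∈𝔓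
            (K.≈-trans (BX≈δ k j)
                (K.reflexive (LM.δ-off-diagonal λ j≡k → ℕ.<-irrefl (cong toℕ j≡k) j<k))))
        (λ k BX∈ → 1≰0
            (subst ([ 1ℤ ] ≤∞_)
                (trans (vK.v-cong
                    (K.≈-trans (BX≈δ k k) (K.reflexive (LM.δ-diagonal k)))) vK.v1) BX∈))
        where
        1≰0 : ¬ [ 1ℤ ] ≤∞ [ 0ℤ ]
        1≰0 = vKP.<⇒≱∞ (ℤ.+<+ (ℕ.s≤s ℕ.z≤n))

  π^-cancel : ∀ m c → π K.^ᶻ m K.* c K.≈ K.0# → c K.≈ K.0#
  π^-cancel m c πc≈0 = by-cases (vKP.≈0? c)
    where
    by-cases : Dec (c K.≈ K.0#) → c K.≈ K.0#
    by-cases (yes c≈0) = c≈0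
    by-cases (no c≉0)  = let i , v-c = vKP.≉0⇒v c≉0 in
      contradiction πc≈0 (vKP.v-finite (vKP.v-*-finite (vKP.v-^ᶻ v-π m) v-c))

  clear-denominators : (c : Fin (p ^ n) → K.Carrier) → ∃ λ m → ∀ i →
      π K.^ᶻ (+ m) K.* c i ∈ vK.𝔓 [ 0ℤ ]
  clear-denominators c = let m , c∈ = vKP.bounded-below c in m , λ i →
    vKP.𝔓-weaken (ℤ.≤-reflexive (sym (ℤ.+-inverseʳ (+ m))))
      (vK.𝔓-* (vKP.v⇒∈𝔓 (vKP.v-^ᶻ v-π (+ m)) ℤ.≤-refl) (c∈ i))

  cleared-· : ∀ m (c : Fin (p ^ n) → K.Carrier) x →
              lcA (λ i → π K.^ᶻ (+ m) K.* c i) (Φ π h b) · x L.≈ ι (π K.^ᶻ (+ m)) L.* lcL c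
                  (λ i → Φ π h b i · x)
  cleared-· m c x = L.≈-trans (lcA-· (λ i → π K.^ᶻ (+ m) K.* c i) (Φ π h b) x)
    (L.≈-sym (LM.lc-scale (π K.^ᶻ (+ m)) c (λ i → Φ π h b i · x)))

  cleared∈𝔄 : ∀ m (c : Fin (p ^ n) → K.Carrier) → (∀ i → π K.^ᶻ (+ m) K.* c i ∈ vK.𝔓 [ 0ℤ ]) →
              lcA (λ i → π K.^ᶻ (+ m) K.* c i) (Φ π h b) ∈ Member𝔄
  cleared∈𝔄 m c c∈ = lc∈𝔄 (λ i → π K.^ᶻ (+ m) K.* c i) c∈ Φ∈𝔄

  -- A free lattice has rank one over 𝔄.

  module Rank {I : Set l} (f : I → LeftModule.Carrierᴹ 𝔓ᴸ-over-𝔄)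
      (f-basis : IsBasis 𝔓ᴸ-over-𝔄 f) where
    open IsBasis f-basis

    E : I → L.Carrier
    E i = proj₁ (f i)

    faithful : ∀ i α → α ∈ Member𝔄 → α · E i L.≈ L.0# → α A.≈ A.0#
    faithful i α α∈ αE≈0 = independent {1} (λ _ → i) (λ { {zero} {zero} _ → refl }) (λ _ → α , α∈)
      (L.≈-trans (L.+-identityʳ (α · E i)) αE≈0) zero

    -- Freeness forbids annihilation only by elements of 𝔄. A power of π carries a relation with
    -- coefficients in K into 𝔄, and is cancelled afterwards.
    orbit-independent : ∀ i → LM.Independent (orbit (E i))
    orbit-independent i c lc≈0 j = let m , c∈ = clear-denominators c in
      π^-cancel (+ m) (c j) (Φ-independent {τ = λ j → j} (λ e → e) (λ j → π K.^ᶻ (+ m) K.* c j)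
        (faithful i _ (cleared∈𝔄 m c c∈)
          (L.≈-trans (cleared-· m c (E i)) (L.≈-trans (L.*-congˡ lc≈0) (L.zeroʳ _)))) j)

    orbit-spans : ∀ i → LM.Spans (orbit (E i))
    orbit-spans i = LinearDependence.independent⇒spans K vKP.≈0? L/K.asLeftModule
      (IsTotallyRamified.hasDegree totallyRamified) (orbit-independent i)

    π^∈𝔄 : ∀ m → A/K.structureMap (π K.^ᶻ (+ m)) ∈ Member𝔄
    π^∈𝔄 m x x∈ = vL.𝔓-resp (L.≈-sym (·-K-linear (π K.^ᶻ (+ m)) x))
      (𝔒-*-𝔓ᴸ (vKP.v⇒∈𝔓 (vKP.v-^ᶻ v-π (+ m)) (ℤ.+≤+ ℕ.z≤n)) x∈)

    π^≉0 : ∀ m → ¬ A/K.structureMap (π K.^ᶻ (+ m)) A.≈ A.0#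
    π^≉0 m π^≈0 = vLP.v-finite (v-ι-* (vKP.v-^ᶻ v-π (+ m)) (v-λ b))
      (L.≈-trans (L.≈-sym (·-K-linear (π K.^ᶻ (+ m)) (λ- b)))
          (L.≈-trans (*ₗ-congʳ π^≈0) (*ₗ-zeroˡ (λ- b))))

    -- Each orbit of 𝔄 on a basis element already spans L over K, so two distinct basis elements are dependent.
    rank-one : ∀ i j → ¬ ¬ i ≡ j
    -- Expanding `E i` in the orbit of `E j` and clearing denominators gives π^m · E i - β′ · E j =
    -- 0, a relation over 𝔄 whose first coefficient is nonzero.
    rank-one i j i≢j = π^≉0 m (independent pair pair-injective coefficients relation zero)
      where
      c : Fin (p ^ n) → K.Carrier
      c = proj₁ (orbit-spans j (E i))
      m : ℕ
      m = proj₁ (clear-denominators c)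
      β′ : A.Carrier
      β′ = lcA (λ s → π K.^ᶻ (+ m) K.* c s) (Φ π h b)
      β∈ : β′ ∈ Member𝔄
      β∈ = cleared∈𝔄 m c (proj₂ (clear-denominators c))
      pair : Fin 2 → I
      pair zero    = i
      pair (suc _) = j
      pair-injective : Injective _≡_ _≡_ pair
      pair-injective {zero}     {zero}     _ = refl
      pair-injective {zero}     {suc zero} e = contradiction e i≢j
      pair-injective {suc zero} {zero}     e = contradiction (sym e) i≢j
      pair-injective {suc zero} {suc zero} _ = refl
      coefficients : Fin 2 → Ring.Carrier (Subring.subring 𝔄)
      coefficients zero    = A/K.structureMap (π K.^ᶻ (+ m)) , π^∈𝔄 m
      coefficients (suc _) = A.- β′ , Subring.neg-closed 𝔄 {β′} β∈
      relation : A/K.structureMap (π K.^ᶻ (+ m)) · E i L.+ ((A.- β′) · E j L.+ L.0#) L.≈ L.0#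
      relation = begin
        A/K.structureMap (π K.^ᶻ (+ m)) · E i L.+ ((A.- β′) · E j L.+ L.0#)
          ≈⟨ L.+-cong
              (L.≈-trans (·-K-linear (π K.^ᶻ (+ m)) (E i))
                  (L.*-congˡ (proj₂ (orbit-spans j (E i)))))
               (L.+-identityʳ _) ⟩
        ι (π K.^ᶻ (+ m)) L.* lcL c (orbit (E j)) L.+ (A.- β′) · E j
          ≈⟨ L.+-congʳ (cleared-· m c (E j)) ⟨
        β′ · E j L.+ (A.- β′) · E j
          ≈⟨ *ₗ-distribʳ (E j) β′ (A.- β′) ⟨
        (β′ A.+ A.- β′) · E j
          ≈⟨ L.≈-trans (*ₗ-congʳ (A.-‿inverseʳ β′)) (*ₗ-zeroˡ (E j)) ⟩
        L.0# ∎
        where open SetoidReasoning L.setoid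

    collapse : ∀ {N} j (τ : Fin N → I) (c : Fin N → Ring.Carrier (Subring.subring 𝔄)) →
        (∀ i → τ i ≡ j) →
               ∃ λ α → α ∈ Member𝔄 × proj₁ (linearCombination 𝔓ᴸ-over-𝔄 c (f ∘ τ)) L.≈ α · E j
    collapse {zero}  j τ c τ≡j = A.0# , Subring.0-closed 𝔄 , L.≈-sym (*ₗ-zeroˡ (E j))
    collapse {suc N} j τ c τ≡j =
      let α , α∈ , lc≈ = collapse j (τ ∘ suc) (c ∘ suc) (τ≡j ∘ suc) in
      proj₁ (c zero) A.+ α , Subring.+-closed 𝔄 {proj₁ (c zero)} {α} (proj₂ (c zero)) α∈ ,
      L.≈-trans (L.+-cong (L.reflexive (cong (λ i → proj₁ (c zero) · E i) (τ≡j zero))) lc≈)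
        (L.≈-sym (*ₗ-distribʳ (E j) (proj₁ (c zero)) α))

    -- All indices in an expansion of x equal `j` up to double negation; once they do, the
    -- coefficients merge into one.
    cyclic : ∀ j x → x ∈ vL.𝔓 [ h ] → ¬ ¬ (∃ λ α → α ∈ Member𝔄 × x L.≈ α · E j)
    cyclic j x x∈ x∉ = let N , τ , c , x≈ = spanning (x , x∈) in
      ¬¬-all (λ i → rank-one (τ i) j) λ τ≡j →
        let α , α∈ , lc≈ = collapse j τ c τ≡j in x∉ (α , α∈ , L.≈-trans x≈ lc≈)

    -- An empty expansion of the nonzero element λ_b is impossible.
    inhabited : I
    inhabited = let N , τ , c , λ≈ = spanning (λ- b , v≡b⇒∈𝔓 (v-λ b)) in first N τ c λ≈
      where
      first : ∀ N (τ : Fin N → I) c → λ- b L.≈ proj₁ (linearCombination 𝔓ᴸ-over-𝔄 c (f ∘ τ)) → I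
      first zero    τ c λ≈ = ⊥-elim (vLP.v-finite (v-λ b) λ≈)
      first (suc N) τ c λ≈ = τ zero

    D≤W : q ℤ.+ b ℤ.- h ℤ.≤ N → ∀ s → D (toℕ s) ℤ.≤ W (toℕ s)
    -- Decidability of ≤ on the integers removes the double negations, taken over all basis vectors
    -- `e k` at once.
    D≤W strong s = decidable-stable (D (toℕ s) ℤ.≤? W (toℕ s)) λ D≰W →
      ¬¬-all (λ k → cyclic inhabited (e k) (vLP.v⇒∈𝔓 (v-λ (θ (toℕ k))) (h≤θ (toℕ k))))
        λ e-cyclic → D≰W (Freeness.cyclic⇒D≤W strong (proj₂ (f inhabited)) e-cyclic s)

  strong-case : q ℤ.+ b ℤ.- h ℤ.≤ N →
      Has𝔒K-Basis (Φ π h b)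
    × (IsFree 𝔓ᴸ-over-𝔄 ⇔ (∀ (s : Fin (p ^ n)) → W (toℕ s) ≡ D (toℕ s)))
    × ((∀ (s : Fin (p ^ n)) → W (toℕ s) ≡ D (toℕ s)) → ∀ ρ → vL.v ρ ≡ [ b ] → 𝔓ᴸ≐𝔄· ρ)
  strong-case strong =
    𝔒-coefficients⇒basis (StrongTolerance.integral strong) ,
    mk⇔ (λ (I , f , f-basis) s → ℤ.≤-antisym (W≤D (Fin.toℕ<n s)) (Rank.D≤W f f-basis strong s))
        (λ W≡D → TightWeights.free W≡D (v-λ b)) ,
    λ W≡D ρ v-ρ → TightWeights.generates W≡D v-ρ

  weak-case :
      (∀ s → Φ π h b s ∈ Member𝔄)
    × ((∀ (s : Fin (p ^ n)) → W (toℕ s) ≡ D (toℕ s)) →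
         Has𝔒K-Basis (Φ π h b) × IsFree 𝔓ᴸ-over-𝔄 × 𝔓ᴸ≐𝔄· (λ- b))
  weak-case = Φ∈𝔄 , λ W≡D →
    𝔒-coefficients⇒basis (TightWeights.integral W≡D (v-λ b)) ,
    TightWeights.free W≡D (v-λ b) , TightWeights.generates W≡D (v-λ b)

-- Choice of the finite tolerance in the two cases.

open import Data.Integer.Base using (_+_; _-_; _⊔_; _≤_; _<_)

theorem3p1 :
  ∀ {k ℓk l ℓl a ℓa} (S : Setting k ℓk l ℓl a ℓa) →
  let open Setting S in
  (β : ShiftParameters p n) (𝔗 : ℤ∞) (scaffold : Scaffold S β 𝔗) →
  let open Shifts p-prime β
      open Scaffold scaffold in
  (π : K.Carrier) → vK.IsUniformizer π →
  (h b : ℤ) → h ≤ b → b < h + + (p ^ n) → suc (𝔞 b) ≡ p ^ n →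
  let open AssociatedOrder S h in
  ( [ + (p ^ n) + b - h ] ≤∞ 𝔗 →
      Has𝔒K-Basis (Φ π h b)
    × (IsFree 𝔓ᴸ-over-𝔄 ⇔ (∀ (s : Fin (p ^ n)) → w h b (toℕ s) ≡ d h b (toℕ s)))
    × ((∀ (s : Fin (p ^ n)) → w h b (toℕ s) ≡ d h b (toℕ s)) →
         ∀ ρ → vL.v ρ ≡ [ b ] → 𝔓ᴸ≐𝔄· ρ))
  ×
  ( [ (b - h) ⊔ 1ℤ ] ≤∞ 𝔗 →
      (∀ s → Φ π h b s ∈ Member𝔄)
    × ((∀ (s : Fin (p ^ n)) → w h b (toℕ s) ≡ d h b (toℕ s)) →
         Has𝔒K-Basis (Φ π h b) × IsFree 𝔓ᴸ-over-𝔄 × 𝔓ᴸ≐𝔄· (λ- b)))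
theorem3p1 S β 𝔗 scaffold π v-π h b h≤b b<h+q 𝔞b =
  -- In both cases `N` is the assumed lower bound of the tolerance itself, which keeps it finite
  -- even when the tolerance is infinite.
  (λ N≤𝔗 → AssociatedOrderBasis.strong-case S β 𝔗 scaffold
    (q + b - h) 1≤q+b-h N≤𝔗 π v-π h b h≤b b<h+q 𝔞b b-h≤q+b-h ℤ.≤-refl) ,
  (λ N≤𝔗 → AssociatedOrderBasis.weak-case S β 𝔗 scaffold
    ((b - h) ⊔ 1ℤ) (ℤ.i≤j⊔i (b - h) 1ℤ) N≤𝔗 π v-π h b h≤b b<h+q 𝔞b (ℤ.i≤i⊔j (b - h) 1ℤ))
  where
  open Ramified S using (q; q-positive)

  1≤q+b-h : 1ℤ ≤ q + b - h
  1≤q+b-h = ≤-from (ℤ.+-mono-≤ (ℤ.i<j⇒suc[i]≤j (ℤ.positive⁻¹ q ⦃ q-positive ⦄)) h≤b) (lem q b h)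
    where
    lem : ∀ q b h → q + b - (1ℤ + h) ≡ q + b - h - 1ℤ
    lem = solve-∀

  b-h≤q+b-h : b - h ≤ q + b - h
  b-h≤q+b-h = ≤-from (ℤ.<⇒≤ (ℤ.positive⁻¹ q ⦃ q-positive ⦄)) (lem q b h)
    where
    lem : ∀ q b h → q - (+ 0) ≡ q + b - h - (b - h)
    lem = solve-∀
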